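{- Let $\varphi$ be a minimal counterexample to Vaught's conjecture, and let $\lambda\in S^\circ=\mathfrak F\cap C_{5.3}\cap(\mathrm{qr}(\varphi),\omega_1)$ with $T_\lambda$, $B_\lambda$ as described in the context. Any two countable models $M,M'$ of $T_\lambda$ with $\omega_1^M=\omega_1^{M'}=\lambda$ which each realize every $n$-type of $T_\lambda$ (all $n\ge1$) are isomorphic. Moreover $B_\lambda$ realizes every $n$-type of $T_\lambda$ and $\omega_1^{B_\lambda}=\lambda$; hence $B_\lambda$ is, up to isomorphism, the unique model of $T_\lambda$ with $\omega_1=\lambda$ that realizes every $n$-type of $T_\lambda$.
   Context: Structures are countable structures in a countable vocabulary; classes of models are counted up to isomorphism. $\Sigma^{\mathrm{in}}_0=\Pi^{\mathrm{in}}_0$ is the set of finitary quantifier-free formulas; for $\alpha>0$, $\Sigma^{\mathrm{in}}_\alpha$ consists of countable disjunctions of formulas $\exists\bar x\,\psi$ with $\psi\in\Pi^{\mathrm{in}}_\beta$, $\beta<\alpha$, and $\Pi^{\mathrm{in}}_\alpha$ is dual. $M\equiv_\alpha N$: $M,N$ satisfy the same $\Pi^{\mathrm{in}}_\alpha$ (equivalently $\Sigma^{\mathrm{in}}_\alpha$) sentences. A Scott sentence of $M$ is an $L_{\omega_1\omega}$ sentence whose countable models are exactly the copies of $M$. $\mathrm{cSR}(M)$: the least $\alpha$ such that $M$ has a $\Pi^{\mathrm{in}}_{\alpha+1}$ Scott sentence. $\omega_1^A=\min\{\omega_1^X: X\in 2^\omega\text{ computes a copy of }A\}$. $\mathrm{qr}(S)$: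 the least $\beta$ with $S\in\Pi^{\mathrm{in}}_\beta\cup\Sigma^{\mathrm{in}}_\beta$. Standing hypotheses: Vaught's conjecture fails, and $\varphi$ is a minimal counterexample: an $L_{\omega_1\omega}$ sentence with exactly $\aleph_1$ countable models up to isomorphism, scattered (for each $\alpha<\omega_1$ at most countably many $\equiv_\alpha$-classes among its models), and such that for every $L_{\omega_1\omega}$ sentence $\psi$ one of $\varphi\wedge\psi$, $\varphi\wedge\neg\psi$ has only countably many models. Moreover for each $\alpha<\omega_1$ only countably many $\Sigma^{\mathrm{in}}_\alpha$-types are realized in models of $\varphi$. For each $\beta<\omega_1$ exactly one $\equiv_\beta$-class of models of $\varphi$ is uncountable, denoted $\mathcal C_\beta$. $f(\alpha)=\min\{\beta:(\forall M\models\varphi)(M\notin\mathcal C_\alpha\Rightarrow\mathrm{cSR}(M)<\beta)\}$, $\mathfrak F=\{\alpha<\omega_1:f(\alpha)\le\alpha\}$. Sacks rank. A fragment is a countable set of $L_{\omega_1\omega}$ formulas closed under subformulas, substitution and the finitary connectives and quantifiers. For a structure $A$: $L^A_0$ is the finitary language; $T^A_\delta=\mathrm{Th}_{L^A_\delta}(A)$; $L^A_{\delta+1}$ is the least fragment containing $L^A_\delta$ and $\bigwedge p$ for every non-principal complete $L^A_\delta$-type $p$ realized in $A$; unions at limits. $\mathrm{sr}_{\mathrm{Sacks}}(A)$ is the least $\delta$ such that $A$ is the atomic model of $T^A_\delta$. Tree of nodes. $L_0$ is the fragment generated by $\varphi$, and $T$ is $\{\varphi\}$ together with the tautologies of $L_0$.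 A theory $T'$ in a fragment $L'$ is $\omega$-complete if for each sentence $F\in L'$, $F\in T'$ or $\neg F\in T'$, and whenever $\bigvee_iF_i\in T'$, some $F_i\in T'$; it is finitarily consistent if no contradiction is derivable from it by finite-length deductions. Nodes on level $0$: finitarily consistent $\omega$-complete extensions of $T$ in $L_0$. An $n$-type of a node $S$ (in fragment $L_S$) is a maximal set of $L_S(\bar x)$-formulas finitarily consistent with $S$; it is principal if generated over $S$ by one of its formulas. Nodes on level $\delta+1$: finitarily consistent $\omega$-complete extensions of a level-$\delta$ node $S$ in $L'_S$, the least fragment containing $L_S$ and $\bigwedge p$ for each non-principal $n$-type $p$ of $S$. Nodes on limit levels: unions along chains. Every model of a node is a model of $\varphi$. Fixed data, supplied by a theorem of Sacks (Bounds on weak scattering, Prop. 5.2 and Thm. 5.3): an increasing branch $(T_\delta)_{\delta<\omega_1}$ of nodes, $T_\delta$ on level $\delta$, unions at limits, $\Delta_1$ over $L(\omega_1,T)$, such that every $T_\delta$ has an atomic model of $\mathrm{sr}_{\mathrm{Sacks}}$ exactly $\delta$; and a club $C_{5.3}\subseteq\omega_1$ (the ordinals $\omega_1^{L(\beta_\delta,T)}$ for the transitive collapses $L(\beta_\delta,T)$ of the $\Sigma_1$-hulls in Sacks' proof) such that for each $\lambda\in C_{5.3}$: $\lambda>\omega$ and $L(\lambda,T)$ is $\Sigma_1$-admissible; the set of non-principal $n$-types of $T_\lambda$ is non-empty and countable; $A_\lambda$ is an atomic model of $T_\lambda$ with $\mathrm{sr}_{\mathrm{Sacks}}(A_\lambda)=\lambda$;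 $B_\lambda\models T_\lambda$ realizes every non-principal $n$-type of $T_\lambda$, $\omega_1^{B_\lambda}=\lambda$ and $\mathrm{sr}_{\mathrm{Sacks}}(B_\lambda)=\lambda+1$. -}

module Defs where

open import Level using (Level)
open import Data.Bool.Base using (Bool; if_then_else_)
open import Data.Empty using (⊥)
open import Data.Fin.Base using (Fin; zero; suc; toℕ)
open import Data.List.Base as List using (List; []; _∷_)
open import Data.List.Membership.Propositional using () renaming (_∈_ to _∈ˡ_)
open import Data.Nat.Base as ℕ using (ℕ; zero; suc; _+_; _*_; _^_)
open import Data.Product.Base using (Σ; Σ-syntax; ∃-syntax; _×_; _,_; proj₁; proj₂)
open import Data.Sum.Base using (_⊎_; inj₁; inj₂)
open import Data.Unit.Base using (⊤)
open import Data.Vec.Base as Vec using (Vec; []; _∷_; lookup)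
open import Function.Base using (_∘_)
open import Function.Bundles using (_⇔_; _↔_; module Inverse)
open import Function.Definitions using (Injective)
open import Relation.Binary.PropositionalEquality.Core using (_≡_)
open import Relation.Nullary.Negation.Core using (¬_)

private variable
  ℓ   : Level
  n m : ℕ

------------------------------------------------------------------------
-- Countable ordinals

-- Every countable ordinal has a notation, where lim f denotes the supremum
-- of the f i (f need not be increasing).  Hence the type Ord, modulo _≈_,
-- is ω₁.

data Ord : Set where
  zero : Ord
  suc  : Ord → Ord
  lim  : (ℕ → Ord) → Ord

infix 4 _≤_ _<_ _≈_

_≤_ : Ord → Ord → Set
zero  ≤ β     = ⊤
suc α ≤ zero  = ⊥
suc α ≤ suc β = α ≤ β
suc α ≤ lim g = ∃[ i ] suc α ≤ g i
lim f ≤ β     = ∀ i → f i ≤ β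

_<_ : Ord → Ord → Set
α < β = suc α ≤ β

_≈_ : Ord → Ord → Set
α ≈ β = α ≤ β × β ≤ α

fromℕ : ℕ → Ord
fromℕ zero    = zero
fromℕ (suc k) = suc (fromℕ k)

ω : Ord
ω = lim fromℕ

IsLimit : Ord → Set
IsLimit δ = zero < δ × (∀ γ → γ < δ → suc γ < δ)

Least : (Ord → Set ℓ) → Ord → Set ℓ
Least P α = P α × (∀ β → P β → α ≤ β)

record Club (C : Ord → Set) : Set where
  field
    resp      : ∀ α β → α ≈ β → C α → C β
    unbounded : ∀ α → ∃[ β ] (α < β × C β)
    closed    : ∀ δ → IsLimit δ →
                (∀ γ → γ < δ → ∃[ β ] (γ < β × β < δ × C β)) → C δ

------------------------------------------------------------------------
-- Relative computability

-- μ-recursive functions with an oracle.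
data Rec : ℕ → Set where
  zeroᶠ   : Rec 0
  sucᶠ    : Rec 1
  oracleᶠ : Rec 1
  projᶠ   : Fin n → Rec n
  compᶠ   : Rec m → Vec (Rec n) m → Rec n
  primᶠ   : Rec n → Rec (suc (suc n)) → Rec (suc n)
  μᶠ      : Rec (suc n) → Rec n

infix 4 _⊢_[_]⇓_ _⊢_[_]⇓*_

mutual
  data _⊢_[_]⇓_ (X : ℕ → Bool) : ∀ {n} → Rec n → Vec ℕ n → ℕ → Set where
    ⇓zero   : X ⊢ zeroᶠ [ [] ]⇓ 0
    ⇓suc    : ∀ {x} → X ⊢ sucᶠ [ x ∷ [] ]⇓ suc x
    ⇓oracle : ∀ {x} → X ⊢ oracleᶠ [ x ∷ [] ]⇓ (if X x then 1 else 0)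
    ⇓proj   : ∀ {n} {i : Fin n} {v} → X ⊢ projᶠ i [ v ]⇓ lookup v i
    ⇓comp   : ∀ {n m} {g : Rec m} {hs : Vec (Rec n) m} {v ws y} →
              X ⊢ hs [ v ]⇓* ws → X ⊢ g [ ws ]⇓ y → X ⊢ compᶠ g hs [ v ]⇓ y
    ⇓prim₀  : ∀ {n} {g : Rec n} {h v y} →
              X ⊢ g [ v ]⇓ y → X ⊢ primᶠ g h [ 0 ∷ v ]⇓ y
    ⇓prim₊  : ∀ {n} {g : Rec n} {h v k y z} →
              X ⊢ primᶠ g h [ k ∷ v ]⇓ y → X ⊢ h [ k ∷ y ∷ v ]⇓ z →
              X ⊢ primᶠ g h [ suc k ∷ v ]⇓ z
    ⇓μ      : ∀ {n} {g : Rec (suc n)} {v y} →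
              X ⊢ g [ y ∷ v ]⇓ 0 →
              (∀ k → k ℕ.< y → ∃[ z ] X ⊢ g [ k ∷ v ]⇓ suc z) →
              X ⊢ μᶠ g [ v ]⇓ y

  data _⊢_[_]⇓*_ (X : ℕ → Bool) {n} : ∀ {m} → Vec (Rec n) m → Vec ℕ n → Vec ℕ m → Set where
    []  : ∀ {v} → X ⊢ [] [ v ]⇓* []
    _∷_ : ∀ {m g} {gs : Vec (Rec n) m} {v y ys} →
          X ⊢ g [ v ]⇓ y → X ⊢ gs [ v ]⇓* ys → X ⊢ g ∷ gs [ v ]⇓* (y ∷ ys)

Computes : (ℕ → Bool) → (Vec ℕ n → Set) → Set
Computes {n} X P =
  Σ[ c ∈ Rec n ] (∀ v → (P v × X ⊢ c [ v ]⇓ 1) ⊎ (¬ P v × X ⊢ c [ v ]⇓ 0))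

-- A bijection between lists of natural numbers and natural numbers.
codeList : List ℕ → ℕ
codeList []       = 0
codeList (x ∷ xs) = 2 ^ x * (1 + 2 * codeList xs)

ComputesList : (ℕ → Bool) → (List ℕ → Set) → Set
ComputesList X P =
  Computes X (λ (v : Vec ℕ 1) → ∃[ xs ] (Vec.head v ≡ codeList xs × P xs))

-- (D , ≺) is a linear order of order type α: g is an isomorphism from it
-- onto the ordinals below α.
HasOrderType : (Vec ℕ 1 → Set) → (Vec ℕ 2 → Set) → Ord → Set
HasOrderType D R α = Σ[ g ∈ (ℕ → Ord) ]
    (∀ x → D (x ∷ []) → g x < α)
  × (∀ β → β < α → ∃[ x ] (D (x ∷ []) × g x ≈ β))
  × (∀ x y → D (x ∷ []) → D (y ∷ []) → g x ≈ g y → x ≡ y)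
  × (∀ x y → D (x ∷ []) → D (y ∷ []) → R (x ∷ y ∷ []) ⇔ g x < g y)

ComputableOrdinal : (ℕ → Bool) → Ord → Set₁
ComputableOrdinal X α = Σ[ D ∈ (Vec ℕ 1 → Set) ] Σ[ R ∈ (Vec ℕ 2 → Set) ]
  (Computes X D × Computes X R × HasOrderType D R α)

-- ω₁^X = α
IsΩ₁ : (ℕ → Bool) → Ord → Set₁
IsΩ₁ X = Least (λ α → ¬ ComputableOrdinal X α)

------------------------------------------------------------------------
-- Countable vocabularies and formulas of L_{ω₁ω}

-- The vocabulary comes with a fixed numbering of its symbols, to which
-- computability of atomic diagrams refers.
record Vocabulary : Set₁ where
  field
    RelSym FunSym : Set
    arʳ           : RelSym → ℕ
    arᶠ           : FunSym → ℕ
    codeʳ         : RelSym → ℕ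
    codeᶠ         : FunSym → ℕ
    codeʳ-inj     : Injective _≡_ _≡_ codeʳ
    codeᶠ-inj     : Injective _≡_ _≡_ codeᶠ

open Vocabulary public

private variable
  τ : Vocabulary

data Term (τ : Vocabulary) (n : ℕ) : Set where
  var : Fin n → Term τ n
  fun : (f : FunSym τ) → Vec (Term τ n) (arᶠ τ f) → Term τ n

mutual
  subᵗ : (Fin n → Term τ m) → Term τ n → Term τ m
  subᵗ σ (var i)    = σ i
  subᵗ σ (fun f ts) = fun f (subᵗˢ σ ts)

  subᵗˢ : ∀ {k} → (Fin n → Term τ m) → Vec (Term τ n) k → Vec (Term τ m) k
  subᵗˢ σ []       = []
  subᵗˢ σ (t ∷ ts) = subᵗ σ t ∷ subᵗˢ σ ts

infix  8 _≐ᶠ_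
infix  9 ¬̇_
infixr 7 _∧̇_
infixr 6 _⇒̇_

-- Formula τ n: free variables are de Bruijn indices below n.  The
-- connectives ∀, →, ⋀ are abbreviations.
data Formula (τ : Vocabulary) : ℕ → Set where
  ⊥̇    : Formula τ n
  _≐ᶠ_ : Term τ n → Term τ n → Formula τ n
  rel  : (R : RelSym τ) → Vec (Term τ n) (arʳ τ R) → Formula τ n
  ¬̇_   : Formula τ n → Formula τ n
  _∧̇_  : Formula τ n → Formula τ n → Formula τ n
  ∃̇    : Formula τ (suc n) → Formula τ n
  ⋁̇    : (ℕ → Formula τ n) → Formula τ n

Sentence : Vocabulary → Set
Sentence τ = Formula τ 0

_⇒̇_ : Formula τ n → Formula τ n → Formula τ n
A ⇒̇ B = ¬̇ (A ∧̇ ¬̇ B)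

∀̇ : Formula τ (suc n) → Formula τ n
∀̇ A = ¬̇ ∃̇ (¬̇ A)

⋀̇ : (ℕ → Formula τ n) → Formula τ n
⋀̇ F = ¬̇ ⋁̇ (λ i → ¬̇ F i)

∃̇* : ∀ k → Formula τ (k + n) → Formula τ n
∃̇* zero    A = A
∃̇* (suc k) A = ∃̇* k (∃̇ A)

∀̇* : ∀ k → Formula τ (k + n) → Formula τ n
∀̇* zero    A = A
∀̇* (suc k) A = ∀̇* k (∀̇ A)

close : ∀ n → Formula τ n → Sentence τ
close zero    A = A
close (suc n) A = close n (∀̇ A)

-- Identity of formulas, in which ⋁̇ F depends only on the set of disjuncts.
data _≋_ {τ : Vocabulary} : ∀ {n} → Formula τ n → Formula τ n → Set where
  ⊥̇    : (⊥̇ {τ} {n}) ≋ ⊥̇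
  _≐ᶠ_ : (s t : Term τ n) → (s ≐ᶠ t) ≋ (s ≐ᶠ t)
  rel  : (R : RelSym τ) (ts : Vec (Term τ n) (arʳ τ R)) → rel R ts ≋ rel R ts
  ¬̇_   : {A B : Formula τ n} → A ≋ B → (¬̇ A) ≋ (¬̇ B)
  _∧̇_  : {A A′ B B′ : Formula τ n} → A ≋ A′ → B ≋ B′ → (A ∧̇ B) ≋ (A′ ∧̇ B′)
  ∃̇    : {A B : Formula τ (suc n)} → A ≋ B → ∃̇ A ≋ ∃̇ B
  ⋁̇    : {F G : ℕ → Formula τ n} →
         (∀ i → ∃[ j ] F i ≋ G j) → (∀ j → ∃[ i ] F i ≋ G j) → ⋁̇ F ≋ ⋁̇ G

infix 4 _≋_

lift : (Fin n → Term τ m) → Fin (suc n) → Term τ (suc m)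
lift σ zero    = var zero
lift σ (suc i) = subᵗ (var ∘ suc) (σ i)

sub : (Fin n → Term τ m) → Formula τ n → Formula τ m
sub σ ⊥̇          = ⊥̇
sub σ (s ≐ᶠ t)   = subᵗ σ s ≐ᶠ subᵗ σ t
sub σ (rel R ts) = rel R (subᵗˢ σ ts)
sub σ (¬̇ A)      = ¬̇ sub σ A
sub σ (A ∧̇ B)    = sub σ A ∧̇ sub σ B
sub σ (∃̇ A)      = ∃̇ (sub (lift σ) A)
sub σ (⋁̇ F)      = ⋁̇ (λ i → sub σ (F i))

ren : (Fin n → Fin m) → Formula τ n → Formula τ m
ren ρ = sub (var ∘ ρ)

instantiate : Term τ n → Formula τ (suc n) → Formula τ n
instantiate t = sub λ { zero → t ; (suc i) → var i }

data QuantifierFree {τ : Vocabulary} {n : ℕ} : Formula τ n → Set where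
  ⊥̇    : QuantifierFree ⊥̇
  _≐ᶠ_ : ∀ s t → QuantifierFree (s ≐ᶠ t)
  rel  : ∀ R ts → QuantifierFree (rel R ts)
  ¬̇_   : ∀ {A} → QuantifierFree A → QuantifierFree (¬̇ A)
  _∧̇_  : ∀ {A B} → QuantifierFree A → QuantifierFree B → QuantifierFree (A ∧̇ B)

mutual
  data Σⁱⁿ {τ : Vocabulary} (α : Ord) {n : ℕ} : Formula τ n → Set where
    qf  : ∀ {A} → α ≈ zero → QuantifierFree A → Σⁱⁿ α A
    ⋁∃  : zero < α → (β : ℕ → Ord) (k : ℕ → ℕ) (ψ : ∀ i → Formula τ (k i + n)) →
          (∀ i → β i < α) → (∀ i → Πⁱⁿ (β i) (ψ i)) →
          Σⁱⁿ α (⋁̇ (λ i → ∃̇* (k i) (ψ i)))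

  data Πⁱⁿ {τ : Vocabulary} (α : Ord) {n : ℕ} : Formula τ n → Set where
    qf  : ∀ {A} → α ≈ zero → QuantifierFree A → Πⁱⁿ α A
    ⋀∀  : zero < α → (β : ℕ → Ord) (k : ℕ → ℕ) (ψ : ∀ i → Formula τ (k i + n)) →
          (∀ i → β i < α) → (∀ i → Σⁱⁿ (β i) (ψ i)) →
          Πⁱⁿ α (⋀̇ (λ i → ∀̇* (k i) (ψ i)))

------------------------------------------------------------------------
-- Countable structures

record Structure (τ : Vocabulary) : Set₁ where
  field
    Carrier   : Set
    point     : Carrier
    countable : Σ[ ι ∈ (Carrier → ℕ) ] Injective _≡_ _≡_ ι
    relᴹ      : (R : RelSym τ) → Vec Carrier (arʳ τ R) → Set
    funᴹ      : (f : FunSym τ) → Vec Carrier (arᶠ τ f) → Carrier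

open Structure public

mutual
  eval : (M : Structure τ) → Vec (Carrier M) n → Term τ n → Carrier M
  eval M v (var i)    = lookup v i
  eval M v (fun f ts) = funᴹ M f (evals M v ts)

  evals : ∀ {k} (M : Structure τ) → Vec (Carrier M) n → Vec (Term τ n) k → Vec (Carrier M) k
  evals M v []       = []
  evals M v (t ∷ ts) = eval M v t ∷ evals M v ts

infix 4 _⊨_[_] _⊨_

_⊨_[_] : (M : Structure τ) → Formula τ n → Vec (Carrier M) n → Set
M ⊨ ⊥̇ [ v ]        = ⊥
M ⊨ s ≐ᶠ t [ v ]   = eval M v s ≡ eval M v t
M ⊨ rel R ts [ v ] = relᴹ M R (evals M v ts)
M ⊨ ¬̇ A [ v ]      = ¬ (M ⊨ A [ v ])
M ⊨ A ∧̇ B [ v ]    = M ⊨ A [ v ] × M ⊨ B [ v ]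
M ⊨ ∃̇ A [ v ]      = ∃[ a ] M ⊨ A [ a ∷ v ]
M ⊨ ⋁̇ F [ v ]      = ∃[ i ] M ⊨ F i [ v ]

_⊨_ : Structure τ → Sentence τ → Set
M ⊨ A = M ⊨ A [ [] ]

infix 4 _≅_

record _≅_ (M N : Structure τ) : Set where
  field
    bij : Carrier M ↔ Carrier N
  open Inverse bij using (to)
  field
    rel-pres : ∀ R v → relᴹ M R v ⇔ relᴹ N R (Vec.map to v)
    fun-pres : ∀ f v → to (funᴹ M f v) ≡ funᴹ N f (Vec.map to v)

-- The atomic diagram of the copy of M obtained by transporting M along an
-- injection ι of its universe into ω.
data Diagram (M : Structure τ) (ι : Carrier M → ℕ) : List ℕ → Set where
  dom : ∀ a → Diagram M ι (0 ∷ ι a ∷ [])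
  rel : ∀ R v → relᴹ M R v → Diagram M ι (1 ∷ codeʳ τ R ∷ List.map ι (Vec.toList v))
  fun : ∀ f v → Diagram M ι (2 ∷ codeᶠ τ f ∷ ι (funᴹ M f v) ∷ List.map ι (Vec.toList v))

ComputesCopy : (ℕ → Bool) → Structure τ → Set
ComputesCopy X M =
  Σ[ ι ∈ (Carrier M → ℕ) ] (Injective _≡_ _≡_ ι × ComputesList X (Diagram M ι))

-- ω₁^M = α
IsΩ₁ᴹ : Structure τ → Ord → Set₁
IsΩ₁ᴹ M = Least (λ α → Σ[ X ∈ (ℕ → Bool) ] (ComputesCopy X M × IsΩ₁ X α))

≡[_] : Ord → Structure τ → Structure τ → Set
≡[ α ] M N = ∀ ψ → Πⁱⁿ α ψ → M ⊨ ψ ⇔ N ⊨ ψ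

ScottSentence : Structure τ → Sentence τ → Set₁
ScottSentence {τ} M ψ = (N : Structure τ) → N ⊨ ψ ⇔ M ≅ N

-- cSR(M) = α
IsCSR : Structure τ → Ord → Set₁
IsCSR M = Least (λ α → ∃[ ψ ] (Πⁱⁿ (suc α) ψ × ScottSentence M ψ))

-- qr(S) = β, where membership of S in a class of formulas is understood up
-- to logical equivalence (an arbitrary L_{ω₁ω} sentence is not literally
-- of the form required by any Πⁱⁿ_β or Σⁱⁿ_β).
IsQr : Sentence τ → Ord → Set₁
IsQr {τ} S = Least (λ β → ∃[ ψ ] ((Πⁱⁿ β ψ ⊎ Σⁱⁿ β ψ)
                                × ((M : Structure τ) → M ⊨ S ⇔ M ⊨ ψ)))

------------------------------------------------------------------------
-- Minimal counterexamples to Vaught's conjecture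

CountablyMany : (Structure τ → Set) → Set₁
CountablyMany {τ} K =
  Σ[ e ∈ (ℕ → Structure τ) ] (∀ M → K M → ∃[ i ] M ≅ e i)

Exactlyℵ₁ : (Structure τ → Set) → Set₁
Exactlyℵ₁ {τ} K = Σ[ e ∈ (Ord → Structure τ) ]
    (∀ α → K (e α))
  × (∀ α β → e α ≅ e β ⇔ α ≈ β)
  × (∀ M → K M → ∃[ α ] M ≅ e α)

-- M ∈ 𝒞_β
In𝒞 : Sentence τ → Ord → Structure τ → Set₁
In𝒞 φ β M = M ⊨ φ × ¬ CountablyMany (λ N → N ⊨ φ × ≡[ β ] N M)

SameΣTypes : Ord → (n : ℕ) → (M : Structure τ) → Vec (Carrier M) n →
             (N : Structure τ) → Vec (Carrier N) n → Set
SameΣTypes {τ} α n M v N w =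
  (ψ : Formula τ n) → Σⁱⁿ α ψ → M ⊨ ψ [ v ] ⇔ N ⊨ ψ [ w ]

record MinimalCounterexample {τ : Vocabulary} (φ : Sentence τ) : Set₁ where
  field
    ℵ₁-models       : Exactlyℵ₁ (_⊨ φ)
    scattered       : ∀ α → Σ[ e ∈ (ℕ → Structure τ) ]
                      (∀ M → M ⊨ φ → ∃[ i ] ≡[ α ] M (e i))
    minimal         : ∀ ψ → CountablyMany (_⊨ φ ∧̇ ψ) ⊎ CountablyMany (_⊨ φ ∧̇ ¬̇ ψ)
    countably-Σ     : ∀ α n → Σ[ e ∈ (ℕ → Σ[ M ∈ Structure τ ] Vec (Carrier M) n) ]
                      (∀ M v → M ⊨ φ →
                       ∃[ i ] SameΣTypes α n M v (proj₁ (e i)) (proj₂ (e i)))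
    𝒞-exists        : ∀ β → ∃[ M ] In𝒞 φ β M
    𝒞-unique        : ∀ β M N → In𝒞 φ β M → In𝒞 φ β N → ≡[ β ] M N

-- f(α) = β
IsF : Sentence τ → Ord → Ord → Set₁
IsF {τ} φ α = Least (λ β → (M : Structure τ) → M ⊨ φ → ¬ In𝒞 φ α M →
                           ∃[ γ ] (IsCSR M γ × γ < β))

-- α ∈ 𝔉
In𝔉 : Sentence τ → Ord → Set₁
In𝔉 φ α = ∃[ β ] (IsF φ α β × β ≤ α)

------------------------------------------------------------------------
-- Fragments and theories

FormulaSet : Vocabulary → Set₁
FormulaSet τ = ∀ n → Formula τ n → Set

Range : (ℕ → Formula τ n) → Formula τ n → Set
Range e A = ∃[ i ] A ≋ e i

-- As usual, a fragment contains all atomic formulas.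
record IsFragment {τ : Vocabulary} (L : FormulaSet τ) : Set where
  field
    countable : ∀ n → Σ[ e ∈ (ℕ → Formula τ n) ] (∀ A → L n A → Range e A)
    resp      : {A B : Formula τ n} → A ≋ B → L n A → L n B
    ⊥-in      : L n ⊥̇
    ≐-in      : (s t : Term τ n) → L n (s ≐ᶠ t)
    rel-in    : ∀ R (ts : Vec (Term τ n) (arʳ τ R)) → L n (rel R ts)
    ¬-in      : {A : Formula τ n} → L n A → L n (¬̇ A)
    ∧-in      : {A B : Formula τ n} → L n A → L n B → L n (A ∧̇ B)
    ∃-in      : {A : Formula τ (suc n)} → L (suc n) A → L n (∃̇ A)
    sub-in    : (σ : Fin n → Term τ m) {A : Formula τ n} → L n A → L m (sub σ A)
    ¬-out     : {A : Formula τ n} → L n (¬̇ A) → L n A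
    ∧-outˡ    : {A B : Formula τ n} → L n (A ∧̇ B) → L n A
    ∧-outʳ    : {A B : Formula τ n} → L n (A ∧̇ B) → L n B
    ∃-out     : {A : Formula τ (suc n)} → L n (∃̇ A) → L (suc n) A
    ⋁-out     : {F : ℕ → Formula τ n} → L n (⋁̇ F) → ∀ i → L n (F i)

-- The least set containing G with the closure properties of a fragment;
-- it is a fragment whenever it is countable.
data Gen {τ : Vocabulary} (G : FormulaSet τ) : ∀ n → Formula τ n → Set where
  gen    : {A : Formula τ n} → G n A → Gen G n A
  resp   : {A B : Formula τ n} → A ≋ B → Gen G n A → Gen G n B
  ⊥-in   : Gen G n ⊥̇
  ≐-in   : (s t : Term τ n) → Gen G n (s ≐ᶠ t)
  rel-in : ∀ R (ts : Vec (Term τ n) (arʳ τ R)) → Gen G n (rel R ts)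
  ¬-in   : {A : Formula τ n} → Gen G n A → Gen G n (¬̇ A)
  ∧-in   : {A B : Formula τ n} → Gen G n A → Gen G n B → Gen G n (A ∧̇ B)
  ∃-in   : {A : Formula τ (suc n)} → Gen G (suc n) A → Gen G n (∃̇ A)
  sub-in : (σ : Fin n → Term τ m) {A : Formula τ n} → Gen G n A → Gen G m (sub σ A)
  ¬-out  : {A : Formula τ n} → Gen G n (¬̇ A) → Gen G n A
  ∧-outˡ : {A B : Formula τ n} → Gen G n (A ∧̇ B) → Gen G n A
  ∧-outʳ : {A B : Formula τ n} → Gen G n (A ∧̇ B) → Gen G n B
  ∃-out  : {A : Formula τ (suc n)} → Gen G n (∃̇ A) → Gen G (suc n) A
  ⋁-out  : {F : ℕ → Formula τ n} → Gen G n (⋁̇ F) → ∀ i → Gen G n (F i)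

Finitary : FormulaSet τ
Finitary = Gen (λ _ _ → ⊥)

record Theory (τ : Vocabulary) : Set₁ where
  field
    lang : FormulaSet τ
    thm  : Sentence τ → Set

open Theory public

infix 4 _⊨ᵀ_ _≗ᵀ_

_⊨ᵀ_ : Structure τ → Theory τ → Set
M ⊨ᵀ S = ∀ A → thm S A → M ⊨ A

_≗ᵀ_ : Theory τ → Theory τ → Set
S ≗ᵀ S′ = (∀ n A → lang S n A ⇔ lang S′ n A) × (∀ A → thm S A ⇔ thm S′ A)

------------------------------------------------------------------------
-- Deductions of finite length

-- Classical natural deduction for L_{ω₁ω}.  Γ ∣ k ∣ ρ ∣ Δ ⊢ A is derivability
-- of A from the (renamed by ρ) global hypotheses Γ and the local hypotheses
-- Δ by a deduction tree of finite height at most k.  The rule ⋁-elim, with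
-- one premise for each disjunct, belongs to the logic; only the height is
-- restricted.  If it were omitted, then for every non-principal type p the
-- set p ∪ {¬ ⋀ p}, which has no realization, would extend to a type.

data _∣_∣_∣_⊢_ {τ : Vocabulary} {n : ℕ} (Γ : Formula τ n → Set) :
       ∀ {m} → ℕ → (Fin n → Fin m) → List (Formula τ m) → Formula τ m → Set where
  glob    : ∀ {k m A} {ρ : Fin n → Fin m} {Δ} →
            Γ A → Γ ∣ k ∣ ρ ∣ Δ ⊢ ren ρ A
  hyp     : ∀ {k m A} {ρ : Fin n → Fin m} {Δ} →
            A ∈ˡ Δ → Γ ∣ k ∣ ρ ∣ Δ ⊢ A
  conv    : ∀ {k m A B} {ρ : Fin n → Fin m} {Δ} →
            A ≋ B → Γ ∣ k ∣ ρ ∣ Δ ⊢ A → Γ ∣ suc k ∣ ρ ∣ Δ ⊢ B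
  ¬-intro : ∀ {k m A} {ρ : Fin n → Fin m} {Δ} →
            Γ ∣ k ∣ ρ ∣ A ∷ Δ ⊢ ⊥̇ → Γ ∣ suc k ∣ ρ ∣ Δ ⊢ (¬̇ A)
  ¬-elim  : ∀ {k m A} {ρ : Fin n → Fin m} {Δ} →
            Γ ∣ k ∣ ρ ∣ Δ ⊢ (¬̇ A) → Γ ∣ k ∣ ρ ∣ Δ ⊢ A → Γ ∣ suc k ∣ ρ ∣ Δ ⊢ ⊥̇
  raa     : ∀ {k m A} {ρ : Fin n → Fin m} {Δ} →
            Γ ∣ k ∣ ρ ∣ (¬̇ A) ∷ Δ ⊢ ⊥̇ → Γ ∣ suc k ∣ ρ ∣ Δ ⊢ A
  ∧-intro : ∀ {k m A B} {ρ : Fin n → Fin m} {Δ} →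
            Γ ∣ k ∣ ρ ∣ Δ ⊢ A → Γ ∣ k ∣ ρ ∣ Δ ⊢ B → Γ ∣ suc k ∣ ρ ∣ Δ ⊢ (A ∧̇ B)
  ∧-elimˡ : ∀ {k m A B} {ρ : Fin n → Fin m} {Δ} →
            Γ ∣ k ∣ ρ ∣ Δ ⊢ (A ∧̇ B) → Γ ∣ suc k ∣ ρ ∣ Δ ⊢ A
  ∧-elimʳ : ∀ {k m A B} {ρ : Fin n → Fin m} {Δ} →
            Γ ∣ k ∣ ρ ∣ Δ ⊢ (A ∧̇ B) → Γ ∣ suc k ∣ ρ ∣ Δ ⊢ B
  ∃-intro : ∀ {k m A} {ρ : Fin n → Fin m} {Δ} (t : Term τ m) →
            Γ ∣ k ∣ ρ ∣ Δ ⊢ instantiate t A → Γ ∣ suc k ∣ ρ ∣ Δ ⊢ ∃̇ A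
  ∃-elim  : ∀ {k m A B} {ρ : Fin n → Fin m} {Δ} →
            Γ ∣ k ∣ ρ ∣ Δ ⊢ ∃̇ A →
            Γ ∣ k ∣ suc ∘ ρ ∣ A ∷ List.map (ren suc) Δ ⊢ ren suc B →
            Γ ∣ suc k ∣ ρ ∣ Δ ⊢ B
  ⋁-intro : ∀ {k m F} {ρ : Fin n → Fin m} {Δ} i →
            Γ ∣ k ∣ ρ ∣ Δ ⊢ F i → Γ ∣ suc k ∣ ρ ∣ Δ ⊢ ⋁̇ F
  ⋁-elim  : ∀ {k m F B} {ρ : Fin n → Fin m} {Δ} →
            Γ ∣ k ∣ ρ ∣ Δ ⊢ ⋁̇ F → (∀ i → Γ ∣ k ∣ ρ ∣ F i ∷ Δ ⊢ B) →
            Γ ∣ suc k ∣ ρ ∣ Δ ⊢ B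
  ≐-refl  : ∀ {k m} {ρ : Fin n → Fin m} {Δ} (t : Term τ m) →
            Γ ∣ k ∣ ρ ∣ Δ ⊢ (t ≐ᶠ t)
  ≐-subst : ∀ {k m s t} {ρ : Fin n → Fin m} {Δ} (A : Formula τ (suc m)) →
            Γ ∣ k ∣ ρ ∣ Δ ⊢ (s ≐ᶠ t) → Γ ∣ k ∣ ρ ∣ Δ ⊢ instantiate s A →
            Γ ∣ suc k ∣ ρ ∣ Δ ⊢ instantiate t A

Derivable : (Formula τ n → Set) → Formula τ n → Set
Derivable Γ A = ∃[ k ] Γ ∣ k ∣ (λ i → i) ∣ [] ⊢ A

FinitarilyConsistent : (Formula τ n → Set) → Set
FinitarilyConsistent Γ = ¬ Derivable Γ ⊥̇

------------------------------------------------------------------------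
-- ω-complete theories and types

infixr 5 _∪_

_∪_ : (Formula τ n → Set) → (Formula τ n → Set) → Formula τ n → Set
(p ∪ q) A = p A ⊎ q A

-- The theorems of S, regarded as formulas in n variables.
thmₙ : Theory τ → ∀ n → Formula τ n → Set
thmₙ S n A = ∃[ B ] (thm S B × A ≡ ren (λ ()) B)

record IsωComplete {τ : Vocabulary} (S : Theory τ) : Set where
  field
    fragment   : IsFragment (lang S)
    thm-lang   : ∀ A → thm S A → lang S 0 A
    complete   : ∀ A → lang S 0 A → thm S A ⊎ thm S (¬̇ A)
    ω-complete : ∀ F → thm S (⋁̇ F) → ∃[ i ] thm S (F i)

record IsType {τ : Vocabulary} (S : Theory τ) (n : ℕ) (p : Formula τ n → Set) : Set where
  field
    in-lang    : ∀ A → p A → lang S n A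
    consistent : FinitarilyConsistent (thmₙ S n ∪ p)
    maximal    : ∀ A → lang S n A → FinitarilyConsistent (thmₙ S n ∪ p ∪ (_≡ A)) → p A

-- For complete S and θ, ψ in its language, derivability of θ ⇒ ψ from S is
-- membership of its universal closure in S.
Principal : Theory τ → (n : ℕ) → (Formula τ n → Set) → Set
Principal S n p = ∃[ θ ] (p θ × (∀ ψ → p ψ → thm S (close n (θ ⇒̇ ψ))))

NonPrincipalType : Theory τ → (n : ℕ) → (Formula τ n → Set) → Set
NonPrincipalType S n p = IsType S n p × ¬ Principal S n p

Realizes : Structure τ → (n : ℕ) → (Formula τ n → Set) → Set
Realizes M n p = ∃[ v ] (∀ A → p A → M ⊨ A [ v ])

RealizesEveryNonPrincipalType : Structure τ → Theory τ → Set₁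
RealizesEveryNonPrincipalType M S = ∀ n p → NonPrincipalType S n p → Realizes M n p

RealizesEveryType : Structure τ → Theory τ → Set₁
RealizesEveryType M S = ∀ n → 1 ℕ.≤ n → ∀ p → IsType S n p → Realizes M n p

typeOf : FormulaSet τ → (M : Structure τ) → Vec (Carrier M) n → Formula τ n → Set
typeOf L M v A = L _ A × M ⊨ A [ v ]

IsAtomicModel : Structure τ → Theory τ → Set
IsAtomicModel M S = M ⊨ᵀ S × (∀ n v → Principal S n (typeOf (lang S) M v))

------------------------------------------------------------------------
-- Sacks rank

Th : FormulaSet τ → Structure τ → Theory τ
Th L M = record { lang = L ; thm = λ A → L 0 A × M ⊨ A }

Lᴬ : Structure τ → Ord → FormulaSet τ
Lᴬ M zero    = Finitary
Lᴬ M (suc δ) = Gen λ n G → Lᴬ M δ n G ⊎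
  (∃[ e ] (G ≡ ⋀̇ e
         × ¬ Principal (Th (Lᴬ M δ) M) n (Range e)
         × (∃[ v ] (∀ A → Range e A ⇔ typeOf (Lᴬ M δ) M v A))))
Lᴬ M (lim f) = λ n G → ∃[ i ] Lᴬ M (f i) n G

-- sr_Sacks(M) = δ
IsSr : Structure τ → Ord → Set
IsSr M = Least (λ δ → IsAtomicModel M (Th (Lᴬ M δ) M))

------------------------------------------------------------------------
-- The tree of nodes

-- The theory T in the fragment L₀ generated by φ; tautologies are the
-- sentences of L₀ derivable from no hypotheses.
T₀ : Sentence τ → Theory τ
T₀ {τ} φ = record
  { lang = L₀
  ; thm  = λ A → A ≋ φ ⊎ (L₀ 0 A × Derivable (λ _ → ⊥) A)
  }
  where
  data IsΦ : ∀ n → Formula τ n → Set where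
    here : IsΦ 0 φ
  L₀ : FormulaSet τ
  L₀ = Gen IsΦ

-- L′_S
nextLang : Theory τ → FormulaSet τ
nextLang S = Gen λ n G →
  lang S n G ⊎ (∃[ e ] (G ≡ ⋀̇ e × NonPrincipalType S n (Range e)))

record Extends {τ : Vocabulary} (S : Theory τ) (L : FormulaSet τ) (S′ : Theory τ) : Set where
  field
    language   : ∀ n A → lang S′ n A ⇔ L n A
    extends    : ∀ A → thm S A → thm S′ A
    consistent : FinitarilyConsistent (thm S′)
    ω-complete : IsωComplete S′

-- T δ is a node on level δ.
record IsBranch {τ : Vocabulary} (φ : Sentence τ) (T : Ord → Theory τ) : Set where
  field
    T-cong : ∀ α β → α ≈ β → T α ≗ᵀ T β
    T-zero : Extends (T₀ φ) (lang (T₀ φ)) (T zero)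
    T-suc  : ∀ δ → Extends (T δ) (nextLang (T δ)) (T (suc δ))
    T-lim  : ∀ δ → IsLimit δ → T δ ≗ᵀ record
      { lang = λ n A → ∃[ γ ] (γ < δ × lang (T γ) n A)
      ; thm  = λ A → ∃[ γ ] (γ < δ × thm (T γ) A)
      }

------------------------------------------------------------------------
-- Sets

-- Aczel's iterative sets.
data 𝕍 : Set₁ where
  set : (I : Set) → (I → 𝕍) → 𝕍

Index : 𝕍 → Set
Index (set I f) = I

elem : (x : 𝕍) → Index x → 𝕍
elem (set I f) = f

infix 4 _≐_ _∈_

_≐_ : 𝕍 → 𝕍 → Set
set I f ≐ set J g = (∀ i → ∃[ j ] f i ≐ g j) × (∀ j → ∃[ i ] f i ≐ g j)

_∈_ : 𝕍 → 𝕍 → Set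
x ∈ y = ∃[ j ] x ≐ elem y j

∅ : 𝕍
∅ = set ⊥ λ ()

⋃ : 𝕍 → 𝕍
⋃ x = set (Σ[ i ∈ Index x ] Index (elem x i)) λ (i , j) → elem (elem x i) j

⟅_,_⟆ : 𝕍 → 𝕍 → 𝕍
⟅ x , y ⟆ = set Bool λ b → if b then x else y

⟨_,_⟩ : 𝕍 → 𝕍 → 𝕍
⟨ x , y ⟩ = ⟅ ⟅ x , x ⟆ , ⟅ x , y ⟆ ⟆

-- tc x is the transitive closure of {x}.
TcIndex : 𝕍 → Set
TcIndex (set I f) = ⊤ ⊎ (Σ[ i ∈ I ] TcIndex (f i))

tcElem : (x : 𝕍) → TcIndex x → 𝕍
tcElem (set I f) (inj₁ _)       = set I f
tcElem (set I f) (inj₂ (i , j)) = tcElem (f i) j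

tc : 𝕍 → 𝕍
tc x = set (TcIndex x) (tcElem x)

-- Hereditarily countable codes.

⟦_⟧ᵒ : Ord → 𝕍
⟦ zero  ⟧ᵒ = ∅
⟦ suc α ⟧ᵒ = ⋃ ⟅ ⟦ α ⟧ᵒ , ⟅ ⟦ α ⟧ᵒ , ⟦ α ⟧ᵒ ⟆ ⟆
⟦ lim f ⟧ᵒ = ⋃ (set ℕ λ i → ⟦ f i ⟧ᵒ)

⟦_⟧ⁿ : ℕ → 𝕍
⟦ k ⟧ⁿ = ⟦ fromℕ k ⟧ᵒ

mutual
  ⟦_⟧ᵗ : Term τ n → 𝕍
  ⟦ var i ⟧ᵗ            = ⟨ ⟦ 0 ⟧ⁿ , ⟦ toℕ i ⟧ⁿ ⟩
  ⟦_⟧ᵗ {τ} (fun f ts)   = ⟨ ⟦ 1 ⟧ⁿ , ⟨ ⟦ codeᶠ τ f ⟧ⁿ , ⟦ ts ⟧ᵗˢ ⟩ ⟩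

  ⟦_⟧ᵗˢ : ∀ {k} → Vec (Term τ n) k → 𝕍
  ⟦ [] ⟧ᵗˢ     = ∅
  ⟦ t ∷ ts ⟧ᵗˢ = ⟨ ⟦ t ⟧ᵗ , ⟦ ts ⟧ᵗˢ ⟩

⟦_⟧ᶠ : Formula τ n → 𝕍
⟦ ⊥̇ ⟧ᶠ              = ⟨ ⟦ 0 ⟧ⁿ , ∅ ⟩
⟦ s ≐ᶠ t ⟧ᶠ         = ⟨ ⟦ 1 ⟧ⁿ , ⟨ ⟦ s ⟧ᵗ , ⟦ t ⟧ᵗ ⟩ ⟩
⟦_⟧ᶠ {τ} (rel R ts) = ⟨ ⟦ 2 ⟧ⁿ , ⟨ ⟦ codeʳ τ R ⟧ⁿ , ⟦ ts ⟧ᵗˢ ⟩ ⟩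
⟦ ¬̇ A ⟧ᶠ            = ⟨ ⟦ 3 ⟧ⁿ , ⟦ A ⟧ᶠ ⟩
⟦ A ∧̇ B ⟧ᶠ          = ⟨ ⟦ 4 ⟧ⁿ , ⟨ ⟦ A ⟧ᶠ , ⟦ B ⟧ᶠ ⟩ ⟩
⟦ ∃̇ A ⟧ᶠ            = ⟨ ⟦ 5 ⟧ⁿ , ⟦ A ⟧ᶠ ⟩
⟦ ⋁̇ F ⟧ᶠ            = ⟨ ⟦ 6 ⟧ⁿ , set ℕ (λ i → ⟦ F i ⟧ᶠ) ⟩

⟦_⟧ᵀ : Theory τ → 𝕍
⟦_⟧ᵀ {τ} S = set (Σ[ A ∈ Sentence τ ] thm S A) (⟦_⟧ᶠ ∘ proj₁)

------------------------------------------------------------------------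
-- The constructible hierarchy over a set, admissibility, definability

infix  8 _∈̇_ _=̇_

data SetFm : ℕ → Set where
  _∈̇_ _=̇_ : Fin n → Fin n → SetFm n
  not     : SetFm n → SetFm n
  _and_   : SetFm n → SetFm n → SetFm n
  ex      : SetFm (suc n) → SetFm n

Sat : (A : 𝕍) → SetFm n → Vec (Index A) n → Set
Sat A (i ∈̇ j)   v = elem A (lookup v i) ∈ elem A (lookup v j)
Sat A (i =̇ j)   v = elem A (lookup v i) ≐ elem A (lookup v j)
Sat A (not φ)   v = ¬ Sat A φ v
Sat A (φ and ψ) v = Sat A φ v × Sat A ψ v
Sat A (ex φ)    v = ∃[ x ] Sat A φ (x ∷ v)

data Δ₀ : ∀ {n} → SetFm n → Set where
  _∈̇_   : (i j : Fin n) → Δ₀ (i ∈̇ j)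
  _=̇_   : (i j : Fin n) → Δ₀ (i =̇ j)
  not   : {φ : SetFm n} → Δ₀ φ → Δ₀ (not φ)
  _and_ : {φ ψ : SetFm n} → Δ₀ φ → Δ₀ ψ → Δ₀ (φ and ψ)
  bex   : (i : Fin n) {φ : SetFm (suc n)} → Δ₀ φ → Δ₀ (ex ((zero ∈̇ suc i) and φ))

data Σ₁ : ∀ {n} → SetFm n → Set where
  Δ₀⇒Σ₁ : {φ : SetFm n} → Δ₀ φ → Σ₁ φ
  ex    : {φ : SetFm (suc n)} → Σ₁ φ → Σ₁ (ex φ)

-- The set of subsets of A definable over (A , ∈) with parameters.
Def : 𝕍 → 𝕍
Def A = set (Σ[ k ∈ ℕ ] (SetFm (suc k) × Vec (Index A) k)) λ (k , φ , ps) →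
  set (Σ[ x ∈ Index A ] Sat A φ (x ∷ ps)) (elem A ∘ proj₁)

-- L⟨ α , T ⟩ is L(α,T), with L(0,T) the transitive closure of {T}.
L⟨_,_⟩ : Ord → 𝕍 → 𝕍
L⟨ zero  , T ⟩ = tc T
L⟨ suc α , T ⟩ = Def L⟨ α , T ⟩
L⟨ lim f , T ⟩ = ⋃ (set ℕ λ i → L⟨ f i , T ⟩)

L⟨ω₁,_⟩ : 𝕍 → 𝕍
L⟨ω₁, T ⟩ = ⋃ (set Ord λ α → L⟨ α , T ⟩)

-- Σ₁-admissibility of a transitive set; extensionality and foundation are
-- automatic.
record Admissible (A : 𝕍) : Set where
  field
    pairing    : (a b : Index A) →
                 ∃[ c ] (elem A a ∈ elem A c × elem A b ∈ elem A c)
    union      : (a : Index A) → ∃[ c ]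
                 ((x y : Index A) → elem A x ∈ elem A a → elem A y ∈ elem A x →
                  elem A y ∈ elem A c)
    separation : ∀ {k} {φ : SetFm (suc k)} → Δ₀ φ → (ps : Vec (Index A) k) (a : Index A) →
                 ∃[ c ] (∀ x → elem A x ∈ elem A c ⇔
                               (elem A x ∈ elem A a × Sat A φ (x ∷ ps)))
    collection : ∀ {k} {φ : SetFm (suc (suc k))} → Δ₀ φ → (ps : Vec (Index A) k) (a : Index A) →
                 (∀ x → elem A x ∈ elem A a → ∃[ y ] Sat A φ (x ∷ y ∷ ps)) →
                 ∃[ c ] (∀ x → elem A x ∈ elem A a →
                         ∃[ y ] (elem A y ∈ elem A c × Sat A φ (x ∷ y ∷ ps)))

-- The map δ ↦ G δ, for δ < ω₁, takes values in A, and its graph is Δ₁ over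
-- (A , ∈) with parameters.
record Δ₁Map (A : 𝕍) (G : Ord → 𝕍) : Set where
  Graph : Index A → Index A → Set
  Graph d x = ∃[ δ ] (elem A d ≐ ⟦ δ ⟧ᵒ × elem A x ≐ G δ)
  field
    total  : ∀ δ → G δ ∈ A
    {k}    : ℕ
    params : Vec (Index A) k
    σ σ′   : SetFm (suc (suc k))
    σ-Σ₁   : Σ₁ σ
    σ′-Σ₁  : Σ₁ σ′
    graph  : ∀ d x → Graph d x ⇔ Sat A σ (d ∷ x ∷ params)
    co     : ∀ d x → (¬ Graph d x) ⇔ Sat A σ′ (d ∷ x ∷ params)

------------------------------------------------------------------------
-- The data supplied by Sacks' theorem

record SacksData {τ : Vocabulary} (φ : Sentence τ) : Set₁ where
  field
    T        : Ord → Theory τ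
    branch   : IsBranch φ T
    T-Δ₁     : Δ₁Map L⟨ω₁, ⟦ T₀ φ ⟧ᵀ ⟩ (λ δ → ⟦ T δ ⟧ᵀ)
    T-atomic : ∀ δ → ∃[ M ] (IsAtomicModel M (T δ) × IsSr M δ)
    C        : Ord → Set
    C-club   : Club C
    A B      : Ord → Structure τ

    C-above-ω    : ∀ λ′ → C λ′ → ω < λ′
    C-admissible : ∀ λ′ → C λ′ → Admissible L⟨ λ′ , ⟦ T₀ φ ⟧ᵀ ⟩
    types-exist  : ∀ λ′ → C λ′ → ∃[ n ] ∃[ p ] NonPrincipalType (T λ′) n p
    types-count  : ∀ λ′ → C λ′ →
                   ∀ n → Σ[ e ∈ (ℕ → Formula τ n → Set) ]
                   (∀ p → NonPrincipalType (T λ′) n p →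
                    ∃[ i ] (∀ F → p F ⇔ e i F))
    A-atomic     : ∀ λ′ → C λ′ → IsAtomicModel (A λ′) (T λ′)
    A-sr         : ∀ λ′ → C λ′ → IsSr (A λ′) λ′
    B-model      : ∀ λ′ → C λ′ → B λ′ ⊨ᵀ T λ′
    B-types      : ∀ λ′ → C λ′ → RealizesEveryNonPrincipalType (B λ′) (T λ′)
    B-ω₁         : ∀ λ′ → C λ′ → IsΩ₁ᴹ (B λ′) λ′
    B-sr         : ∀ λ′ → C λ′ → IsSr (B λ′) (suc λ′)

-- λ′ ∈ S° = 𝔉 ∩ C ∩ (qr(φ) , ω₁)
InS° : (φ : Sentence τ) → SacksData φ → Ord → Set₁
InS° φ 𝒟 λ′ = In𝔉 φ λ′ × SacksData.C 𝒟 λ′ × (∃[ β ] (IsQr φ β × β < λ′))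

{-# OPTIONS --safe #-}

-- Back-and-forth equivalence of length γ is determined by types over the node on level γ + 1,
-- because the next node contains the conjunction of every non-principal type.  So tuples with the
-- same type over T λ are equivalent for all lengths below λ.  If ω₁ᴹ = λ, then M is homogeneous for
-- this equivalence ~ (Nadel): if v ~ w, then every a has a b with a, v ~ b, w.  Given tuples v ~ w
-- of M and N and an element a of M, one realizes the type of a, v in N and moves the realization to
-- w by homogeneity of N; this back-and-forth yields M ≅ N.
--
-- Homogeneity is a boundedness property of games decidable in X, where ω₁^X = λ: if for every γ < λ
-- Duplicator can survive γ moves from some starting position, then one starting position works for
-- all γ.  To see this, let D be the tree of attempts to build a strategy against a Spoiler who counts
-- down along the Kleene–Brouwer order of D itself; the circularity is harmless, since a sequence
-- only refers to elements of D with a smaller code.  Along an infinite branch the initial segments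
-- descend in D, so that the strategy never loses.  If there is no infinite branch, then the order
-- type of D is an ordinal computable in X, and surviving that many moves provides a branch.
module Submission where

open import Defs hiding (lift) renaming (_≤_ to _≤ᵒ_; _<_ to _<ᵒ_)
import Defs
open import Axiom.ExcludedMiddle using (ExcludedMiddle)
open import Data.Bool.Base using (Bool)
open import Data.Empty using (⊥-elim)
open import Data.Fin.Base as Fin using (Fin; zero; suc; toℕ)
open import Data.Fin.Properties using (toℕ<n)
open import Data.List.Base as List using (List; []; _∷_; _++_; length; drop; applyUpTo)
open import Data.List.Membership.Propositional using () renaming (_∈_ to _∈ˡ_)
open import Data.List.Membership.Propositional.Properties using (∈-map⁻)
open import Data.List.Properties using (∷-injectiveˡ; ∷-injectiveʳ; map-∘; length-map; length-++)
open import Data.List.Relation.Unary.Any using () renaming (here to hereˡ; there to thereˡ)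
open import Data.Nat.Base
open import Data.Nat.Induction using (<-rec; <-wellFounded)
open import Data.Nat.Properties
open import Data.Product.Base as Prod using (Σ-syntax; ∃-syntax; _×_; _,_; proj₁; proj₂; uncurry)
open import Data.Sum.Base as Sum using (_⊎_; inj₁; inj₂; [_,_]′)
open import Data.Unit.Base using (⊤; tt)
open import Data.Vec.Base as Vec using (Vec; []; _∷_; head; tail; lookup; tabulate)
open import Data.Vec.Properties using (tabulate∘lookup; lookup∘tabulate; tabulate-cong)
open import Function.Base using (_∘_; id)
open import Function.Bundles using (_⇔_; mk⇔; mk↔ₛ′; module Equivalence)
import Function.Construct.Composition as Composition
import Function.Construct.Symmetry as Symmetry
open import Induction.WellFounded using (Acc; acc)
open import Level using (0ℓ; Lift; lift; lower) renaming (suc to lsuc)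
open import Relation.Binary.Definitions using (tri<; tri≈; tri>)
open import Relation.Binary.PropositionalEquality hiding ([_])
open import Relation.Nullary using (Dec; yes; no; ¬_)
open import Relation.Nullary.Decidable using (map′; ¬?; decidable-stable)

open Equivalence using (to; from)

-- Ordinals

-- The obstacle to homogeneity is an exchange of quantifiers: for each γ below λ some b answers a
-- for length γ, and a single b must serve all γ. There are countably many candidates b, but λ is
-- countable too, so no pigeonhole argument applies and the computability of a copy of the model has
-- to be used. One could let Duplicator play against an ill-founded order whose well-founded part is
-- λ; with the order of D itself no such order has to be constructed beforehand. For D to be
-- decidable in X, every round of the game must be decidable. Being a partial isomorphism is not,
-- since the vocabulary may be infinite. Spoiler therefore names one atomic formula in each move,
-- and only that formula is tested. The price is one extra round whenever agreement on atomic
-- formulas is to be read off from survival.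

≤ᵒ-refl : ∀ α → α ≤ᵒ α
≤ᵒ-lim  : ∀ α {g} i → α ≤ᵒ g i → α ≤ᵒ lim g

≤ᵒ-lim zero    i p = tt
≤ᵒ-lim (suc α) i p = i , p
≤ᵒ-lim (lim f) i p = λ j → ≤ᵒ-lim (f j) i (p j)

≤ᵒ-refl zero    = tt
≤ᵒ-refl (suc α) = ≤ᵒ-refl α
≤ᵒ-refl (lim f) = λ i → ≤ᵒ-lim (f i) i (≤ᵒ-refl (f i))

≤ᵒ-trans : ∀ α β γ → α ≤ᵒ β → β ≤ᵒ γ → α ≤ᵒ γ
≤ᵒ-trans zero    β       γ       p       q       = tt
≤ᵒ-trans (lim f) β       γ       p       q       = λ i → ≤ᵒ-trans (f i) β γ (p i) q
≤ᵒ-trans (suc α) (suc β) (suc γ) p       q       = ≤ᵒ-trans α β γ p q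
≤ᵒ-trans (suc α) (suc β) (lim h) p       (i , q) = i , ≤ᵒ-trans (suc α) (suc β) (h i) p q
≤ᵒ-trans (suc α) (lim g) γ       (i , p) q       = ≤ᵒ-trans (suc α) (g i) γ p (q i)

α≤sucα : ∀ α → α ≤ᵒ suc α
α≤sucα zero    = tt
α≤sucα (suc α) = α≤sucα α
α≤sucα (lim f) = λ i → ≤ᵒ-trans (f i) (suc (f i)) (suc (lim f)) (α≤sucα (f i))
                                (≤ᵒ-lim (f i) i (≤ᵒ-refl (f i)))

<ᵒ⇒≤ᵒ : ∀ α β → α <ᵒ β → α ≤ᵒ β
<ᵒ⇒≤ᵒ α β = ≤ᵒ-trans α (suc α) β (α≤sucα α)

<ᵒ-irrefl : ∀ α → ¬ α <ᵒ α
<ᵒ-irrefl (suc α) p       = <ᵒ-irrefl α p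
<ᵒ-irrefl (lim f) (i , p) =
  <ᵒ-irrefl (f i) (≤ᵒ-trans (suc (f i)) (suc (lim f)) (f i) (≤ᵒ-lim (f i) i (≤ᵒ-refl (f i))) p)

-- Classical logic and the comparison of ordinals

module Classical (em : ExcludedMiddle (lsuc 0ℓ)) where

  em₀ : (P : Set) → Dec P
  em₀ P = map′ lower lift (em {Lift (lsuc 0ℓ) P})

  stable : {P : Set} → ¬ ¬ P → P
  stable = decidable-stable (em₀ _)

  ¬∀⇒∃¬ : {A : Set} {P : A → Set} → ¬ (∀ a → P a) → ∃[ a ] ¬ P a
  ¬∀⇒∃¬ ¬∀ = stable λ ¬∃ → ¬∀ λ a → stable λ ¬p → ¬∃ (a , ¬p)

  ≤ᵒ-or->ᵒ : ∀ α β → α ≤ᵒ β ⊎ β <ᵒ α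
  ≤ᵒ-or->ᵒ zero    β       = inj₁ tt
  ≤ᵒ-or->ᵒ (suc α) zero    = inj₂ tt
  ≤ᵒ-or->ᵒ (suc α) (suc β) = ≤ᵒ-or->ᵒ α β
  ≤ᵒ-or->ᵒ (suc α) (lim g) with em₀ (∃[ i ] suc α ≤ᵒ g i)
  ... | yes p = inj₁ p
  ... | no ¬p = inj₂ λ i → g≤α i (≤ᵒ-or->ᵒ (suc α) (g i))
    where
    g≤α : ∀ i → suc α ≤ᵒ g i ⊎ g i <ᵒ suc α → g i ≤ᵒ α
    g≤α i (inj₁ q) = ⊥-elim (¬p (i , q))
    g≤α i (inj₂ q) = q
  ≤ᵒ-or->ᵒ (lim f) β with em₀ (∀ i → f i ≤ᵒ β)
  ... | yes p = inj₁ p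
  ... | no ¬p with ¬∀⇒∃¬ ¬p
  ...   | i , q with ≤ᵒ-or->ᵒ (f i) β
  ...     | inj₁ r = ⊥-elim (q r)
  ...     | inj₂ r = inj₂ (i , r)

-- Functions and relations computable in an oracle

module Computability (X : ℕ → Bool) where

  private variable
    n   : ℕ
    f g : Vec ℕ n → ℕ
    P Q : Vec ℕ n → Set

  -- Only total functions given in advance are considered: the program merely has to follow `f`, so
  -- that partiality never has to be discussed.
  record Computable (f : Vec ℕ n → ℕ) : Set where
    constructor _by_
    field
      program : Rec n
      correct : ∀ v → X ⊢ program [ v ]⇓ f v

  Computable₁ : (ℕ → ℕ) → Set
  Computable₁ F = Computable {1} λ v → F (lookup v zero)

  Computable₂ : (ℕ → ℕ → ℕ) → Set
  Computable₂ F = Computable {2} λ v → F (lookup v zero) (lookup v (suc zero))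

  var· : (i : Fin n) → Computable (λ v → lookup v i)
  var· i = projᶠ i by λ v → ⇓proj

  app₁ : ∀ F → Computable₁ F → Computable f → Computable (λ v → F (f v))
  app₁ F (c by p) (d by q) = compᶠ c (d ∷ []) by λ v → ⇓comp (q v ∷ []) (p _)

  app₂ : ∀ F → Computable₂ F → Computable f → Computable g → Computable (λ v → F (f v) (g v))
  app₂ F (c by p) (d by q) (e by r) =
    compᶠ c (d ∷ e ∷ []) by λ v → ⇓comp (q v ∷ r v ∷ []) (p _)

  suc· : Computable f → Computable (λ v → suc (f v))
  suc· (c by p) = compᶠ sucᶠ (c ∷ []) by λ v → ⇓comp (p v ∷ []) ⇓suc

  const· : (k : ℕ) → Computable {n} (λ _ → k)
  const· zero    = compᶠ zeroᶠ [] by λ v → ⇓comp [] ⇓zero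
  const· (suc k) = suc· (const· k)

  ext· : (∀ v → f v ≡ g v) → Computable f → Computable g
  ext· e (c by p) = c by λ v → subst (X ⊢ c [ v ]⇓_) (e v) (p v)

  prim· : ∀ {F : ℕ → Vec ℕ n → ℕ} {h} → Computable (F 0) → Computable h →
          (∀ k v → h (k ∷ F k v ∷ v) ≡ F (suc k) v) →
          Computable (λ v → F (lookup v zero) (tail v))
  prim· {n} {F} (c by p) (d by q) e = primᶠ c d by run
    where
    run : ∀ v → X ⊢ primᶠ c d [ v ]⇓ F (lookup v zero) (tail v)
    run (zero ∷ v)  = ⇓prim₀ (p v)
    run (suc k ∷ v) = subst (X ⊢ primᶠ c d [ suc k ∷ v ]⇓_) (e k v)
                            (⇓prim₊ (run (k ∷ v)) (q _))

  prim₂ : ∀ (F : ℕ → ℕ → ℕ) {h} → Computable₁ (F 0) → Computable {3} h →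
          (∀ k x → h (k ∷ F k x ∷ x ∷ []) ≡ F (suc k) x) → Computable₂ F
  prim₂ F c d e = ext· (λ { (k ∷ x ∷ []) → refl })
    (prim· {F = λ k v → F k (lookup v zero)} c d λ { k (x ∷ []) → e k x })

  prim₁ : ∀ (F : ℕ → ℕ) {h} → Computable {2} h →
          (∀ k → h (k ∷ F k ∷ []) ≡ F (suc k)) → Computable₁ F
  prim₁ F d e = prim· {F = λ k _ → F k} (const· (F 0)) d λ { k [] → e k }

  _+·_ : Computable f → Computable g → Computable (λ v → f v + g v)
  _+·_ = app₂ _+_ (prim₂ _+_ (var· zero) (suc· (var· (suc zero))) λ k x → refl)

  _*·_ : Computable f → Computable g → Computable (λ v → f v * g v)
  _*·_ = app₂ _*_ (prim₂ _*_ (const· 0) (var· (suc (suc zero)) +· var· (suc zero)) λ k x → refl)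

  2^· : Computable f → Computable (λ v → 2 ^ f v)
  2^· = app₁ (2 ^_) (prim₁ (2 ^_) (const· 2 *· var· (suc zero)) λ k → refl)

  pred· : Computable f → Computable (λ v → pred (f v))
  pred· = app₁ pred (prim₁ pred (var· zero) λ k → refl)

  _∸·_ : Computable f → Computable g → Computable (λ v → f v ∸ g v)
  c ∸· d = app₂ (λ x y → y ∸ x)
    (prim₂ (λ x y → y ∸ x) (var· zero) (pred· (var· (suc zero))) λ k x → pred[m∸n]≡m∸[1+n] x k) d c

  -- Any nonzero value of `χ` stands for truth. This makes conjunction a product and bounded
  -- existence a sum; `toComputes` normalizes the value to 1 at the end.
  record Decidable (P : Vec ℕ n → Set) : Set where
    constructor dec
    field
      {χ}        : Vec ℕ n → ℕ
      computable : Computable χ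
      spec       : ∀ v → P v ⇔ χ v ≢ 0

    decide : ∀ v → Dec (P v)
    decide v = map′ (from (spec v)) (to (spec v)) (¬? (χ v ≟ 0))

  open Decidable using (decide)

  toComputes : Decidable P → Computes X P
  toComputes {P = P} (dec {χ} c e) = program , λ v → result v (χ v) (correct v) (e v)
    where
    open Computable (const· 1 ∸· (const· 1 ∸· c))
    result : ∀ v y → X ⊢ program [ v ]⇓ (1 ∸ (1 ∸ y)) → P v ⇔ y ≢ 0 →
             (P v × X ⊢ program [ v ]⇓ 1) ⊎ (¬ P v × X ⊢ program [ v ]⇓ 0)
    result v zero    r e = inj₂ ((λ p → to e p refl) , r)
    result v (suc y) r e =
      inj₁ (from e (λ ()) , subst (X ⊢ program [ v ]⇓_) (cong (1 ∸_) (0∸n≡0 y)) r)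

  fromComputes : Computes X P → Decidable P
  fromComputes {P = P} (c , p) = dec {χ = λ v → χ (p v)} (c by λ v → run (p v)) λ v → spec (p v)
    where
    χ : ∀ {v} → (P v × X ⊢ c [ v ]⇓ 1) ⊎ (¬ P v × X ⊢ c [ v ]⇓ 0) → ℕ
    χ (inj₁ _) = 1
    χ (inj₂ _) = 0
    run : ∀ {v} (r : (P v × X ⊢ c [ v ]⇓ 1) ⊎ (¬ P v × X ⊢ c [ v ]⇓ 0)) → X ⊢ c [ v ]⇓ χ r
    run (inj₁ (_ , r)) = r
    run (inj₂ (_ , r)) = r
    spec : ∀ {v} (r : (P v × X ⊢ c [ v ]⇓ 1) ⊎ (¬ P v × X ⊢ c [ v ]⇓ 0)) → P v ⇔ χ r ≢ 0
    spec (inj₁ (y , _)) = mk⇔ (λ _ ()) λ _ → y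
    spec (inj₂ (z , _)) = mk⇔ (λ y → ⊥-elim (z y)) λ z → ⊥-elim (z refl)

  resp· : (∀ v → P v ⇔ Q v) → Decidable P → Decidable Q
  resp· e (dec c s) = dec c λ v → mk⇔ (to (s v) ∘ from (e v)) (to (e v) ∘ from (s v))

  sub₁ : {P : Vec ℕ 1 → Set} → Decidable P → Computable f → Decidable (λ v → P (f v ∷ []))
  sub₁ (dec (c by p) s) (d by q) =
    dec (compᶠ c (d ∷ []) by λ v → ⇓comp (q v ∷ []) (p _)) λ v → s _

  sub₂ : {P : Vec ℕ 2 → Set} → Decidable P → Computable f → Computable g →
         Decidable (λ v → P (f v ∷ g v ∷ []))
  sub₂ (dec (c by p) s) (d by q) (e by r) =
    dec (compᶠ c (d ∷ e ∷ []) by λ v → ⇓comp (q v ∷ r v ∷ []) (p _)) λ v → s _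

  sub₃ : {P : Vec ℕ 3 → Set} → Decidable P → ∀ {h} → Computable f → Computable g → Computable h →
         Decidable (λ v → P (f v ∷ g v ∷ h v ∷ []))
  sub₃ (dec (c by p) s) (d by q) (e by r) (e′ by r′) =
    dec (compᶠ c (d ∷ e ∷ e′ ∷ []) by λ v → ⇓comp (q v ∷ r v ∷ r′ v ∷ []) (p _)) λ v → s _

  infix  5 _≡·_ _≢0· _<·_
  infixr 3 _∧·_
  infixr 2 _∨·_
  infixr 1 _⇒·_ _⇔·_

  _≢0· : Computable f → Decidable (λ v → f v ≢ 0)
  c ≢0· = dec c λ v → mk⇔ id id

  ¬· : Decidable P → Decidable (λ v → ¬ P v)
  ¬· (dec {χ} c s) = dec (const· 1 ∸· c) λ v → spec v (χ v) (s v)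
    where
    spec : ∀ v y → _ ⇔ y ≢ 0 → _ ⇔ 1 ∸ y ≢ 0
    spec v zero    e = mk⇔ (λ _ ()) λ _ p → to e p refl
    spec v (suc y) e = mk⇔ (λ ¬p → ⊥-elim (¬p (from e λ ()))) λ z → ⊥-elim (z (0∸n≡0 y))

  _∧·_ : Decidable P → Decidable Q → Decidable (λ v → P v × Q v)
  dec {χ} c s ∧· dec {χ′} d t = dec (c *· d) λ v → mk⇔
    (λ (p , q) e → [ to (s v) p , to (t v) q ]′ (m*n≡0⇒m≡0∨n≡0 (χ v) e))
    (λ z → from (s v) (λ e → z (cong (_* χ′ v) e)) ,
           from (t v) (λ e → z (trans (cong (χ v *_) e) (*-zeroʳ (χ v)))))

  _⇒·_ : Decidable P → Decidable Q → Decidable (λ v → P v → Q v)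
  _⇒·_ d e = resp· (λ v → mk⇔
    (λ ¬pq p → decidable-stable (decide e v) λ ¬q → ¬pq (p , ¬q))
    (λ f (p , ¬q) → ¬q (f p))) (¬· (d ∧· ¬· e))

  _∨·_ : Decidable P → Decidable Q → Decidable (λ v → P v ⊎ Q v)
  _∨·_ {P = P} {Q = Q} d e = resp· (λ v → mk⇔ (either v (decide d v)) λ where
      (inj₁ p) ¬p → ⊥-elim (¬p p)
      (inj₂ q) _  → q) (¬· d ⇒· e)
    where
    either : ∀ v → Dec (P v) → (¬ P v → Q v) → P v ⊎ Q v
    either v (yes p) h = inj₁ p
    either v (no ¬p) h = inj₂ (h ¬p)

  _⇔·_ : Decidable P → Decidable Q → Decidable (λ v → P v ⇔ Q v)
  d ⇔· e = resp· (λ v → mk⇔ (λ (p , q) → mk⇔ p q) λ h → to h , from h)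
                 ((d ⇒· e) ∧· (e ⇒· d))

  _<·_ : Computable f → Computable g → Decidable (λ v → f v < g v)
  _<·_ {f = f} {g = g} c d = dec (d ∸· c) λ v →
    mk⇔ (λ p e → <⇒≱ p (m∸n≡0⇒m≤n e)) λ z → ≰⇒> (z ∘ m≤n⇒m∸n≡0)

  _≡·_ : Computable f → Computable g → Decidable (λ v → f v ≡ g v)
  c ≡· d = resp· (λ v → mk⇔
      (λ (p , q) → ≤-antisym (≮⇒≥ q) (≮⇒≥ p))
      (λ e → <-irrefl e , <-irrefl (sym e))) (¬· (c <· d) ∧· ¬· (d <· c))

  private
    projs : ∀ {m n} → (Fin m → Fin n) → Vec (Rec n) m
    projs ρ = tabulate (projᶠ ∘ ρ)

    projs-run : ∀ {m n} (ρ : Fin m → Fin n) v → X ⊢ projs ρ [ v ]⇓* tabulate (lookup v ∘ ρ)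
    projs-run {zero}  ρ v = []
    projs-run {suc m} ρ v = ⇓proj ∷ projs-run (ρ ∘ suc) v

  under : {F : Vec ℕ (suc n) → ℕ} → Computable F → Computable f → Computable (λ v → F (f v ∷ v))
  under {F = F} (c by p) (d by q) =
    compᶠ c (d ∷ projs id) by λ v → ⇓comp
      (q v ∷ subst (X ⊢ projs id [ v ]⇓*_) (tabulate∘lookup v) (projs-run id v)) (p _)

  -- The sum of the values of `χ` below the bound is nonzero exactly if one of them is.
  ∃<· : {P : Vec ℕ (suc n) → Set} → Computable f → Decidable P →
        Decidable (λ v → ∃[ k ] (k < f v × P (k ∷ v)))
  ∃<· {n} {f} {P} b (dec {χ} (d by q) s) =
    dec (under {F = λ v → Σχ (head v) (tail v)}
           (ext· (λ { (k ∷ v) → refl }) (prim· {F = Σχ} (const· 0) step λ k v → refl)) b)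
        λ v → spec v (f v)
    where
    Σχ : ℕ → Vec ℕ n → ℕ
    Σχ zero    v = 0
    Σχ (suc k) v = χ (k ∷ v) + Σχ k v

    -- Primitive recursion passes the index, the sum so far and the parameters; the sum is dropped
    -- before `χ` is evaluated.
    step : Computable {2 + n} (λ v → χ (head v ∷ tail (tail v)) + head (tail v))
    step = _+·_ {f = λ v → χ (head v ∷ tail (tail v))} {g = λ v → head (tail v)}
      (compᶠ d (projᶠ zero ∷ projs (Fin.suc ∘ Fin.suc)) by λ { (k ∷ y ∷ v) → ⇓comp
             (⇓proj ∷ subst (X ⊢ projs (Fin.suc ∘ Fin.suc) [ k ∷ y ∷ v ]⇓*_) (tabulate∘lookup v)
                            (projs-run (Fin.suc ∘ Fin.suc) (k ∷ y ∷ v))) (q _) })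
           (ext· (λ { (k ∷ y ∷ v) → refl }) (var· (suc zero)))

    spec : ∀ v b → (∃[ k ] (k < b × P (k ∷ v))) ⇔ Σχ b v ≢ 0
    spec v zero    = mk⇔ (λ ()) λ z → ⊥-elim (z refl)
    spec v (suc b) = mk⇔ there back
      where
      there : ∃[ k ] (k < suc b × P (k ∷ v)) → χ (b ∷ v) + Σχ b v ≢ 0
      there (k , k≤b , p) e with m≤n⇒m<n∨m≡n (s≤s⁻¹ k≤b)
      ... | inj₁ k<b  = to (spec v b) (k , k<b , p) (m+n≡0⇒n≡0 (χ (b ∷ v)) e)
      ... | inj₂ refl = to (s (k ∷ v)) p (m+n≡0⇒m≡0 (χ (b ∷ v)) e)
      back : χ (b ∷ v) + Σχ b v ≢ 0 → ∃[ k ] (k < suc b × P (k ∷ v))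
      back z with χ (b ∷ v) ≟ 0
      ... | no y  = b , n<1+n b , from (s (b ∷ v)) y
      ... | yes e = let k , k<b , p = from (spec v b) (λ e′ → z (cong₂ _+_ e e′))
                    in k , m<n⇒m<1+n k<b , p

  ∀<· : {P : Vec ℕ (suc n) → Set} → Computable f → Decidable P →
        Decidable (λ v → ∀ k → k < f v → P (k ∷ v))
  ∀<· b d = resp· (λ v → mk⇔
    (λ ¬∃ k k<b → decidable-stable (decide d (k ∷ v)) λ ¬p → ¬∃ (k , k<b , ¬p))
    (λ h (k , k<b , ¬p) → ¬p (h k k<b))) (¬· (∃<· b (¬· d)))

  -- `⇓μ` looks for the first zero and wants positive values before it, so the search runs on
  -- `1 ∸ χ`, which vanishes exactly where `P` holds.
  μ· : {P : Vec ℕ (suc n) → Set} → Decidable P → (∀ v → P (f v ∷ v)) →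
       (∀ v k → P (k ∷ v) → f v ≤ k) → Computable f
  μ· {n} {f} {P} d holds least = μᶠ program by λ v → ⇓μ
      (subst (X ⊢ program [ f v ∷ v ]⇓_) (zero-iff (to (spec _) (holds v))) (correct (f v ∷ v)))
      λ k k<f → 0 , subst (X ⊢ program [ k ∷ v ]⇓_)
        (cong (1 ∸_) (decidable-stable (χ (k ∷ v) ≟ 0)
                        λ z → <⇒≱ k<f (least v k (from (spec _) z))))
        (correct (k ∷ v))
    where
    open Decidable d
    open Computable (const· 1 ∸· computable)
    zero-iff : ∀ {y} → y ≢ 0 → 1 ∸ y ≡ 0
    zero-iff {zero}  z = ⊥-elim (z refl)
    zero-iff {suc y} z = 0∸n≡0 y

-- Codes of lists

opaque
  cons : ℕ → ℕ → ℕ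
  cons x c = 2 ^ x * (1 + 2 * c)

opaque
  unfolding cons

  codeList-∷ : ∀ x xs → codeList (x ∷ xs) ≡ cons x (codeList xs)
  codeList-∷ x xs = refl

  2*-cons : ∀ x c → 2 * cons x c ≡ cons (suc x) c
  2*-cons x c = sym (*-assoc 2 (2 ^ x) (1 + 2 * c))

  cons-injective : ∀ x y {c d} → cons x c ≡ cons y d → x ≡ y × c ≡ d
  cons-injective zero    zero    {c} {d} e =
    refl , *-cancelˡ-≡ c d 2 (suc-injective (*-cancelˡ-≡ (1 + 2 * c) (1 + 2 * d) 1 e))
  cons-injective zero    (suc y) {c} {d} e =
    ⊥-elim (even≢odd (cons y d) c (trans (2*-cons y d) (trans (sym e) (*-identityˡ _))))
  cons-injective (suc x) zero    {c} {d} e =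
    ⊥-elim (even≢odd (cons x c) d (trans (2*-cons x c) (trans e (*-identityˡ _))))
  cons-injective (suc x) (suc y) {c} {d} e
    with cons-injective x y (*-cancelˡ-≡ (cons x c) (cons y d) 2
           (trans (2*-cons x c) (trans e (sym (2*-cons y d)))))
  ... | refl , q = refl , q

  n<2^n : ∀ n → n < 2 ^ n
  n<2^n zero    = s≤s z≤n
  n<2^n (suc n) = ≤-trans (+-mono-≤ (m^n>0 2 n) (n<2^n n)) (+-monoʳ-≤ (2 ^ n) (m≤m+n (2 ^ n) 0))

  x<cons : ∀ x c → x < cons x c
  x<cons x c = ≤-trans (n<2^n x) (m≤m*n (2 ^ x) (1 + 2 * c))

  c<cons : ∀ x c → c < cons x c
  c<cons x c = ≤-trans (s≤s (m≤m+n c (c + 0)))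
    (m≤n*m (1 + 2 * c) (2 ^ x) ⦃ >-nonZero (m^n>0 2 x) ⦄)

  cons≢0 : ∀ x c → cons x c ≢ 0
  cons≢0 x c e = n≮0 (subst (c <_) e (c<cons x c))

  codeList-injective : ∀ xs ys → codeList xs ≡ codeList ys → xs ≡ ys
  codeList-injective []       []       e = refl
  codeList-injective []       (y ∷ ys) e = ⊥-elim (cons≢0 y (codeList ys) (sym e))
  codeList-injective (x ∷ xs) []       e = ⊥-elim (cons≢0 x (codeList xs) e)
  codeList-injective (x ∷ xs) (y ∷ ys) e with cons-injective x y e
  ... | refl , q = cong (x ∷_) (codeList-injective xs ys q)

  length≤codeList : ∀ xs → length xs ≤ codeList xs
  length≤codeList []       = z≤n
  length≤codeList (x ∷ xs) = ≤-trans (s≤s (length≤codeList xs)) (c<cons x (codeList xs))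

data EvenOrOdd : ℕ → Set where
  even : ∀ m → EvenOrOdd (2 * m)
  odd  : ∀ m → EvenOrOdd (1 + 2 * m)

evenOrOdd : ∀ n → EvenOrOdd n
evenOrOdd zero = even 0
evenOrOdd (suc n) with evenOrOdd n
... | even m = odd m
... | odd m  = subst EvenOrOdd (cong suc (+-suc m (m + 0))) (even (suc m))

opaque
  unfolding cons

  private
    -- An odd number is a code with head 0. A positive even number arises from its half, which is a
    -- smaller code, by raising the head by one.
    codeList-surjective : ∀ n → Σ[ xs ∈ List ℕ ] codeList xs ≡ n
    codeList-surjective = <-rec _ λ n rec → go rec (evenOrOdd n)
      where
      go : ∀ {n} → (∀ {m} → m < n → Σ[ xs ∈ List ℕ ] codeList xs ≡ m) → EvenOrOdd n →
           Σ[ xs ∈ List ℕ ] codeList xs ≡ n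
      go rec (odd m) with rec {m} (s≤s (m≤m+n m (m + 0)))
      ... | xs , refl = 0 ∷ xs , *-identityˡ _
      go rec (even zero) = [] , refl
      go rec (even (suc m)) with rec {suc m} (m<m+n (suc m) (s≤s z≤n))
      ... | x ∷ xs , e = suc x ∷ xs , trans (sym (2*-cons x (codeList xs))) (cong (2 *_) e)

  decode : ℕ → List ℕ
  decode n = proj₁ (codeList-surjective n)

  codeList-decode : ∀ n → codeList (decode n) ≡ n
  codeList-decode n = proj₂ (codeList-surjective n)

decode-codeList : ∀ xs → decode (codeList xs) ≡ xs
decode-codeList xs = codeList-injective _ xs (codeList-decode (codeList xs))

opaque
  unfolding cons

  decode-cons : ∀ x c → decode (cons x c) ≡ x ∷ decode c
  decode-cons x c = trans (cong (decode ∘ cons x) (sym (codeList-decode c)))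
                          (decode-codeList (x ∷ decode c))

decode-0 : decode 0 ≡ []
decode-0 = decode-codeList []

nth : List ℕ → ℕ → ℕ
nth []       k       = 0
nth (x ∷ xs) zero    = x
nth (x ∷ xs) (suc k) = nth xs k

opaque
  unfolding cons

  hd tl : ℕ → ℕ
  hd n = nth (decode n) 0
  tl n = codeList (drop 1 (decode n))

  hd-cons : ∀ x c → hd (cons x c) ≡ x
  hd-cons x c = cong (λ xs → nth xs 0) (decode-cons x c)

  tl-cons : ∀ x c → tl (cons x c) ≡ c
  tl-cons x c = trans (cong (codeList ∘ drop 1) (decode-cons x c)) (codeList-decode c)

  hd-0 : hd 0 ≡ 0
  hd-0 = cong (λ xs → nth xs 0) decode-0

  tl-0 : tl 0 ≡ 0
  tl-0 = cong (codeList ∘ drop 1) decode-0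

data Code : ℕ → Set where
  nil  : Code 0
  cell : ∀ x c → Code (cons x c)

opaque
  unfolding cons

  code : ∀ n → Code n
  code n = subst Code (codeList-decode n) (view (decode n))
    where
    view : ∀ xs → Code (codeList xs)
    view []       = nil
    view (x ∷ xs) = cell x (codeList xs)

cons-hd-tl : ∀ n → n ≢ 0 → cons (hd n) (tl n) ≡ n
cons-hd-tl n z with code n
... | nil      = ⊥-elim (z refl)
... | cell x c = cong₂ cons (hd-cons x c) (tl-cons x c)

hd≤ : ∀ n → hd n ≤ n
hd≤ n with code n
... | nil      = ≤-reflexive hd-0
... | cell x c = ≤-trans (≤-reflexive (hd-cons x c)) (<⇒≤ (x<cons x c))

hd< : ∀ n → n ≢ 0 → hd n < n
hd< n z = subst (hd n <_) (cons-hd-tl n z) (x<cons (hd n) (tl n))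

tl< : ∀ n → n ≢ 0 → tl n < n
tl< n z = subst (tl n <_) (cons-hd-tl n z) (c<cons (hd n) (tl n))

dropᶜ : ℕ → ℕ → ℕ
dropᶜ zero    n = n
dropᶜ (suc k) n = tl (dropᶜ k n)

opaque
  unfolding cons

  dropᶜ-codeList : ∀ k xs → dropᶜ k (codeList xs) ≡ codeList (drop k xs)
  dropᶜ-codeList zero    xs       = refl
  dropᶜ-codeList (suc k) xs = trans (cong tl (dropᶜ-codeList k xs)) (shift k xs)
    where
    shift : ∀ k xs → tl (codeList (drop k xs)) ≡ codeList (drop (suc k) xs)
    shift zero    []       = tl-0
    shift zero    (x ∷ xs) = tl-cons x (codeList xs)
    shift (suc k) []       = tl-0
    shift (suc k) (x ∷ xs) = shift k xs

  -- This expresses that an entry exists without computing the length, and is the form in which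
  -- lengths occur in all decidable relations below.
  dropᶜ≢0 : ∀ k xs → dropᶜ k (codeList xs) ≢ 0 ⇔ k < length xs
  dropᶜ≢0 k xs = subst (λ c → c ≢ 0 ⇔ k < length xs) (sym (dropᶜ-codeList k xs)) (go k xs)
    where
    go : ∀ k xs → codeList (drop k xs) ≢ 0 ⇔ k < length xs
    go zero    []       = mk⇔ (λ z → ⊥-elim (z refl)) λ ()
    go zero    (x ∷ xs) = mk⇔ (λ _ → s≤s z≤n) λ _ → cons≢0 x (codeList xs)
    go (suc k) []       = mk⇔ (λ z → ⊥-elim (z refl)) λ ()
    go (suc k) (x ∷ xs) = mk⇔ (s≤s ∘ to (go k xs)) (from (go k xs) ∘ s≤s⁻¹)

nthᶜ : ℕ → ℕ → ℕ
nthᶜ k n = hd (dropᶜ k n)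

opaque
  unfolding cons

  nthᶜ-codeList : ∀ k xs → nthᶜ k (codeList xs) ≡ nth xs k
  nthᶜ-codeList k xs = trans (cong hd (dropᶜ-codeList k xs)) (go k xs)
    where
    go : ∀ k xs → hd (codeList (drop k xs)) ≡ nth xs k
    go zero    []       = hd-0
    go zero    (x ∷ xs) = hd-cons x (codeList xs)
    go (suc k) []       = hd-0
    go (suc k) (x ∷ xs) = go k xs

module CodeComputability (X : ℕ → Bool) where
  open Computability X

  private variable
    n   : ℕ
    f g : Vec ℕ n → ℕ

  opaque
    unfolding cons

    cons· : Computable f → Computable g → Computable (λ v → cons (f v) (g v))
    cons· c d = 2^· c *· (const· 1 +· (const· 2 *· d))

  -- The head is found by searching for x such that n is `cons x c`; c may be bounded by n, which
  -- keeps the relation decidable.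
  hd· : Computable f → Computable (λ v → hd (f v))
  hd· = app₁ hd (μ·
    ((var· (suc zero) ≡· const· 0) ∧· (var· zero ≡· const· 0) ∨·
     ∃<· (var· (suc zero)) (cons· (var· (suc zero)) (var· zero) ≡· var· (suc (suc zero))))
    (λ { (n ∷ []) → holds n (code n) })
    λ { (n ∷ []) k (inj₁ (refl , refl)) → ≤-reflexive hd-0
      ; (n ∷ []) k (inj₂ (c , _ , e))   → ≤-reflexive (trans (cong hd (sym e)) (hd-cons k c)) })
    where
    holds : ∀ n → Code n → (n ≡ 0 × hd n ≡ 0) ⊎ ∃[ c ] (c < n × cons (hd n) c ≡ n)
    holds _ nil        = inj₁ (refl , hd-0)
    holds _ (cell x c) = inj₂ (c , c<cons x c , cong (λ y → cons y c) (hd-cons x c))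

  tl· : Computable f → Computable (λ v → tl (f v))
  tl· = app₁ tl (μ·
    ((var· (suc zero) ≡· const· 0) ∧· (var· zero ≡· const· 0) ∨·
     ∃<· (var· (suc zero)) (cons· (var· zero) (var· (suc zero)) ≡· var· (suc (suc zero))))
    (λ { (n ∷ []) → holds n (code n) })
    λ { (n ∷ []) k (inj₁ (refl , refl)) → ≤-reflexive tl-0
      ; (n ∷ []) k (inj₂ (x , _ , e))   → ≤-reflexive (trans (cong tl (sym e)) (tl-cons x k)) })
    where
    holds : ∀ n → Code n → (n ≡ 0 × tl n ≡ 0) ⊎ ∃[ x ] (x < n × cons x (tl n) ≡ n)
    holds _ nil        = inj₁ (refl , tl-0)
    holds _ (cell x c) = inj₂ (x , x<cons x c , cong (cons x) (tl-cons x c))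

  dropᶜ· : Computable f → Computable g → Computable (λ v → dropᶜ (f v) (g v))
  dropᶜ· = app₂ dropᶜ (prim₂ dropᶜ (var· zero) (tl· (var· (suc zero))) λ k x → refl)

  nthᶜ· : Computable f → Computable g → Computable (λ v → nthᶜ (f v) (g v))
  nthᶜ· c d = hd· (dropᶜ· c d)

-- The Kleene–Brouwer order

infix 4 _≺_

data _≺_ : List ℕ → List ℕ → Set where
  longer : ∀ {a s} → a ∷ s ≺ []
  here   : ∀ {a b s t} → a < b → a ∷ s ≺ b ∷ t
  there  : ∀ {a s t} → s ≺ t → a ∷ s ≺ a ∷ t

≺-compare : ∀ s t → s ≺ t ⊎ s ≡ t ⊎ t ≺ s
≺-compare []      []      = inj₂ (inj₁ refl)
≺-compare []      (b ∷ t) = inj₂ (inj₂ longer)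
≺-compare (a ∷ s) []      = inj₁ longer
≺-compare (a ∷ s) (b ∷ t) with <-cmp a b
... | tri< p _ _ = inj₁ (here p)
... | tri> _ _ p = inj₂ (inj₂ (here p))
... | tri≈ _ refl _ with ≺-compare s t
...   | inj₁ p           = inj₁ (there p)
...   | inj₂ (inj₁ refl) = inj₂ (inj₁ refl)
...   | inj₂ (inj₂ p)    = inj₂ (inj₂ (there p))

-- All quantifiers on the right are bounded by lengths, so the order is decidable on codes.
≺-firstDifference : ∀ s t → s ≺ t ⇔
  (∃[ i ] (i < length s × (∀ j → j < i → j < length t × nth s j ≡ nth t j)
                        × (¬ i < length t ⊎ nth s i < nth t i)))
≺-firstDifference s t = mk⇔ find (λ (i , i<s , agree , d) → build s t i i<s agree d)
  where
  find : ∀ {s t} → s ≺ t → ∃[ i ] (i < length s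
         × (∀ j → j < i → j < length t × nth s j ≡ nth t j) × (¬ i < length t ⊎ nth s i < nth t i))
  find longer   = 0 , s≤s z≤n , (λ _ ()) , inj₁ λ ()
  find (here p) = 0 , s≤s z≤n , (λ _ ()) , inj₂ p
  find {a ∷ s} {a ∷ t} (there p) with find p
  ... | i , i<s , agree , d = suc i , s≤s i<s , agree′ , Sum.map₁ (_∘ s≤s⁻¹) d
    where
    agree′ : ∀ j → j < suc i → j < suc (length t) × nth (a ∷ s) j ≡ nth (a ∷ t) j
    agree′ zero    _ = s≤s z≤n , refl
    agree′ (suc j) q = let r , e = agree j (s≤s⁻¹ q) in s≤s r , e

  build : ∀ s t i → i < length s → (∀ j → j < i → j < length t × nth s j ≡ nth t j) →
          (¬ i < length t ⊎ nth s i < nth t i) → s ≺ t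
  build (a ∷ s) []      i       i<s agree d        = longer
  build (a ∷ s) (b ∷ t) zero    i<s agree (inj₁ q) = ⊥-elim (q (s≤s z≤n))
  build (a ∷ s) (b ∷ t) zero    i<s agree (inj₂ q) = here q
  build (a ∷ s) (b ∷ t) (suc i) i<s agree d with proj₂ (agree 0 (s≤s z≤n))
  ... | refl = there (build s t i (s≤s⁻¹ i<s)
                 (λ j j<i → let q , e = agree (suc j) (s≤s j<i) in s≤s⁻¹ q , e)
                 (Sum.map₁ (_∘ s≤s) d))

applyUpTo-≺ : ∀ f n → applyUpTo f (suc n) ≺ applyUpTo f n
applyUpTo-≺ f zero    = longer
applyUpTo-≺ f (suc n) = there (applyUpTo-≺ (f ∘ suc) n)

infix 4 _≺ᶜ_

_≺ᶜ_ : ℕ → ℕ → Set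
m ≺ᶜ n = decode m ≺ decode n

module KleeneBrouwerComputability (X : ℕ → Bool) where
  open Computability X
  open CodeComputability X

  ≺ᶜ· : Decidable {2} λ v → lookup v zero ≺ᶜ lookup v (suc zero)
  ≺ᶜ· = resp· (λ { (m ∷ n ∷ []) → mk⇔ (correct m n) (complete m n) })
    -- A list is no longer than its code, so m bounds the index of the first difference.
    (∃<· m (∀<· i (j<length n″ ∧· nthᶜ· j m″ ≡· nthᶜ· j n″)
           ∧· (dropᶜ· i m′ ≢0·)
           ∧· (¬· (dropᶜ· i n′ ≢0·) ∨· nthᶜ· i m′ <· nthᶜ· i n′)))
    where
    m  = var· {2} zero
    i  = var· {3} zero
    m′ = var· {3} (suc zero)
    n′ = var· {3} (suc (suc zero))
    j  = var· {4} zero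
    m″ = var· {4} (suc (suc zero))
    n″ = var· {4} (suc (suc (suc zero)))
    j<length : ∀ {f : Vec ℕ 4 → ℕ} → Computable f → Decidable (λ v → dropᶜ (lookup v zero) (f v) ≢ 0)
    j<length c = dropᶜ· j c ≢0·

    FirstDifference : ℕ → ℕ → Set
    FirstDifference m n = ∃[ i ] (i < m
      × (∀ j → j < i → dropᶜ j n ≢ 0 × nthᶜ j m ≡ nthᶜ j n)
      × dropᶜ i m ≢ 0 × (¬ dropᶜ i n ≢ 0 ⊎ nthᶜ i m < nthᶜ i n))

    ≢0⇔<length : ∀ k n → dropᶜ k n ≢ 0 ⇔ k < length (decode n)
    ≢0⇔<length k n = subst (λ c → dropᶜ k c ≢ 0 ⇔ k < length (decode n)) (codeList-decode n)
                       (dropᶜ≢0 k (decode n))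

    nthᶜ-nth : ∀ k n → nthᶜ k n ≡ nth (decode n) k
    nthᶜ-nth k n = trans (cong (nthᶜ k) (sym (codeList-decode n))) (nthᶜ-codeList k (decode n))

    correct : ∀ m n → FirstDifference m n → m ≺ᶜ n
    correct m n (i , _ , agree , i<m , d) = from (≺-firstDifference _ _)
      ( i , to (≢0⇔<length i m) i<m
      , (λ j j<i → let q , e = agree j j<i in
           to (≢0⇔<length j n) q , trans (sym (nthᶜ-nth j m)) (trans e (nthᶜ-nth j n)))
      , Sum.map (_∘ from (≢0⇔<length i n)) (subst₂ _<_ (nthᶜ-nth i m) (nthᶜ-nth i n)) d)

    complete : ∀ m n → m ≺ᶜ n → FirstDifference m n
    complete m n p with to (≺-firstDifference _ _) p
    ... | i , i<m , agree , d =
      i , ≤-trans i<m (subst (length (decode m) ≤_) (codeList-decode m) (length≤codeList (decode m)))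
      , (λ j j<i → let q , e = agree j j<i in
           from (≢0⇔<length j n) q , trans (nthᶜ-nth j m) (trans e (sym (nthᶜ-nth j n))))
      , from (≢0⇔<length i m) i<m
      , Sum.map (_∘ to (≢0⇔<length i n)) (subst₂ _<_ (sym (nthᶜ-nth i m)) (sym (nthᶜ-nth i n))) d

-- Trees of finite sequences

PrefixClosed : (List ℕ → Set) → Set
PrefixClosed S = ∀ s t → S (s ++ t) → S s

-- The inductive form supports the recursion in `≺-wellFounded`; `InfinitePath` links its failure to
-- infinite branches.
data WellFoundedTree (S : List ℕ → Set) : Set₁ where
  leaf : (∀ s → ¬ S s) → WellFoundedTree S
  node : (∀ a → WellFoundedTree (S ∘ (a ∷_))) → WellFoundedTree S

-- Below `a ∷ s` lie the sequences with a smaller first entry, handled by induction on a and in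
-- their own subtree, and the sequences `a ∷ t` with t below s in the subtree at a. The empty
-- sequence lies above all others.
≺-wellFounded : ∀ {S} → WellFoundedTree S → ∀ s → S s → Acc (λ s t → S s × s ≺ t) s
≺-wellFounded     (leaf ∅) s  Ss = ⊥-elim (∅ s Ss)
≺-wellFounded {S} (node W) s₀ Ss₀ = accessible s₀ Ss₀
  where
  _◁_ : List ℕ → List ℕ → Set
  s ◁ t = S s × s ≺ t

  mutual
    acc-∷ : ∀ a → Acc _<_ a → ∀ s → Acc (λ s t → S (a ∷ s) × s ≺ t) s → Acc _◁_ (a ∷ s)
    acc-∷ a A s B = acc (below a A s B)

    below : ∀ a → Acc _<_ a → ∀ s → Acc (λ s t → S (a ∷ s) × s ≺ t) s →
            ∀ {t} → t ◁ (a ∷ s) → Acc _◁_ t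
    below a (acc A) s B       {b ∷ t} (St , here b<a) =
      acc-∷ b (A b<a) t (≺-wellFounded (W b) t St)
    below a A       s (acc B) {a ∷ t} (St , there p)  = acc-∷ a A t (B (St , p))

  accessible-∷ : ∀ a s → S (a ∷ s) → Acc _◁_ (a ∷ s)
  accessible-∷ a s Ss = acc-∷ a (<-wellFounded a) s (≺-wellFounded (W a) s Ss)

  accessible : ∀ s → S s → Acc _◁_ s
  accessible (a ∷ s) Ss = accessible-∷ a s Ss
  accessible []      _  = acc λ { {a ∷ s} (Ss , longer) → accessible-∷ a s Ss }

module InfinitePath (em : ExcludedMiddle (lsuc 0ℓ)) where

  private
    -- Neither constructor of `WellFoundedTree` applies: S is non-empty, so it contains `[]` by
    -- prefix closure, and some subtree is again ill-founded. Iterating this choice gives the path.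
    ill-founded : ∀ {S} → PrefixClosed S → ¬ WellFoundedTree S →
                  S [] × ∃[ a ] ¬ WellFoundedTree (S ∘ (a ∷_))
    ill-founded {S} closed ill =
      Classical.stable em (λ ¬S → ill (leaf λ s Ss → ¬S (closed [] s Ss))) , child
      where
      child : ∃[ a ] ¬ WellFoundedTree (S ∘ (a ∷_))
      child with em {∃[ a ] ¬ WellFoundedTree (S ∘ (a ∷_))}
      ... | yes p = p
      ... | no ¬p = ⊥-elim (ill (node λ a → wf a em))
        where
        wf : ∀ a → Dec (WellFoundedTree (S ∘ (a ∷_))) → WellFoundedTree (S ∘ (a ∷_))
        wf a (yes w) = w
        wf a (no ¬w) = ⊥-elim (¬p (a , ¬w))

    path : ∀ {S} → PrefixClosed S → ¬ WellFoundedTree S → ℕ → ℕ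
    path closed ill zero    = proj₁ (proj₂ (ill-founded closed ill))
    path closed ill (suc n) =
      path (λ s t → closed (_ ∷ s) t) (proj₂ (proj₂ (ill-founded closed ill))) n

    path-in : ∀ {S} (closed : PrefixClosed S) (ill : ¬ WellFoundedTree S) n →
              S (applyUpTo (path closed ill) n)
    path-in closed ill zero    = proj₁ (ill-founded closed ill)
    path-in closed ill (suc n) =
      path-in (λ s t → closed (_ ∷ s) t) (proj₂ (proj₂ (ill-founded closed ill))) n

  infinitePath : ∀ {S} → PrefixClosed S → ¬ WellFoundedTree S →
                 Σ[ f ∈ (ℕ → ℕ) ] (∀ n → S (applyUpTo f n))
  infinitePath closed ill = path closed ill , path-in closed ill

-- Computable ordinals

module ComputableOrdinals (em : ExcludedMiddle (lsuc 0ℓ)) (X : ℕ → Bool) where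
  open Classical em
  open Computability X

  module WellOrder
    {D : ℕ → Set} {_≺_ : ℕ → ℕ → Set}
    (compare : ∀ x y → x ≺ y ⊎ x ≡ y ⊎ y ≺ x)
    (accessible : ∀ x → D x → Acc (λ x y → D x × x ≺ y) x) where

    _◁_ : ℕ → ℕ → Set
    x ◁ y = D x × x ≺ y

    mutual
      -- The supremum has to be indexed by ℕ, so numbers that are not predecessors of x contribute
      -- `zero`.
      rankᵃ : ∀ x → Acc _◁_ x → Ord
      rankᵃ x (acc rs) = lim λ y → sucRankᵃ x rs y (em₀ (y ◁ x))

      sucRankᵃ : ∀ x → (∀ {y} → y ◁ x → Acc _◁_ y) → ∀ y → Dec (y ◁ x) → Ord
      sucRankᵃ x rs y (yes p) = suc (rankᵃ y (rs p))
      sucRankᵃ x rs y (no _)  = zero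

    mutual
      -- Accessibility proofs cannot be identified without function extensionality; since ordinals
      -- are compared up to `_≈_`, the inequality for all p and q is enough.
      rankᵃ-irrelevant : ∀ x p q → rankᵃ x p ≤ᵒ rankᵃ x q
      rankᵃ-irrelevant x (acc rs) (acc rs′) y =
        ≤ᵒ-lim (sucRankᵃ x rs y (em₀ (y ◁ x))) y
               (sucRankᵃ-irrelevant x rs rs′ y (em₀ (y ◁ x)) (em₀ (y ◁ x)))

      sucRankᵃ-irrelevant : ∀ x (rs rs′ : ∀ {y} → y ◁ x → Acc _◁_ y) y d d′ →
                            sucRankᵃ x rs y d ≤ᵒ sucRankᵃ x rs′ y d′
      sucRankᵃ-irrelevant x rs rs′ y (yes p) (yes q) = rankᵃ-irrelevant y (rs p) (rs′ q)
      sucRankᵃ-irrelevant x rs rs′ y (yes p) (no ¬p) = ⊥-elim (¬p p)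
      sucRankᵃ-irrelevant x rs rs′ y (no _)  d       = tt

    rankᵈ : ∀ x → Dec (D x) → Ord
    rankᵈ x (yes d) = rankᵃ x (accessible x d)
    rankᵈ x (no _)  = zero

    rank : ℕ → Ord
    rank x = rankᵈ x (em₀ (D x))

    rank≤rankᵃ : ∀ x a d → D x → rankᵈ x d ≤ᵒ rankᵃ x a
    rank≤rankᵃ x a (yes d) _ = rankᵃ-irrelevant x (accessible x d) a
    rank≤rankᵃ x a (no ¬d) d = ⊥-elim (¬d d)

    rankᵃ≤rank : ∀ x a d → D x → rankᵃ x a ≤ᵒ rankᵈ x d
    rankᵃ≤rank x a (yes d) _ = rankᵃ-irrelevant x a (accessible x d)
    rankᵃ≤rank x a (no ¬d) d = ⊥-elim (¬d d)

    rank-mono : ∀ {x y} → D x → D y → x ≺ y → rank x <ᵒ rank y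
    rank-mono {x} {y} Dx Dy x≺y with accessible y Dy in e
    ... | acc rs = ≤ᵒ-trans (suc (rank x)) (rankᵃ y (acc rs)) (rank y)
                     (x , below (em₀ (x ◁ y))) (rankᵃ≤rank y (acc rs) (em₀ (D y)) Dy)
      where
      below : ∀ d → rank x <ᵒ sucRankᵃ y rs x d
      below (yes p) = rank≤rankᵃ x (rs p) (em₀ (D x)) Dx
      below (no ¬p) = ⊥-elim (¬p (Dx , x≺y))

    below-rank : ∀ {x β} → D x → β <ᵒ rank x → ∃[ y ] (y ◁ x × β ≤ᵒ rank y)
    below-rank {x} {β} Dx β<x with accessible x Dx
    ... | acc rs = let y , p = ≤ᵒ-trans (suc β) (rank x) (rankᵃ x (acc rs)) β<x
                                 (rank≤rankᵃ x (acc rs) (em₀ (D x)) Dx)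
                   in y , find y (em₀ (y ◁ x)) p
      where
      find : ∀ y d → β <ᵒ sucRankᵃ x rs y d → y ◁ x × β ≤ᵒ rank y
      find y (yes p) q = p , ≤ᵒ-trans β _ (rank y) q (rankᵃ≤rank y (rs p) (em₀ (D y)) (proj₁ p))

    -- While the rank of x exceeds β, some predecessor of x still has rank at least β. This descent
    -- stops by accessibility, and then the rank is β.
    rank-surjective : ∀ {x β} → Acc _◁_ x → D x → β ≤ᵒ rank x → ∃[ y ] (D y × rank y ≈ β)
    rank-surjective {x} {β} (acc rs) Dx β≤x with ≤ᵒ-or->ᵒ (rank x) β
    ... | inj₁ x≤β = x , Dx , x≤β , β≤x
    ... | inj₂ β<x with below-rank Dx β<x
    ...   | y , y◁x , β≤y = rank-surjective (rs y◁x) (proj₁ y◁x) β≤y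

    sucRankᵈ : ∀ x → Dec (D x) → Ord
    sucRankᵈ x (yes _) = suc (rank x)
    sucRankᵈ x (no _)  = zero

    orderType : Ord
    orderType = lim λ x → sucRankᵈ x (em₀ (D x))

    rank<orderType : ∀ {x} → D x → rank x <ᵒ orderType
    rank<orderType {x} Dx = x , below (em₀ (D x))
      where
      below : ∀ d → rank x <ᵒ sucRankᵈ x d
      below (yes _) = ≤ᵒ-refl (rank x)
      below (no ¬d) = ⊥-elim (¬d Dx)

    rank-injective : ∀ {x y} → D x → D y → rank x ≈ rank y → x ≡ y
    rank-injective {x} {y} Dx Dy (p , q) with compare x y
    ... | inj₁ x≺y        = ⊥-elim (<ᵒ-irrefl (rank x)
                              (≤ᵒ-trans (suc (rank x)) (rank y) (rank x) (rank-mono Dx Dy x≺y) q))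
    ... | inj₂ (inj₁ x≡y) = x≡y
    ... | inj₂ (inj₂ y≺x) = ⊥-elim (<ᵒ-irrefl (rank y)
                              (≤ᵒ-trans (suc (rank y)) (rank x) (rank y) (rank-mono Dy Dx y≺x) p))

    rank-reflects : ∀ {x y} → D x → D y → rank x <ᵒ rank y → x ≺ y
    rank-reflects {x} {y} Dx Dy p with compare x y
    ... | inj₁ x≺y         = x≺y
    ... | inj₂ (inj₁ refl) = ⊥-elim (<ᵒ-irrefl (rank x) p)
    ... | inj₂ (inj₂ y≺x)  = ⊥-elim (<ᵒ-irrefl (rank x)
                               (≤ᵒ-trans (suc (rank x)) (rank y) (rank x) p
                                 (<ᵒ⇒≤ᵒ (rank y) (rank x) (rank-mono Dy Dx y≺x))))

    hasOrderType : HasOrderType (λ v → D (lookup v zero))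
                                (λ v → lookup v zero ≺ lookup v (suc zero)) orderType
    hasOrderType = rank
      , (λ x → rank<orderType)
      , (λ { β (x , p) → surjective β x (em₀ (D x)) p })
      , (λ x y → rank-injective)
      , (λ x y Dx Dy → mk⇔ (rank-mono Dx Dy) (rank-reflects Dx Dy))
      where
      surjective : ∀ β x d → β <ᵒ sucRankᵈ x d → ∃[ y ] (D y × rank y ≈ β)
      surjective β x (yes Dx) p = rank-surjective (accessible x Dx) Dx p

  ComputableOrdinal-downward : ∀ α β → ComputableOrdinal X α → β ≤ᵒ α → ComputableOrdinal X β
  ComputableOrdinal-downward α β (D , R , D· , R· , g , g<α , surj , inj , iso) β≤α
    with ≤ᵒ-or->ᵒ α β
  -- Here α and β are two notations of one ordinal, and the same order serves. Otherwise some x has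
  -- rank β, and the order is cut off at x.
  ... | inj₁ α≤β = D , R , D· , R· , g
      , (λ x Dx → ≤ᵒ-trans (suc (g x)) α β (g<α x Dx) α≤β)
      , (λ γ γ<β → surj γ (≤ᵒ-trans (suc γ) β α γ<β β≤α)) , inj , iso
  ... | inj₂ β<α with surj β β<α
  ...   | x , Dx , gx≤β , β≤gx =
        (λ v → D (lookup v zero ∷ []) × R (lookup v zero ∷ x ∷ [])) , R
      , toComputes (sub₁ (fromComputes D·) (var· zero)
                    ∧· sub₂ (fromComputes R·) (var· zero) (const· x))
      , R· , g
      , (λ y (Dy , Ryx) → ≤ᵒ-trans (suc (g y)) (g x) β (to (iso y x Dy Dx) Ryx) gx≤β)
      , (λ γ γ<β → let y , Dy , gy≤γ , γ≤gy = surj γ (≤ᵒ-trans (suc γ) β α γ<β β≤α) in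
           y , (Dy , from (iso y x Dy Dx)
                      (≤ᵒ-trans (suc (g y)) (suc γ) (g x) gy≤γ (≤ᵒ-trans (suc γ) β (g x) γ<β β≤gx)))
             , gy≤γ , γ≤gy)
      , (λ y z Dy Dz → inj y z (proj₁ Dy) (proj₁ Dz))
      , (λ y z Dy Dz → iso y z (proj₁ Dy) (proj₁ Dz))

  ComputableOrdinal-suc : ∀ {α} → ComputableOrdinal X α → ComputableOrdinal X (suc α)
  ComputableOrdinal-suc {α} (D , R , D· , R· , g , g<α , surj , inj , iso) =
      (λ v → lookup v zero ≡ 0 ⊎ D (pred (lookup v zero) ∷ []))
    , (λ v → lookup v zero ≢ 0 × (lookup v one ≡ 0
               ⊎ (lookup v one ≢ 0 × R (pred (lookup v zero) ∷ pred (lookup v one) ∷ []))))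
    , toComputes (var· zero ≡· const· 0 ∨· sub₁ (fromComputes D·) (pred· (var· zero)))
    , toComputes ((var· zero ≢0·) ∧· (var· one ≡· const· 0 ∨· (var· one ≢0·)
                   ∧· sub₂ (fromComputes R·) (pred· (var· zero)) (pred· (var· one))))
    , g′ , g′<sucα , surj′ , inj′ , iso′
    where
    one : Fin 2
    one = suc zero

    D′ : ℕ → Set
    D′ x = x ≡ 0 ⊎ D (pred x ∷ [])

    -- 0 is added as a new greatest element
    g′ : ℕ → Ord
    g′ zero    = α
    g′ (suc x) = g x

    in-D : ∀ {x} → D′ (suc x) → D (x ∷ [])
    in-D (inj₂ Dx) = Dx

    g<′ : ∀ {x} → D′ (suc x) → g x <ᵒ α
    g<′ Dx = g<α _ (in-D Dx)

    g′<sucα : ∀ x → D′ x → g′ x <ᵒ suc α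
    g′<sucα zero    _  = ≤ᵒ-refl α
    g′<sucα (suc x) Dx = <ᵒ⇒≤ᵒ (g x) α (g<′ Dx)

    surj′ : ∀ β → β <ᵒ suc α → ∃[ x ] (D′ x × g′ x ≈ β)
    surj′ β β≤α with ≤ᵒ-or->ᵒ α β
    ... | inj₁ α≤β = 0 , inj₁ refl , α≤β , β≤α
    ... | inj₂ β<α = let x , Dx , e = surj β β<α in suc x , inj₂ Dx , e

    inj′ : ∀ x y → D′ x → D′ y → g′ x ≈ g′ y → x ≡ y
    inj′ zero    zero    _  _  _       = refl
    inj′ zero    (suc y) _  Dy (p , _) = ⊥-elim (<ᵒ-irrefl (g y) (≤ᵒ-trans (suc (g y)) α (g y) (g<′ Dy) p))
    inj′ (suc x) zero    Dx _  (_ , q) = ⊥-elim (<ᵒ-irrefl (g x) (≤ᵒ-trans (suc (g x)) α (g x) (g<′ Dx) q))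
    inj′ (suc x) (suc y) Dx Dy e       = cong suc (inj x y (in-D Dx) (in-D Dy) e)

    iso′ : ∀ x y → D′ x → D′ y →
           (x ≢ 0 × (y ≡ 0 ⊎ (y ≢ 0 × R (pred x ∷ pred y ∷ [])))) ⇔ g′ x <ᵒ g′ y
    iso′ zero    zero    _  _  = mk⇔ (λ (z , _) → ⊥-elim (z refl)) λ p → ⊥-elim (<ᵒ-irrefl α p)
    iso′ zero    (suc y) _  Dy = mk⇔ (λ (z , _) → ⊥-elim (z refl)) λ p → ⊥-elim (<ᵒ-irrefl α
                                   (≤ᵒ-trans (suc α) (g y) α p (<ᵒ⇒≤ᵒ (g y) α (g<′ Dy))))
    iso′ (suc x) zero    Dx _  = mk⇔ (λ _ → g<′ Dx) λ _ → (λ ()) , inj₁ refl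
    iso′ (suc x) (suc y) Dx Dy = mk⇔
      (λ { (_ , inj₂ (_ , r)) → to (iso x y (in-D Dx) (in-D Dy)) r })
      λ p → (λ ()) , inj₂ ((λ ()) , from (iso x y (in-D Dx) (in-D Dy)) p)

  module FirstNoncomputable (ω₁ : Ord) (isΩ₁ : IsΩ₁ X ω₁) where

    computable⇒<ω₁ : ∀ {α} → ComputableOrdinal X α → α <ᵒ ω₁
    computable⇒<ω₁ {α} c with ≤ᵒ-or->ᵒ ω₁ α
    ... | inj₁ p = ⊥-elim (proj₁ isΩ₁ (ComputableOrdinal-downward α ω₁ c p))
    ... | inj₂ p = p

    <ω₁⇒computable : ∀ {α} → α <ᵒ ω₁ → ComputableOrdinal X α
    <ω₁⇒computable {α} p with em {ComputableOrdinal X α}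
    ... | yes c = c
    ... | no ¬c = ⊥-elim (<ᵒ-irrefl α (≤ᵒ-trans (suc α) ω₁ α p (proj₂ isΩ₁ α ¬c)))

    ω₁-limit : ∀ α → α <ᵒ ω₁ → suc α <ᵒ ω₁
    ω₁-limit α p = computable⇒<ω₁ (ComputableOrdinal-suc (<ω₁⇒computable p))

-- Course-of-values recursion

module CourseOfValues (X : ℕ → Bool) where
  open Computability X
  open CodeComputability X

  -- In P (n ∷ t ∷ []), t codes the list of the characteristic values below n, latest first, so that
  -- the value at i is entry n ∸ suc i.
  module _ {P : Vec ℕ 2 → Set} (P· : Decidable P) where
    open Decidable P·

    abstract
      table : ℕ → ℕ
      table zero    = 0
      table (suc n) = cons (χ (n ∷ table n ∷ [])) (table n)

      -- A set defined by reference to itself: through the table, `P` may ask whether smaller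
      -- numbers belong to it.
      Fixpoint : ℕ → Set
      Fixpoint n = P (n ∷ table n ∷ [])

      Fixpoint-spec : ∀ n → Fixpoint n ⇔ P (n ∷ table n ∷ [])
      Fixpoint-spec n = mk⇔ id id

      Fixpoint· : Decidable {1} λ v → Fixpoint (lookup v zero)
      Fixpoint· = sub₂ P· (var· zero)
        (app₁ table (prim₁ table step λ k → refl) (var· zero))
        where
        step : Computable {2} λ v → cons (χ (lookup v zero ∷ lookup v (suc zero) ∷ [])) (lookup v (suc zero))
        step = cons· {f = λ v → χ (lookup v zero ∷ lookup v (suc zero) ∷ [])}
                     (ext· (λ { (_ ∷ _ ∷ []) → refl }) computable) (var· (suc zero))

      private
        nthᶜ-cons : ∀ j x c → nthᶜ (suc j) (cons x c) ≡ nthᶜ j c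
        nthᶜ-cons j x c = cong hd (go j)
          where
          go : ∀ j → dropᶜ (suc j) (cons x c) ≡ dropᶜ j c
          go zero    = tl-cons x c
          go (suc j) = cong tl (go j)

      nthᶜ-table : ∀ {i} n → i < n → nthᶜ (n ∸ suc i) (table n) ≡ χ (i ∷ table i ∷ [])
      nthᶜ-table {i} (suc n) i≤n with m≤n⇒m<n∨m≡n (s≤s⁻¹ i≤n)
      ... | inj₂ refl = trans (cong (λ j → nthᶜ j (table (suc n))) (n∸n≡0 n)) (hd-cons (χ (n ∷ table n ∷ [])) (table n))
      ... | inj₁ i<n  = trans (cong (λ j → nthᶜ j (table (suc n))) (+-∸-assoc 1 i<n))
                              (trans (nthᶜ-cons (n ∸ suc i) (χ (n ∷ table n ∷ [])) (table n)) (nthᶜ-table n i<n))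

      table-spec : ∀ {i} n → i < n → nthᶜ (n ∸ suc i) (table n) ≢ 0 ⇔ Fixpoint i
      table-spec {i} n i<n = mk⇔ (λ z → from (spec _) (z ∘ trans (nthᶜ-table n i<n)))
                                 (λ p → to (spec _) p ∘ trans (sym (nthᶜ-table n i<n)))

-- Games of ordinal length

nth-++ : ∀ s t {k} → k < length s → nth (s ++ t) k ≡ nth s k
nth-++ (x ∷ s) t {zero}  p = refl
nth-++ (x ∷ s) t {suc k} p = nth-++ s t (s≤s⁻¹ p)

nth-applyUpTo : ∀ f {n k} → k < n → nth (applyUpTo f n) k ≡ f k
nth-applyUpTo f {suc n} {zero}  p = refl
nth-applyUpTo f {suc n} {suc k} p = nth-applyUpTo (f ∘ suc) (s≤s⁻¹ p)

length-applyUpTo : ∀ (f : ℕ → ℕ) n → length (applyUpTo f n) ≡ n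
length-applyUpTo f zero    = refl
length-applyUpTo f (suc n) = cong suc (length-applyUpTo (f ∘ suc) n)

-- Next p m q: in position p, Duplicator may answer the move m by going to position q.
-- Survives γ p: from p, Duplicator can answer γ moves, Spoiler counting down an ordinal.
Survives : (ℕ → ℕ → ℕ → Set) → Ord → ℕ → Set
Survives Next zero    p = ⊤
Survives Next (suc γ) p = Survives Next γ p × (∀ m → ∃[ q ] (Next p m q × Survives Next γ q))
Survives Next (lim f) p = ∀ i → Survives Next (f i) p

Survives-mono : ∀ {Next} α β {p} → β ≤ᵒ α → Survives Next α p → Survives Next β p
Survives-mono α       zero    β≤α       w       = tt
Survives-mono α       (lim f) β≤α       w       = λ i → Survives-mono α (f i) (β≤α i) w
Survives-mono (suc α) (suc β) β≤α       (w , n) = Survives-mono α β β≤α w , λ m →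
  let q , r , u = n m in q , r , Survives-mono α β β≤α u
Survives-mono (lim g) (suc β) (i , β≤α) w       = Survives-mono (g i) (suc β) β≤α (w i)

module GameBoundedness
  (em : ExcludedMiddle (lsuc 0ℓ)) (X : ℕ → Bool) (ω₁ : Ord) (isΩ₁ : IsΩ₁ X ω₁)
  (Start : ℕ → Set) (Next : ℕ → ℕ → ℕ → Set)
  (Start· : Computability.Decidable X {1} (λ v → Start (lookup v zero)))
  (Next·  : Computability.Decidable X {3}
              (λ v → Next (lookup v zero) (lookup v (suc zero)) (lookup v (suc (suc zero)))))
  (start≢0 : ∀ {p} → Start p → p ≢ 0) (next≢0 : ∀ {p m q} → Next p m q → q ≢ 0) where

  open Classical em
  open Computability X
  open CodeComputability X
  open KleeneBrouwerComputability X
  open CourseOfValues X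
  open ComputableOrdinals em X
  open FirstNoncomputable ω₁ isΩ₁

  -- A number k codes a history, latest round first. A round `cons x m` consists of the element x of
  -- D to which Spoiler counts down and his move m, so `top` is his last element. For the empty
  -- history 0 it is 0, the code of the empty sequence, which is the greatest element of the order.
  top : ℕ → ℕ
  top k = hd (hd k)

  -- Here f sends each history to the position that Duplicator reaches. As positions are nonzero,
  -- the value 0 can mark histories with an illegal round, after which nothing is demanded. Spoiler
  -- plays legally if he names an element of D below the previous one.
  Move : (ℕ → Set) → (ℕ → ℕ) → ℕ → Set
  Move D f k = (k ≡ 0 → Start (f 0)) ×
    (k ≢ 0 → D (top k) → top k ≺ᶜ top (tl k) → f (tl k) ≢ 0 → Next (f (tl k)) (tl (hd k)) (f k))

  -- The condition at k consults f only at 0, `tl k` and k, and D only at `top k`.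
  Move-resp : ∀ D D′ {f f′ k} → (k ≢ 0 → D′ (top k) → D (top k)) → (∀ j → j ≤ k → f j ≡ f′ j) →
              Move D f k → Move D′ f′ k
  Move-resp D D′ {k = k} d e (p , q) =
      (λ { refl → subst Start (e 0 z≤n) (p refl) })
    , (λ k≢0 d′ lt z → subst₂ (λ x y → Next x (tl (hd k)) y) (e (tl k) (<⇒≤ (tl< k k≢0))) (e k ≤-refl)
         (q k≢0 (d k≢0 d′) lt (z ∘ trans (sym (e (tl k) (<⇒≤ (tl< k k≢0)))))))

  Run : Vec ℕ 2 → Set
  Run v = ∀ k → k < lookup v zero → dropᶜ k (lookup v zero) ≢ 0 →
    Move (λ i → nthᶜ (lookup v zero ∸ suc i) (lookup v (suc zero)) ≢ 0) (λ j → nthᶜ j (lookup v zero)) k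

  Run· : Decidable Run
  Run· = ∀<· (var· zero) ((dropᶜ· k n ≢0·) ⇒·
    ((k ≡· const· 0 ⇒· sub₁ Start· (nthᶜ· (const· 0) n)) ∧·
     ((k ≢0·) ⇒· (nthᶜ· (n ∸· suc· (hd· (hd· k))) t ≢0·) ⇒·
      sub₂ ≺ᶜ· (hd· (hd· k)) (hd· (hd· (tl· k))) ⇒· (nthᶜ· (tl· k) n ≢0·) ⇒·
      sub₃ Next· (nthᶜ· (tl· k) n) (tl· (hd· k)) (nthᶜ· k n))))
    where
    k = var· {3} zero
    n = var· {3} (suc zero)
    t = var· {3} (suc (suc zero))

  D : ℕ → Set
  D = Fixpoint Run·

  Tree : List ℕ → Set
  Tree s = D (codeList s)

  top< : ∀ k → k ≢ 0 → top k < k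
  top< k k≢0 = ≤-<-trans (hd≤ (hd k)) (hd< k k≢0)

  -- This resolves the circularity: `top k` < k < `length s` ≤ `codeList s`, so the table for s
  -- already contains the value that decides membership of `top k`.
  Tree-spec : ∀ s → Tree s ⇔ (∀ k → k < length s → Move D (nth s) k)
  Tree-spec s = mk⇔ (λ r → forth (to (Fixpoint-spec Run· (codeList s)) r))
                    (λ h → from (Fixpoint-spec Run· (codeList s)) (back h))
    where
    Tabulated : ℕ → Set
    Tabulated i = nthᶜ (codeList s ∸ suc i) (table Run· (codeList s)) ≢ 0

    k<c : ∀ k → k < length s → k < codeList s
    k<c k p = ≤-trans p (length≤codeList s)

    forth : Run (codeList s ∷ table Run· (codeList s) ∷ []) → ∀ k → k < length s → Move D (nth s) k
    forth r k k<s = Move-resp Tabulated D (λ k≢0 → from (table-spec Run· _ (<-trans (top< k k≢0) (k<c k k<s))))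
      (λ j _ → nthᶜ-codeList j s) (r k (k<c k k<s) (from (dropᶜ≢0 k s) k<s))

    back : (∀ k → k < length s → Move D (nth s) k) → Run (codeList s ∷ table Run· (codeList s) ∷ [])
    back h k k<c z = Move-resp D Tabulated (λ k≢0 → to (table-spec Run· _ (<-trans (top< k k≢0) k<c)))
      (λ j _ → sym (nthᶜ-codeList j s)) (h k (to (dropᶜ≢0 k s) z))

  Tree-closed : PrefixClosed Tree
  Tree-closed s t p = from (Tree-spec s) λ k k<s →
    Move-resp D D (λ _ → id) (λ j j≤k → nth-++ s t (≤-<-trans j≤k k<s))
      (to (Tree-spec (s ++ t)) p k (≤-trans k<s (subst (length s ≤_) (sym (length-++ s)) (m≤m+n _ _))))

  Branch : (ℕ → ℕ) → Set
  Branch f = ∀ n → Tree (applyUpTo f n)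

  Branch-spec : ∀ f → Branch f ⇔ (∀ k → Move D f k)
  Branch-spec f = mk⇔
    (λ b k → Move-resp D D (λ _ → id) (λ j j≤k → nth-applyUpTo f (s≤s j≤k))
       (to (Tree-spec (applyUpTo f (suc k))) (b (suc k)) k
           (≤-reflexive (sym (length-applyUpTo f (suc k))))))
    (λ h n → from (Tree-spec (applyUpTo f n)) λ k k<n →
       Move-resp D D (λ _ → id)
         (λ j j≤k → sym (nth-applyUpTo f (≤-<-trans j≤k (subst (k <_) (length-applyUpTo f n) k<n))))
         (h k))

  -- The initial segments of a branch descend in the Kleene–Brouwer order on D, so along
  -- them Spoiler never runs out of ordinals.
  branch⇒survives : ∀ f → Branch f → Start (f 0) × (∀ γ → Survives Next γ (f 0))
  branch⇒survives f b = start , λ γ → survives γ 0 0 (trans (cong hd hd-0) hd-0) (start≢0 start)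
    where
    moves = to (Branch-spec f) b

    start : Start (f 0)
    start = proj₁ (moves 0) refl

    -- The count γ of `Survives` is independent of the countdown in D: in round n Spoiler names the
    -- initial segment of f of length n, whatever γ is.
    survives : ∀ γ k n → top k ≡ codeList (applyUpTo f n) → f k ≢ 0 → Survives Next γ (f k)
    survives zero    k n e z = tt
    survives (lim g) k n e z = λ i → survives (g i) k n e z
    survives (suc γ) k n e z = survives γ k n e z , λ m → let r = next m in
      f (k′ m) , r , survives γ (k′ m) (suc n) (top-k′ m) (next≢0 r)
      where
      x = codeList (applyUpTo f (suc n))
      -- The history k followed by the round in which Spoiler names the segment of length `suc n`
      -- and plays m.
      k′ : ℕ → ℕ
      k′ m = cons (cons x m) k
      top-k′ : ∀ m → top (k′ m) ≡ x
      top-k′ m = trans (cong hd (hd-cons _ k)) (hd-cons x m)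
      next : ∀ m → Next (f k) m (f (k′ m))
      next m = subst₂ (λ i j → Next (f i) j (f (k′ m)))
        (tl-cons _ k) (trans (cong tl (hd-cons _ k)) (tl-cons x m))
        (proj₂ (moves (k′ m)) (cons≢0 _ k) (subst D (sym (top-k′ m)) (b (suc n)))
          (subst₂ _≺_ (sym (trans (cong decode (top-k′ m)) (decode-codeList _)))
                      (sym (trans (cong decode (trans (cong top (tl-cons _ k)) e)) (decode-codeList _)))
                      (applyUpTo-≺ f n))
          (z ∘ trans (cong f (sym (tl-cons _ k)))))

  accessible : WellFoundedTree Tree → ∀ x → D x → Acc (λ x y → D x × x ≺ᶜ y) x
  accessible W x Dx = go x (≺-wellFounded W (decode x) (subst D (sym (codeList-decode x)) Dx))
    where
    go : ∀ x → Acc (λ s t → Tree s × s ≺ t) (decode x) → Acc (λ x y → D x × x ≺ᶜ y) x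
    go x (acc rs) = acc λ {y} (Dy , p) → go y (rs (subst D (sym (codeList-decode y)) Dy , p))

  ≺ᶜ-compare : ∀ x y → x ≺ᶜ y ⊎ x ≡ y ⊎ y ≺ᶜ x
  ≺ᶜ-compare x y = Sum.map₂ (Sum.map₁ λ e →
    trans (sym (codeList-decode x)) (trans (cong codeList e) (codeList-decode y)))
    (≺-compare (decode x) (decode y))

  -- If D is well-ordered then its order type is computable, hence below ω₁, and a strategy
  -- surviving that long is a branch.
  wellFounded⇒branch : WellFoundedTree Tree → (∀ γ → γ <ᵒ ω₁ → ∃[ p ] (Start p × Survives Next γ p)) →
                       ∃[ f ] Branch f
  wellFounded⇒branch W h = (λ k → proj₁ (strategy (decode k))) , from (Branch-spec _) moves
    where
    open WellOrder ≺ᶜ-compare (accessible W)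

    good : ∃[ p ] (Start p × Survives Next orderType p)
    good = h orderType (computable⇒<ω₁
      (_ , _ , toComputes (Fixpoint· Run·) , toComputes ≺ᶜ· , hasOrderType))

    -- Duplicator keeps enough in hand to survive as many moves as the rank of Spoiler's last
    -- element. The invariant is waived at the value 0, the default after an illegal round.
    Position : List ℕ → Set
    Position ks = Σ[ q ∈ ℕ ] (q ≢ 0 → D (top (codeList ks)) × Survives Next (rank (top (codeList ks))) q)

    Legal : List ℕ → ℕ → ℕ → Set
    Legal ks q a = D (hd a) × hd a ≺ᶜ top (codeList ks) × q ≢ 0

    top-∷ : ∀ a ks → top (codeList (a ∷ ks)) ≡ hd a
    top-∷ a ks = cong hd (trans (cong hd (codeList-∷ a ks)) (hd-cons a (codeList ks)))

    answer : ∀ a ks (p : Position ks) → Legal ks (proj₁ p) a →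
             ∃[ q ] (Next (proj₁ p) (tl a) q × Survives Next (rank (hd a)) q)
    answer a ks (q , inv) (Da , lt , z) =
      let Dt , w = inv z
      in proj₂ (Survives-mono (rank (top (codeList ks))) (suc (rank (hd a)))
                              (rank-mono Da Dt lt) w) (tl a)

    extend : ∀ a ks (p : Position ks) → Dec (Legal ks (proj₁ p) a) → Position (a ∷ ks)
    extend a ks p (yes l) = let q , _ , w = answer a ks p l in
      q , λ _ → subst (λ x → D x × Survives Next (rank x) q) (sym (top-∷ a ks)) (proj₁ l , w)
    extend a ks p (no _)  = 0 , λ z → ⊥-elim (z refl)

    strategy : ∀ ks → Position ks
    strategy [] = proj₁ good , λ _ → subst (λ x → D x × Survives Next (rank x) (proj₁ good))
      (sym (trans (cong hd hd-0) hd-0))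
      (D0 , Survives-mono orderType (rank 0) (<ᵒ⇒≤ᵒ (rank 0) orderType (rank<orderType D0))
              (proj₂ (proj₂ good)))
      where
      D0 : D 0
      D0 = from (Tree-spec []) λ _ ()
    strategy (a ∷ ks) = extend a ks (strategy ks) (em₀ _)

    extend-next : ∀ a ks (p : Position ks) d → Legal ks (proj₁ p) a →
                  Next (proj₁ p) (tl a) (proj₁ (extend a ks p d))
    extend-next a ks p (yes l) _ = proj₁ (proj₂ (answer a ks p l))
    extend-next a ks p (no ¬l) l = ⊥-elim (¬l l)

    moves : ∀ k → Move D (λ k → proj₁ (strategy (decode k))) k
    moves k = (λ _ → subst (λ ks → Start (proj₁ (strategy ks))) (sym decode-0) (proj₁ (proj₂ good)))
            , λ k≢0 Dk lt z → subst (λ ks → Next (proj₁ (strategy (decode (tl k)))) (tl (hd k)) (proj₁ (strategy ks)))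
                (trans (sym (decode-cons (hd k) (tl k))) (cong decode (cons-hd-tl k k≢0)))
                (extend-next (hd k) (decode (tl k)) (strategy (decode (tl k))) (em₀ _)
                  (Dk , subst (λ c → top k ≺ᶜ top c) (sym (codeList-decode (tl k))) lt , z))

  -- Either case of the distinction yields a branch, in the first one in contradiction to `W`; its
  -- value at the empty history is the position sought.
  boundedness : (∀ γ → γ <ᵒ ω₁ → ∃[ p ] (Start p × Survives Next γ p)) →
                ∃[ p ] (Start p × (∀ γ → Survives Next γ p))
  boundedness h = uncurry branch⇒survives′ (branch em)
    where
    branch : Dec (WellFoundedTree Tree) → ∃[ f ] Branch f
    branch (yes W) = wellFounded⇒branch W h
    branch (no ¬W) = InfinitePath.infinitePath em Tree-closed ¬W

    branch⇒survives′ : ∀ f → Branch f → ∃[ p ] (Start p × (∀ γ → Survives Next γ p))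
    branch⇒survives′ f b = f 0 , branch⇒survives f b

-- Substitution

module _ {τ : Vocabulary} where
  private variable
    n m k : ℕ

  mutual
    -- The composite enters as any υ that agrees pointwise, which avoids function extensionality, in
    -- particular for functions on `Fin 0`.
    subᵗ-∘ : {σ : Fin m → Term τ k} {ρ : Fin n → Term τ m} {υ : Fin n → Term τ k} →
             (∀ i → subᵗ σ (ρ i) ≡ υ i) → ∀ t → subᵗ σ (subᵗ ρ t) ≡ subᵗ υ t
    subᵗ-∘ e (var i)    = e i
    subᵗ-∘ e (fun f ts) = cong (fun f) (subᵗˢ-∘ e ts)

    subᵗˢ-∘ : ∀ {l} {σ : Fin m → Term τ k} {ρ : Fin n → Term τ m} {υ : Fin n → Term τ k} →
              (∀ i → subᵗ σ (ρ i) ≡ υ i) → ∀ (ts : Vec (Term τ n) l) → subᵗˢ σ (subᵗˢ ρ ts) ≡ subᵗˢ υ ts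
    subᵗˢ-∘ e []       = refl
    subᵗˢ-∘ e (t ∷ ts) = cong₂ _∷_ (subᵗ-∘ e t) (subᵗˢ-∘ e ts)

  lift-∘ : {σ : Fin m → Term τ k} {ρ : Fin n → Term τ m} {υ : Fin n → Term τ k} →
           (∀ i → subᵗ σ (ρ i) ≡ υ i) → ∀ i → subᵗ (Defs.lift σ) (Defs.lift ρ i) ≡ Defs.lift υ i
  lift-∘         e zero    = refl
  lift-∘ {ρ = ρ} e (suc i) =
    trans (subᵗ-∘ (λ j → refl) (ρ i))
          (trans (sym (subᵗ-∘ (λ j → refl) (ρ i))) (cong (subᵗ (var ∘ suc)) (e i)))

  -- Only `_≋_` can be had here, because the two sides of a disjunction are distinct families of
  -- formulas.
  sub-∘ : {σ : Fin m → Term τ k} {ρ : Fin n → Term τ m} {υ : Fin n → Term τ k} →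
          (∀ i → subᵗ σ (ρ i) ≡ υ i) → ∀ A → sub σ (sub ρ A) ≋ sub υ A
  sub-∘ {σ = σ} {ρ} {υ} e (s ≐ᶠ t) =
    subst₂ (λ s′ t′ → (subᵗ σ (subᵗ ρ s) ≐ᶠ subᵗ σ (subᵗ ρ t)) ≋ (s′ ≐ᶠ t′))
           (subᵗ-∘ e s) (subᵗ-∘ e t) (_ ≐ᶠ _)
  sub-∘ e (rel R ts) = subst (λ ts′ → rel R _ ≋ rel R ts′) (subᵗˢ-∘ e ts) (rel R _)
  sub-∘ e ⊥̇          = ⊥̇
  sub-∘ e (¬̇ A)      = ¬̇ sub-∘ e A
  sub-∘ e (A ∧̇ B)    = sub-∘ e A ∧̇ sub-∘ e B
  sub-∘ e (∃̇ A)      = ∃̇ (sub-∘ (lift-∘ e) A)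
  sub-∘ e (⋁̇ F)      = ⋁̇ (λ i → i , sub-∘ e (F i)) (λ i → i , sub-∘ e (F i))

  ≋-sym : {A B : Formula τ n} → A ≋ B → B ≋ A
  ≋-sym ⊥̇          = ⊥̇
  ≋-sym (s ≐ᶠ t)   = s ≐ᶠ t
  ≋-sym (rel R ts) = rel R ts
  ≋-sym (¬̇ p)      = ¬̇ ≋-sym p
  ≋-sym (p ∧̇ q)    = ≋-sym p ∧̇ ≋-sym q
  ≋-sym (∃̇ p)      = ∃̇ (≋-sym p)
  ≋-sym (⋁̇ F G)    = ⋁̇ (λ j → proj₁ (G j) , ≋-sym (proj₂ (G j)))
                       (λ i → proj₁ (F i) , ≋-sym (proj₂ (F i)))

  -- Satisfaction, soundness and universal closures

  module _ (M : Structure τ) where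

    mutual
      eval-sub : (σ : Fin n → Term τ m) (u : Vec (Carrier M) m) (t : Term τ n) →
                 eval M u (subᵗ σ t) ≡ eval M (tabulate (eval M u ∘ σ)) t
      eval-sub σ u (var i)    = sym (lookup∘tabulate (eval M u ∘ σ) i)
      eval-sub σ u (fun f ts) = cong (funᴹ M f) (evals-sub σ u ts)

      evals-sub : (σ : Fin n → Term τ m) (u : Vec (Carrier M) m) (ts : Vec (Term τ n) k) →
                  evals M u (subᵗˢ σ ts) ≡ evals M (tabulate (eval M u ∘ σ)) ts
      evals-sub σ u []       = refl
      evals-sub σ u (t ∷ ts) = cong₂ _∷_ (eval-sub σ u t) (evals-sub σ u ts)

    tabulate-lift : (σ : Fin n → Term τ m) (u : Vec (Carrier M) m) (a : Carrier M) →
                    tabulate (eval M (a ∷ u) ∘ Defs.lift σ) ≡ a ∷ tabulate (eval M u ∘ σ)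
    tabulate-lift σ u a = cong (a ∷_) (tabulate-cong λ i →
      trans (eval-sub (var ∘ suc) (a ∷ u) (σ i))
            (cong (λ v → eval M v (σ i)) (tabulate∘lookup u)))

    ⊨-sub : (σ : Fin n → Term τ m) (u : Vec (Carrier M) m) (A : Formula τ n) →
            M ⊨ sub σ A [ u ] ⇔ M ⊨ A [ tabulate (eval M u ∘ σ) ]
    ⊨-sub σ u ⊥̇          = mk⇔ id id
    ⊨-sub σ u (s ≐ᶠ t)   = mk⇔
      (λ p → trans (sym (eval-sub σ u s)) (trans p (eval-sub σ u t)))
      (λ p → trans (eval-sub σ u s) (trans p (sym (eval-sub σ u t))))
    ⊨-sub σ u (rel R ts) = mk⇔ (subst (relᴹ M R) (evals-sub σ u ts))
                               (subst (relᴹ M R) (sym (evals-sub σ u ts)))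
    ⊨-sub σ u (¬̇ A)      = mk⇔ (_∘ from (⊨-sub σ u A)) (_∘ to (⊨-sub σ u A))
    ⊨-sub σ u (A ∧̇ B)    = mk⇔ (λ (p , q) → to (⊨-sub σ u A) p , to (⊨-sub σ u B) q)
                               (λ (p , q) → from (⊨-sub σ u A) p , from (⊨-sub σ u B) q)
    ⊨-sub σ u (∃̇ A)      = mk⇔
      (λ (a , p) → a , subst (M ⊨ A [_]) (tabulate-lift σ u a) (to (⊨-sub (Defs.lift σ) (a ∷ u) A) p))
      (λ (a , p) → a , from (⊨-sub (Defs.lift σ) (a ∷ u) A) (subst (M ⊨ A [_]) (sym (tabulate-lift σ u a)) p))
    ⊨-sub σ u (⋁̇ F)      = mk⇔ (λ (i , p) → i , to (⊨-sub σ u (F i)) p)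
                               (λ (i , p) → i , from (⊨-sub σ u (F i)) p)

    ⊨-weaken : (a : Carrier M) (u : Vec (Carrier M) m) (A : Formula τ m) →
               M ⊨ ren suc A [ a ∷ u ] ⇔ M ⊨ A [ u ]
    ⊨-weaken a u A = subst (λ v → M ⊨ ren suc A [ a ∷ u ] ⇔ M ⊨ A [ v ]) (tabulate∘lookup u)
                           (⊨-sub (var ∘ suc) (a ∷ u) A)

    ⊨-instantiate : (t : Term τ m) (u : Vec (Carrier M) m) (A : Formula τ (suc m)) →
                    M ⊨ instantiate t A [ u ] ⇔ M ⊨ A [ eval M u t ∷ u ]
    ⊨-instantiate t u A =
      subst (λ v → M ⊨ instantiate t A [ u ] ⇔ M ⊨ A [ eval M u t ∷ v ]) (tabulate∘lookup u) (⊨-sub _ u A)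

    ⊨-≋ : {A B : Formula τ n} (v : Vec (Carrier M) n) → A ≋ B → M ⊨ A [ v ] → M ⊨ B [ v ]
    ⊨-≋ v ⊥̇          p       = p
    ⊨-≋ v (s ≐ᶠ t)   p       = p
    ⊨-≋ v (rel R ts) p       = p
    ⊨-≋ v (¬̇ e)      p       = p ∘ ⊨-≋ v (≋-sym e)
    ⊨-≋ v (e ∧̇ f)    (p , q) = ⊨-≋ v e p , ⊨-≋ v f q
    ⊨-≋ v (∃̇ e)      (a , p) = a , ⊨-≋ (a ∷ v) e p
    ⊨-≋ v (⋁̇ F _)    (i , p) = proj₁ (F i) , ⊨-≋ v (proj₂ (F i)) p

  ⊨-close : ExcludedMiddle (lsuc 0ℓ) → ∀ (M : Structure τ) n {A} → M ⊨ close n A ⇔ (∀ v → M ⊨ A [ v ])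
  ⊨-close em M zero    = mk⇔ (λ { p [] → p }) λ h → h []
  ⊨-close em M (suc n) = mk⇔
    (λ { p (a ∷ v) → Classical.stable em λ ¬q → to (⊨-close em M n) p v (a , ¬q) })
    (λ h → from (⊨-close em M n) λ { v (a , ¬q) → ¬q (h (a ∷ v)) })

  -- It shows that a set of formulas with a realization is finitarily consistent.
  soundness : ExcludedMiddle (lsuc 0ℓ) → (M : Structure τ) {Γ : Formula τ n → Set} {ρ : Fin n → Fin m} →
    ∀ {Δ A} → Γ ∣ k ∣ ρ ∣ Δ ⊢ A → (u : Vec (Carrier M) m) →
    (∀ B → Γ B → M ⊨ B [ tabulate (lookup u ∘ ρ) ]) → (∀ B → B ∈ˡ Δ → M ⊨ B [ u ]) → M ⊨ A [ u ]
  soundness em M = sound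
    where
    sound : ∀ {n m k} {Γ : Formula τ n → Set} {ρ : Fin n → Fin m} {Δ A} →
      Γ ∣ k ∣ ρ ∣ Δ ⊢ A → (u : Vec (Carrier M) m) →
      (∀ B → Γ B → M ⊨ B [ tabulate (lookup u ∘ ρ) ]) → (∀ B → B ∈ˡ Δ → M ⊨ B [ u ]) → M ⊨ A [ u ]

    discharge : ∀ {m} {A : Formula τ m} {Δ} {u : Vec (Carrier M) m} →
      M ⊨ A [ u ] → (∀ B → B ∈ˡ Δ → M ⊨ B [ u ]) → ∀ B → B ∈ˡ A ∷ Δ → M ⊨ B [ u ]
    discharge p h B (hereˡ refl) = p
    discharge p h B (thereˡ b)   = h B b

    sound (glob {A = A} {ρ = ρ} γ) u g h = from (⊨-sub M (var ∘ ρ) u A) (g A γ)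
    sound (hyp b)         u g h = h _ b
    sound (conv e d)      u g h = ⊨-≋ M u e (sound d u g h)
    sound (¬-intro d)     u g h = λ p → sound d u g (discharge p h)
    sound (¬-elim d e)    u g h = sound d u g h (sound e u g h)
    sound (raa d)         u g h = Classical.stable em λ ¬p → sound d u g (discharge ¬p h)
    sound (∧-intro d e)   u g h = sound d u g h , sound e u g h
    sound (∧-elimˡ d)     u g h = proj₁ (sound d u g h)
    sound (∧-elimʳ d)     u g h = proj₂ (sound d u g h)
    sound (∃-intro {A = A} t d) u g h = eval M u t , to (⊨-instantiate M t u A) (sound d u g h)
    sound (∃-elim {A = A} {B = B} {Δ = Δ} d e) u g h =
      let a , p = sound d u g h in
      to (⊨-weaken M a u B) (sound e (a ∷ u) g (discharge p λ C c →
        let C′ , c′ , eq = ∈-map⁻ (ren suc) c in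
        subst (λ C → M ⊨ C [ a ∷ u ]) (sym eq) (from (⊨-weaken M a u C′) (h C′ c′))))
    sound (⋁-intro i d)   u g h = i , sound d u g h
    sound (⋁-elim d e)    u g h = let i , p = sound d u g h in sound (e i) u g (discharge p h)
    sound (≐-refl t)      u g h = refl
    sound (≐-subst {s = s} {t = t} A d e) u g h = from (⊨-instantiate M t u A)
      (subst (λ a → M ⊨ A [ a ∷ u ]) (sound d u g h) (to (⊨-instantiate M s u A) (sound e u g h)))

  -- Rules with several premises want equal heights. Asking for derivations at all sufficiently
  -- large heights replaces a lemma on raising the height. The local hypotheses vary because the
  -- negated goal is added to them for `raa`, once for each quantifier.
  close-elim : ∀ {Γ : Formula τ n → Set} {ρ : Fin n → Fin m} l {A} →
    (∀ ε Δ → ∃[ K ] (∀ k → K ≤ k → Γ ∣ k ∣ ρ ∣ Δ ⊢ sub ε (close l A))) → (σ : Fin l → Term τ m) →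
    ∀ Δ → ∃[ K ] (∀ k → K ≤ k → Γ ∣ k ∣ ρ ∣ Δ ⊢ sub σ A)
  close-elim zero        d σ Δ = d σ Δ
  close-elim (suc l) {A} d σ Δ =
    let K , e = close-elim l d (σ ∘ suc) (¬̇ sub σ A ∷ Δ) in
    -- The four steps are `raa`, `¬-elim`, `∃-intro` and `conv`; the first two lie below both
    -- branches, hence the height `2 + k` on the left.
    4 + K , λ { (suc (suc (suc (suc k)))) (s≤s (s≤s (s≤s (s≤s p)))) →
      raa (¬-elim (e (2 + k) (m≤n⇒m≤1+n (m≤n⇒m≤1+n p)))
        (∃-intro (σ zero) (conv (≋-sym (sub-∘ instantiate-lift (¬̇ A))) (hyp (hereˡ refl))))) }
    where
    instantiate-lift : ∀ i → subᵗ _ (Defs.lift (σ ∘ suc) i) ≡ σ i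
    instantiate-lift zero    = refl
    instantiate-lift (suc i) = trans (subᵗ-∘ (λ j → refl) (σ (suc i))) (subᵗ-var (σ (suc i)))
      where
      mutual
        subᵗ-var : ∀ {n} (t : Term τ n) → subᵗ var t ≡ t
        subᵗ-var (var i)    = refl
        subᵗ-var (fun f ts) = cong (fun f) (subᵗˢ-var ts)

        subᵗˢ-var : ∀ {n k} (ts : Vec (Term τ n) k) → subᵗˢ var ts ≡ ts
        subᵗˢ-var []       = refl
        subᵗˢ-var (t ∷ ts) = cong₂ _∷_ (subᵗ-var t) (subᵗˢ-var ts)

  -- The absurd function λ () in the definition of thmₙ is not definitionally equal to any other
  -- function Fin 0 → Fin n, so it is read off from the type thmₙ S n A by unification.
  private
    inferRenaming : ∀ (S : Theory τ) n A {ρ : Sentence τ → Fin 0 → Fin n} →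
                    (thmₙ S n A → ∃[ B ] (thm S B × A ≡ ren (ρ B) B)) → Sentence τ → Fin 0 → Fin n
    inferRenaming S n A {ρ} _ = ρ

  fromEmpty : Theory τ → ∀ n → Sentence τ → Fin 0 → Fin n
  fromEmpty S n = inferRenaming S n ⊥̇ id

  thmₙ-intro : ∀ (S : Theory τ) n {B} → thm S B → thmₙ S n (ren (fromEmpty S n B) B)
  thmₙ-intro S n {B} s = B , s , refl

  -- The argument is syntactic, since a type is given by consistency and not by a realization:
  -- instantiating the closure at the variables themselves derives `¬̇ θ`, against θ in p.
  type-consistent-with-theory : ∀ {S : Theory τ} {p : Formula τ n → Set} {θ} → IsType S n p → p θ →
                                ¬ thm S (close n (¬̇ θ))
  type-consistent-with-theory {n = n} {S} {p} {θ} t pθ s =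
    let K , d = close-elim n (λ ε Δ → 1 , λ { (suc k) _ →
                  conv (sub-∘ (λ ()) (close n (¬̇ θ))) (glob (inj₁ (thmₙ-intro S n s))) }) var []
    in IsType.consistent t (suc K , ¬-elim (d K ≤-refl) (glob (inj₂ pθ)))

-- Types realized in models

module Types (em : ExcludedMiddle (lsuc 0ℓ)) {τ : Vocabulary} where
  open Classical em

  private variable
    n : ℕ

  -- The set p only has to be equivalent to the type of v, so that the range of an enumeration may
  -- be taken for it. Maximality holds because a false A has its negation in p.
  realized-isType : ∀ {S : Theory τ} {p : Formula τ n → Set} (M : Structure τ) (v : Vec (Carrier M) n) →
    M ⊨ᵀ S → (∀ A → lang S n A → lang S n (¬̇ A)) → (∀ A → p A ⇔ typeOf (lang S) M v A) → IsType S n p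
  realized-isType {n = n} {S} {p} M v M⊨S ¬-closed p⇔ = record
    { in-lang    = λ A pA → proj₁ (to (p⇔ A) pA)
    ; consistent = λ (k , d) → soundness em M d v true (λ B ())
    ; maximal    = maximal
    }
    where
    true : ∀ B → (thmₙ S n ∪ p) B → M ⊨ B [ tabulate (lookup v ∘ id) ]
    true B (inj₁ (C , s , e)) = subst (λ B → M ⊨ B [ _ ]) (sym e) (from (⊨-sub M _ _ C) (M⊨S C s))
    true B (inj₂ pB)          = subst (M ⊨ B [_]) (sym (tabulate∘lookup v)) (proj₂ (to (p⇔ B) pB))

    maximal : ∀ A → lang S n A → FinitarilyConsistent (thmₙ S n ∪ p ∪ (_≡ A)) → p A
    maximal A l c = from (p⇔ A) (l , stable λ ¬q → c
      (1 , ¬-elim (glob (inj₂ (inj₁ (from (p⇔ (¬̇ A)) (¬-closed A l , ¬q))))) (glob (inj₂ (inj₂ refl)))))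

  record SameType (L : FormulaSet τ) (M : Structure τ) (v : Vec (Carrier M) n)
                  (N : Structure τ) (w : Vec (Carrier N) n) : Set where
    constructor same
    field transfer : ∀ A → L n A → M ⊨ A [ v ] ⇔ N ⊨ A [ w ]

  open SameType public

  sameType : ∀ {L : FormulaSet τ} {M N} {v : Vec (Carrier M) n} {w : Vec (Carrier N) n} →
             (∀ A → L n A → L n (¬̇ A)) → (∀ A → L n A → M ⊨ A [ v ] → N ⊨ A [ w ]) →
             SameType L M v N w
  sameType ¬-closed h = same λ A l →
    mk⇔ (h A l) λ q → stable λ ¬p → h (¬̇ A) (¬-closed A l) ¬p q

  principal-realized : ∀ {S : Theory τ} {p : Formula τ n → Set} {N : Structure τ} {w : Vec (Carrier N) n} →
    N ⊨ᵀ S → ((θ , _) : Principal S n p) → N ⊨ θ [ w ] → ∀ A → p A → N ⊨ A [ w ]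
  principal-realized {n = n} {N = N} {w} N⊨S (θ , _ , generates) q A pA =
    stable λ ¬q → to (⊨-close em N n) (N⊨S _ (generates A pA)) w (q , ¬q)

  -- A type over lang S is generated by a formula of S or its conjunction belongs to nextLang S;
  -- in both cases its realizability is expressed by an existential formula of nextLang S.
  extendSameType : ∀ {S : Theory τ} {M N : Structure τ} {v : Vec (Carrier M) n} {w : Vec (Carrier N) n} →
    IsωComplete S → M ⊨ᵀ S → N ⊨ᵀ S → SameType (nextLang S) M v N w →
    ∀ a → ∃[ b ] SameType (lang S) M (a ∷ v) N (b ∷ w)
  extendSameType {n = n} {S} {M} {N} {v} {w} complete M⊨S N⊨S (same transfer) a = extend (em₀ _)
    where
    open IsωComplete complete using (fragment)
    module F = IsFragment fragment

    p : Formula τ (suc n) → Set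
    p = typeOf (lang S) M (a ∷ v)

    conclude : ∀ b → (∀ A → p A → N ⊨ A [ b ∷ w ]) → SameType (lang S) M (a ∷ v) N (b ∷ w)
    conclude b h = sameType (λ A → F.¬-in) λ A l q → h A (l , q)

    enum = F.countable (suc n)

    -- A conjunction is indexed by ℕ and the enumeration covers the whole language, so formulas
    -- outside p are replaced by a tautology, which lies in p.
    keep : ∀ {A} → Dec (p A) → Formula τ (suc n)
    keep {A} (yes _) = A
    keep     (no _)  = ¬̇ ⊥̇

    e : ℕ → Formula τ (suc n)
    e i = keep (em₀ (p (proj₁ enum i)))

    p-resp : ∀ {A B} → A ≋ B → p A → p B
    p-resp A≋B (l , q) = F.resp A≋B l , ⊨-≋ M (a ∷ v) A≋B q

    keep-p : ∀ {A} d → p (keep {A} d)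
    keep-p (yes q) = q
    keep-p (no _)  = F.¬-in F.⊥-in , λ ()

    keep-≋ : ∀ {A B} d → p B → B ≋ A → B ≋ keep {A} d
    keep-≋ (yes _) pB B≋A = B≋A
    keep-≋ (no ¬p) pB B≋A = ⊥-elim (¬p (p-resp B≋A pB))

    range⇒p : ∀ A → Range e A → p A
    range⇒p A (i , A≋e) = p-resp (≋-sym A≋e) (keep-p (em₀ _))

    p⇒range : ∀ A → p A → Range e A
    p⇒range A pA = let i , A≋ = proj₂ enum A (proj₁ pA) in i , keep-≋ (em₀ _) pA A≋

    rangeIsType : IsType S (suc n) (Range e)
    rangeIsType = realized-isType M (a ∷ v) M⊨S (λ A → F.¬-in) λ A → mk⇔ (range⇒p A) (p⇒range A)

    extend : Dec (Principal S (suc n) p) → ∃[ b ] SameType (lang S) M (a ∷ v) N (b ∷ w)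
    extend (yes g@(θ , (l , q) , _)) =
      let b , r = to (transfer (∃̇ θ) (gen (inj₁ (F.∃-in l)))) (a , q) in
      b , conclude b (principal-realized {S = S} {p = p} {w = b ∷ w} N⊨S g r)
    extend (no ¬g) =
      let b , r = to (transfer (∃̇ (⋀̇ e)) (∃-in (gen (inj₂ (e , refl , rangeIsType , nonprincipal)))))
                     (a , λ (i , ¬q) → ¬q (proj₂ (keep-p (em₀ _)))) in
      b , conclude b λ A pA → let i , A≋e = p⇒range A pA in
        ⊨-≋ N (b ∷ w) (≋-sym A≋e) (stable λ ¬q → r (i , ¬q))
      where
      nonprincipal : ¬ Principal S (suc n) (Range e)
      nonprincipal (θ , r , generates) = ¬g (θ , range⇒p θ r , λ ψ pψ → generates ψ (p⇒range ψ pψ))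

-- Back-and-forth equivalence

module _ {τ : Vocabulary} where
  private variable
    n : ℕ
    M N K : Structure τ

  -- Only unnested atomic formulas are compared. These are equalities and the facts listed in an
  -- atomic diagram, and they suffice for an isomorphism once all elements are listed.
  record PartialIsomorphism (M : Structure τ) (v : Vec (Carrier M) n)
                            (N : Structure τ) (w : Vec (Carrier N) n) : Set where
    field
      equality : ∀ i j → lookup v i ≡ lookup v j ⇔ lookup w i ≡ lookup w j
      relation : ∀ R is → relᴹ M R (Vec.map (lookup v) is) ⇔ relᴹ N R (Vec.map (lookup w) is)
      function : ∀ f is j → funᴹ M f (Vec.map (lookup v) is) ≡ lookup v j
                          ⇔ funᴹ N f (Vec.map (lookup w) is) ≡ lookup w j

  open PartialIsomorphism public

  BackAndForth : Ord → ∀ {n} (M : Structure τ) → Vec (Carrier M) n → (N : Structure τ) → Vec (Carrier N) n → Set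
  BackAndForth zero    M v N w = PartialIsomorphism M v N w
  BackAndForth (suc γ) M v N w = BackAndForth γ M v N w
    × (∀ a → ∃[ b ] BackAndForth γ M (a ∷ v) N (b ∷ w))
    × (∀ b → ∃[ a ] BackAndForth γ M (a ∷ v) N (b ∷ w))
  BackAndForth (lim f) M v N w = ∀ i → BackAndForth (f i) M v N w

  BackAndForth⇒PartialIsomorphism : ∀ γ {v : Vec (Carrier M) n} {w : Vec (Carrier N) n} →
    BackAndForth γ M v N w → PartialIsomorphism M v N w
  BackAndForth⇒PartialIsomorphism zero    e = e
  BackAndForth⇒PartialIsomorphism (suc γ) e = BackAndForth⇒PartialIsomorphism γ (proj₁ e)
  BackAndForth⇒PartialIsomorphism (lim f) e = BackAndForth⇒PartialIsomorphism (f 0) (e 0)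

  PartialIsomorphism-sym : {v : Vec (Carrier M) n} {w : Vec (Carrier N) n} →
    PartialIsomorphism M v N w → PartialIsomorphism N w M v
  PartialIsomorphism-sym e = record
    { equality    = λ i j → Symmetry.equivalence (equality e i j)
    ; relation = λ R is → Symmetry.equivalence (relation e R is)
    ; function = λ f is j → Symmetry.equivalence (function e f is j)
    }

  BackAndForth-sym : ∀ γ {n} {v : Vec (Carrier M) n} {w : Vec (Carrier N) n} →
    BackAndForth γ M v N w → BackAndForth γ N w M v
  BackAndForth-sym zero    e = PartialIsomorphism-sym e
  BackAndForth-sym (suc γ) (e , forth , back) = BackAndForth-sym γ e
    , (λ b → let a , e′ = back b in a , BackAndForth-sym γ e′)
    , (λ a → let b , e′ = forth a in b , BackAndForth-sym γ e′)
  BackAndForth-sym (lim f) e = λ i → BackAndForth-sym (f i) (e i)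

  BackAndForth-trans : ∀ γ {n} {v : Vec (Carrier M) n} {w : Vec (Carrier N) n} {u : Vec (Carrier K) n} →
    BackAndForth γ M v N w → BackAndForth γ N w K u → BackAndForth γ M v K u
  BackAndForth-trans zero e d = record
    { equality    = λ i j → Composition.equivalence (equality e i j) (equality d i j)
    ; relation = λ R is → Composition.equivalence (relation e R is) (relation d R is)
    ; function = λ f is j → Composition.equivalence (function e f is j) (function d f is j)
    }
  BackAndForth-trans (suc γ) (e , forth , back) (d , forth′ , back′) = BackAndForth-trans γ e d
    , (λ a → let b , e′ = forth a ; c , d′ = forth′ b in c , BackAndForth-trans γ e′ d′)
    , (λ c → let b , d′ = back′ c ; a , e′ = back b in a , BackAndForth-trans γ e′ d′)
  BackAndForth-trans (lim f) e d = λ i → BackAndForth-trans (f i) (e i) (d i)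

  evals-var : ∀ (M : Structure τ) (v : Vec (Carrier M) n) {k} (is : Vec (Fin n) k) →
              evals M v (Vec.map var is) ≡ Vec.map (lookup v) is
  evals-var M v []       = refl
  evals-var M v (i ∷ is) = cong (lookup v i ∷_) (evals-var M v is)

  -- Countability is merely an injection into ℕ, so stage k + 1 adds on each side the element with
  -- number k, provided that there is one.
  module Zigzag (em : ExcludedMiddle (lsuc 0ℓ)) (M N : Structure τ)
    (Z : ∀ {n} → Vec (Carrier M) n → Vec (Carrier N) n → Set) (Z-[] : Z [] [])
    (Z⇒PartialIsomorphism : ∀ {n} {v : Vec (Carrier M) n} {w} → Z v w → PartialIsomorphism M v N w)
    (Z-forth : ∀ {n} {v : Vec (Carrier M) n} {w} → Z v w → ∀ a → ∃[ b ] Z (a ∷ v) (b ∷ w))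
    (Z-back : ∀ {n} {v : Vec (Carrier M) n} {w} → Z v w → ∀ b → ∃[ a ] Z (a ∷ v) (b ∷ w)) where

    open Classical em

    ιᴹ = proj₁ (countable M)
    ιᴺ = proj₁ (countable N)

    record State : Set where
      field
        {size}    : ℕ
        {left}    : Vec (Carrier M) size
        {right}   : Vec (Carrier N) size
        invariant : Z left right

    open State

    addLeft : ∀ {k} → State → Dec (∃[ a ] ιᴹ a ≡ k) → State
    addLeft s (yes (a , _)) = record { invariant = proj₂ (Z-forth (invariant s) a) }
    addLeft s (no _)        = s

    addRight : ∀ {k} → State → Dec (∃[ b ] ιᴺ b ≡ k) → State
    addRight s (yes (b , _)) = record { invariant = proj₂ (Z-back (invariant s) b) }
    addRight s (no _)        = s

    stage : ℕ → State
    stage zero    = record { invariant = Z-[] }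
    stage (suc k) = addRight {k} (addLeft {k} (stage k) (em₀ _)) (em₀ _)

    Pair : State → Carrier M → Carrier N → Set
    Pair s a b = ∃[ i ] (lookup (left s) i ≡ a × lookup (right s) i ≡ b)

    addLeft-mono : ∀ {k} s d {a b} → Pair s a b → Pair (addLeft {k} s d) a b
    addLeft-mono s (yes _) (i , p) = suc i , p
    addLeft-mono s (no _)  p       = p

    addRight-mono : ∀ {k} s d {a b} → Pair s a b → Pair (addRight {k} s d) a b
    addRight-mono s (yes _) (i , p) = suc i , p
    addRight-mono s (no _)  p       = p

    stage-mono : ∀ {k l a b} → k ≤ l → Pair (stage k) a b → Pair (stage l) a b
    stage-mono k≤l = go (≤⇒≤′ k≤l)
      where
      go : ∀ {k l a b} → k ≤′ l → Pair (stage k) a b → Pair (stage l) a b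
      go (≤′-reflexive refl) p = p
      go (≤′-step q)         p = addRight-mono _ (em₀ _) (addLeft-mono _ (em₀ _) (go q p))

    addLeft-covers : ∀ s a d → ∃[ b ] Pair (addLeft {ιᴹ a} s d) a b
    addLeft-covers s a (yes (a′ , e)) = _ , zero , proj₂ (countable M) e , refl
    addLeft-covers s a (no ¬a)        = ⊥-elim (¬a (a , refl))

    addRight-covers : ∀ s b d → ∃[ a ] Pair (addRight {ιᴺ b} s d) a b
    addRight-covers s b (yes (b′ , e)) = _ , zero , refl , proj₂ (countable N) e
    addRight-covers s b (no ¬b)        = ⊥-elim (¬b (b , refl))

    covers : ∀ a → ∃[ b ] Pair (stage (suc (ιᴹ a))) a b
    covers a = let b , p = addLeft-covers (stage (ιᴹ a)) a (em₀ _) in b , addRight-mono _ (em₀ _) p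

    coversʳ : ∀ b → ∃[ a ] Pair (stage (suc (ιᴺ b))) a b
    coversʳ b = addRight-covers _ b (em₀ _)

    iso : ∀ k → PartialIsomorphism M (left (stage k)) N (right (stage k))
    iso k = Z⇒PartialIsomorphism (invariant (stage k))

    -- Pairs from two stages occur together at the later one, where `equality` applies. This makes
    -- the two maps inverse to each other.
    compatible : ∀ k l {a a′ b b′} → Pair (stage k) a b → Pair (stage l) a′ b′ → a ≡ a′ ⇔ b ≡ b′
    compatible k l p q
      with stage-mono (m≤m⊔n k l) p | stage-mono (m≤n⊔m k l) q
    ... | i , refl , refl | j , refl , refl = equality (iso (k ⊔ l)) i j

    toᶻ : Carrier M → Carrier N
    toᶻ a = proj₁ (covers a)

    fromᶻ : Carrier N → Carrier M
    fromᶻ b = proj₁ (coversʳ b)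

    Pairs : ℕ → ∀ {n} → Vec (Carrier M) n → Set
    Pairs k []       = ⊤
    Pairs k (a ∷ as) = Pair (stage k) a (toᶻ a) × Pairs k as

    Pairs-mono : ∀ {k l n} (as : Vec (Carrier M) n) → k ≤ l → Pairs k as → Pairs l as
    Pairs-mono []       k≤l ps       = tt
    Pairs-mono (a ∷ as) k≤l (p , ps) = stage-mono k≤l p , Pairs-mono as k≤l ps

    coversAll : ∀ {n} (as : Vec (Carrier M) n) → ∃[ k ] Pairs k as
    coversAll []       = 0 , tt
    coversAll (a ∷ as) = let k , ps = coversAll as in suc (ιᴹ a) ⊔ k
      , stage-mono (m≤m⊔n (suc (ιᴹ a)) k) (proj₂ (covers a))
      , Pairs-mono as (m≤n⊔m (suc (ιᴹ a)) k) ps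

    indices : ∀ {k n} (as : Vec (Carrier M) n) → Pairs k as →
      ∃[ is ] (Vec.map (lookup (left (stage k))) is ≡ as × Vec.map (lookup (right (stage k))) is ≡ Vec.map toᶻ as)
    indices []       _                    = [] , refl , refl
    indices (a ∷ as) ((i , e , e′) , ps) = let is , es , es′ = indices as ps in
      i ∷ is , cong₂ _∷_ e es , cong₂ _∷_ e′ es′

    isomorphism : M ≅ N
    isomorphism = record
      { bij = mk↔ₛ′ toᶻ fromᶻ
          (λ b → to (compatible (suc (ιᴹ (fromᶻ b))) (suc (ιᴺ b)) (proj₂ (covers (fromᶻ b))) (proj₂ (coversʳ b))) refl)
          (λ a → from (compatible (suc (ιᴺ (toᶻ a))) (suc (ιᴹ a)) (proj₂ (coversʳ (toᶻ a))) (proj₂ (covers a))) refl)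
      ; rel-pres = λ R as →
          let k , ps = coversAll as ; is , e , e′ = indices as ps in
          subst₂ (λ x y → relᴹ M R x ⇔ relᴹ N R y) e e′ (relation (iso k) R is)
      ; fun-pres = λ f as →
          -- The value is covered along with the arguments, because `function` compares it only with
          -- listed elements.
          let k , (j , q , q′) , ps = coversAll (funᴹ M f as ∷ as) ; is , e , e′ = indices as ps in
          sym (subst₂ (λ x y → funᴹ N f x ≡ y) e′ q′
                (to (function (iso k) f is j) (trans (cong (funᴹ M f) e) (sym q))))
      }

-- Equivalence of models along a branch of nodes

module Branches (em : ExcludedMiddle (lsuc 0ℓ)) {τ : Vocabulary} {φ : Sentence τ} {T : Ord → Theory τ}
                (branch : IsBranch φ T) where
  open Classical em
  open Types em
  open IsBranch branch

  complete-suc : ∀ γ → IsωComplete (T (suc γ))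
  complete-suc γ = Extends.ω-complete (T-suc γ)

  nextLang⊆ : ∀ γ {n A} → nextLang (T γ) n A → lang (T (suc γ)) n A
  nextLang⊆ γ = from (Extends.language (T-suc γ) _ _)

  lang-suc : ∀ γ {n A} → lang (T γ) n A → lang (T (suc γ)) n A
  lang-suc γ l = nextLang⊆ γ (gen (inj₁ l))

  lang-≈ : ∀ α β {n A} → α ≤ᵒ β → β ≤ᵒ α → lang (T α) n A → lang (T β) n A
  lang-≈ α β p q = to (proj₁ (T-cong α β (p , q)) _ _)

  lang-limit : ∀ δ {γ n A} → IsLimit δ → γ <ᵒ δ → lang (T γ) n A → lang (T δ) n A
  lang-limit δ {γ} limit p l = from (proj₁ (T-lim δ limit) _ _) (γ , p , l)

  -- A notation `lim f` need not denote a limit, as f need not increase. If it is above α and not a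
  -- limit, then it denotes the same ordinal as some `f j`, and the induction continues there.
  lang-mono : ∀ α β {n A} → α ≤ᵒ β → lang (T α) n A → lang (T β) n A
  lang-mono α zero    p l = lang-≈ α zero p tt l
  lang-mono α (suc β) p l with ≤ᵒ-or->ᵒ α β
  ... | inj₁ α≤β = lang-suc β (lang-mono α β α≤β l)
  ... | inj₂ β<α = lang-≈ α (suc β) p β<α l
  lang-mono α (lim f) p l with ≤ᵒ-or->ᵒ (lim f) α
  ... | inj₁ q       = lang-≈ α (lim f) p q l
  ... | inj₂ (i , q) with em₀ (∀ γ → γ <ᵒ lim f → suc γ <ᵒ lim f)
  ...   | yes limit = lang-limit (lim f) (≤ᵒ-trans (suc zero) (suc α) (lim f) tt (i , q) , limit) (i , q) l
  ...   | no ¬limit with ¬∀⇒∃¬ ¬limit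
  ...     | γ , ¬h with ¬∀⇒∃¬ ¬h
  ...       | (j , γ<fj) , ¬sγ<lim with ≤ᵒ-or->ᵒ (lim f) (suc γ)
  ...         | inj₂ sγ<lim = ⊥-elim (¬sγ<lim sγ<lim)
  ...         | inj₁ lim≤sγ = lang-≈ (f j) (lim f) (≤ᵒ-lim (f j) j (≤ᵒ-refl (f j))) lim≤fj
                                (lang-mono α (f j) (≤ᵒ-trans α (lim f) (f j) p lim≤fj) l)
    where
    lim≤fj : lim f ≤ᵒ f j
    lim≤fj = ≤ᵒ-trans (lim f) (suc γ) (f j) lim≤sγ γ<fj

  weaken : ∀ {L L′ : FormulaSet τ} {n M N} {v : Vec (Carrier M) n} {w : Vec (Carrier N) n} →
           (∀ {A} → L n A → L′ n A) → SameType L′ M v N w → SameType L M v N w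
  weaken L⊆L′ (same h) = same λ A l → h A (L⊆L′ l)

  sameType-sym : ∀ {L : FormulaSet τ} {n M N} {v : Vec (Carrier M) n} {w : Vec (Carrier N) n} →
                 SameType L M v N w → SameType L N w M v
  sameType-sym (same h) = same λ A l → Symmetry.equivalence (h A l)

  -- The level is `suc γ` because successor nodes are ω-complete in a fragment by definition. In the
  -- step from γ to `suc γ` the node `T (suc (suc γ))` speaks the language that `extendSameType`
  -- needs over `T (suc γ)`.
  sameType⇒BackAndForth : ∀ γ {n M N} {v : Vec (Carrier M) n} {w : Vec (Carrier N) n} →
    (∀ β → β ≤ᵒ suc γ → M ⊨ᵀ T β × N ⊨ᵀ T β) → SameType (lang (T (suc γ))) M v N w → BackAndForth γ M v N w
  sameType⇒BackAndForth zero {M = M} {N} {v} {w} models (same h) = record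
    { equality    = λ i j → h _ (F.≐-in (var i) (var j))
    ; relation = λ R is → subst₂ (λ x y → relᴹ M R x ⇔ relᴹ N R y) (evals-var M v is) (evals-var N w is)
                            (h _ (F.rel-in R (Vec.map var is)))
    ; function = λ f is j → subst₂ (λ x y → funᴹ M f x ≡ lookup v j ⇔ funᴹ N f y ≡ lookup w j)
                              (evals-var M v is) (evals-var N w is)
                              (h _ (F.≐-in (fun f (Vec.map var is)) (var j)))
    }
    where module F = IsFragment (IsωComplete.fragment (complete-suc zero))
  sameType⇒BackAndForth (suc γ) {M = M} {N} {v} {w} models s =
      sameType⇒BackAndForth γ models′ (weaken (lang-suc (suc γ)) s)
    , (λ a → let b , s′ = extendSameType (complete-suc γ) M⊨T N⊨T next a in
         b , sameType⇒BackAndForth γ models′ s′)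
    , (λ b → let a , s′ = extendSameType (complete-suc γ) N⊨T M⊨T (sameType-sym next) b in
         a , sameType⇒BackAndForth γ models′ (sameType-sym s′))
    where
    models′ : ∀ β → β ≤ᵒ suc γ → M ⊨ᵀ T β × N ⊨ᵀ T β
    models′ β p = models β (≤ᵒ-trans β (suc γ) (suc (suc γ)) p (α≤sucα (suc γ)))
    M⊨T = proj₁ (models (suc γ) (α≤sucα (suc γ)))
    N⊨T = proj₂ (models (suc γ) (α≤sucα (suc γ)))
    next : SameType (nextLang (T (suc γ))) M v N w
    next = weaken {L = nextLang (T (suc γ))} (nextLang⊆ (suc γ)) s
  sameType⇒BackAndForth (lim f) models s i = sameType⇒BackAndForth (f i)
    (λ β p → models β (≤ᵒ-trans β (suc (f i)) (suc (lim f)) p fi≤lim))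
    (weaken (lang-mono (suc (f i)) (suc (lim f)) fi≤lim) s)
    where
    fi≤lim : f i ≤ᵒ lim f
    fi≤lim = ≤ᵒ-lim (f i) i (≤ᵒ-refl (f i))

-- Homogeneity

module Homogeneity
  (em : ExcludedMiddle (lsuc 0ℓ)) {τ : Vocabulary} (M : Structure τ)
  (X : ℕ → Bool) (ι : Carrier M → ℕ) (ι-injective : ∀ {a b} → ι a ≡ ι b → a ≡ b)
  (diagram : ComputesList X (Diagram M ι)) (ω₁ : Ord) (isΩ₁ : IsΩ₁ X ω₁) where

  open Classical em
  open Computability X
  open CodeComputability X

  private variable
    n : ℕ

  toList-map : ∀ {A B : Set} (f : A → B) {k} (xs : Vec A k) →
               Vec.toList (Vec.map f xs) ≡ List.map f (Vec.toList xs)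
  toList-map f []       = refl
  toList-map f (x ∷ xs) = cong (f x ∷_) (toList-map f xs)

  pairs : Vec (Carrier M) n → Vec (Carrier M) n → List ℕ
  pairs []      []      = []
  pairs (a ∷ v) (b ∷ w) = cons (ι a) (ι b) ∷ pairs v w

  position : Vec (Carrier M) n → Vec (Carrier M) n → ℕ
  position v w = codeList (pairs v w)

  position-∷ : ∀ a b (v w : Vec (Carrier M) n) → position (a ∷ v) (b ∷ w) ≡ cons (cons (ι a) (ι b)) (position v w)
  position-∷ a b v w = codeList-∷ (cons (ι a) (ι b)) (pairs v w)

  numbers : Vec (Carrier M) n → List (Fin n) → List ℕ
  numbers v is = List.map (ι ∘ lookup v) is

  numbers-toList : ∀ (v : Vec (Carrier M) n) {k} (is : Vec (Fin n) k) →
                   numbers v (Vec.toList is) ≡ List.map ι (Vec.toList (Vec.map (lookup v) is))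
  numbers-toList v is = trans (map-∘ (Vec.toList is)) (cong (List.map ι) (sym (toList-map (lookup v) is)))

  numbers-suc : ∀ a (v : Vec (Carrier M) n) is → numbers (a ∷ v) (List.map suc is) ≡ numbers v is
  numbers-suc a v is = sym (map-∘ is)

  numbers⁻¹ : ∀ (v : Vec (Carrier M) n) is {k} (as : Vec (Carrier M) k) → List.map ι (Vec.toList as) ≡ numbers v is →
              ∃[ is′ ] (Vec.toList is′ ≡ is × as ≡ Vec.map (lookup v) is′)
  numbers⁻¹ v []       []       e = [] , refl , refl
  numbers⁻¹ v (i ∷ is) (a ∷ as) e =
    let is′ , q , r = numbers⁻¹ v is as (∷-injectiveʳ e)
    in i ∷ is′ , cong (i ∷_) q , cong₂ _∷_ (ι-injective (∷-injectiveˡ e)) r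

  codes-injective : ∀ {k} (as bs : Vec (Carrier M) k) →
                    List.map ι (Vec.toList as) ≡ List.map ι (Vec.toList bs) → as ≡ bs
  codes-injective []       []       _ = refl
  codes-injective (a ∷ as) (b ∷ bs) e =
    cong₂ _∷_ (ι-injective (∷-injectiveˡ e)) (codes-injective as bs (∷-injectiveʳ e))

  rel⁻¹ : ∀ {xs} R as → Diagram M ι xs → xs ≡ 1 ∷ codeʳ τ R ∷ List.map ι (Vec.toList as) → relᴹ M R as
  rel⁻¹ R as (rel R′ as′ r) e with codeʳ-inj τ (∷-injectiveˡ (∷-injectiveʳ e))
  ... | refl = subst (relᴹ M R) (codes-injective as′ as (∷-injectiveʳ (∷-injectiveʳ e))) r

  fun⁻¹ : ∀ {xs} f as b → Diagram M ι xs → xs ≡ 2 ∷ codeᶠ τ f ∷ ι b ∷ List.map ι (Vec.toList as) → funᴹ M f as ≡ b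
  fun⁻¹ f as b (fun f′ as′) e with codeᶠ-inj τ (∷-injectiveˡ (∷-injectiveʳ e))
  ... | refl = trans (cong (funᴹ M f) (sym (codes-injective as′ as (∷-injectiveʳ (∷-injectiveʳ (∷-injectiveʳ e))))))
                     (ι-injective (∷-injectiveˡ (∷-injectiveʳ (∷-injectiveʳ e))))

  dom⁻¹ : ∀ {xs} x → Diagram M ι xs → xs ≡ 0 ∷ x ∷ [] → ∃[ a ] ι a ≡ x
  dom⁻¹ x (dom a) e = a , ∷-injectiveˡ (∷-injectiveʳ e)

  -- One format serves all facts of the diagram: the tag t, the code k of the symbol, then the
  -- arguments, preceded by the value in the case of a function.
  transport : {v w : Vec (Carrier M) n} → PartialIsomorphism M v M w → ∀ t k is →
              Diagram M ι (t ∷ k ∷ numbers v is) → Diagram M ι (t ∷ k ∷ numbers w is)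
  transport {n} {v} {w} iso t k is d = go t k is d refl
    where
    go : ∀ t k is {xs} → Diagram M ι xs → xs ≡ t ∷ k ∷ numbers v is → Diagram M ι (t ∷ k ∷ numbers w is)
    -- In this fact k is the number of the element and the list is empty, so the tuple does not
    -- occur.
    go t k []       (dom a) refl = dom a
    go t k (j ∷ js) (dom a) ()
    go t k is (rel R as r) e
      with refl ← ∷-injectiveˡ e | refl ← ∷-injectiveˡ (∷-injectiveʳ e)
         | is′ , refl , refl ← numbers⁻¹ v is as (∷-injectiveʳ (∷-injectiveʳ e)) =
      subst (λ xs → Diagram M ι (1 ∷ codeʳ τ R ∷ xs)) (sym (numbers-toList w is′))
            (rel R _ (to (relation iso R is′) r))
    go t k []       (fun f as) ()
    go t k (j ∷ js) (fun f as) e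
      with refl ← ∷-injectiveˡ e | refl ← ∷-injectiveˡ (∷-injectiveʳ e)
         | is′ , refl , refl ← numbers⁻¹ v js as (∷-injectiveʳ (∷-injectiveʳ (∷-injectiveʳ e))) =
      subst₂ (λ x xs → Diagram M ι (2 ∷ codeᶠ τ f ∷ x ∷ xs))
             (cong ι (to (function iso f is′ j) (ι-injective (∷-injectiveˡ (∷-injectiveʳ (∷-injectiveʳ e))))))
             (sym (numbers-toList w is′)) (fun f _)

  -- The back-and-forth game as a game on numbers

  Holds : ℕ → Set
  Holds c = ∃[ xs ] (c ≡ codeList xs × Diagram M ι xs)

  Dom : ℕ → Set
  Dom x = Holds (cons 0 (cons x 0))

  Entry : ℕ → ℕ → ℕ → Set
  Entry q x y = ∃[ i ] (i < q × nthᶜ i q ≡ cons x y)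

  -- The bound `A + B` exceeds every index of either list, and the disjunction forces the lists to
  -- have equal length.
  Matched : ℕ → ℕ → ℕ → Set
  Matched q A B = ∀ i → i < A + B → (dropᶜ i A ≢ 0 ⊎ dropᶜ i B ≢ 0) →
                  dropᶜ i A ≢ 0 × dropᶜ i B ≢ 0 × Entry q (nthᶜ i A) (nthᶜ i B)

  -- Equality is not recorded in the diagram, so it is tested separately on the first two entries,
  -- which exist if `tl A` is nonzero.
  Agree : ℕ → ℕ → ℕ → ℕ → ℕ → Set
  Agree q t k A B = Matched q A B → (Holds (cons t (cons k A)) ⇔ Holds (cons t (cons k B)))
                                  × (tl A ≢ 0 → hd A ≡ hd (tl A) ⇔ hd B ≡ hd (tl B))

  -- The move [s, c, t, k, A, B] asks for a partner of c, on the right if s is 0 and on the left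
  -- otherwise, and tests an atomic formula on the lists A and B of partners.
  Answer : (s c t k A B p q : ℕ) → Set
  Answer s c t k A B p q =
      (¬ Dom c × p ≢ 0 × q ≡ p)
    ⊎ ((∃[ x ] (x < q × ∃[ y ] (y < q × q ≡ cons (cons x y) p × Dom x × Dom y ×
         ((s ≡ 0 × x ≡ c) ⊎ (s ≢ 0 × y ≡ c)))))
       × Agree q t k A B)

  Next : ℕ → ℕ → ℕ → Set
  Next p m q = Answer (nthᶜ 0 m) (nthᶜ 1 m) (nthᶜ 2 m) (nthᶜ 3 m) (nthᶜ 4 m) (nthᶜ 5 m) p q

  Start : ℕ → ℕ → ℕ → Set
  Start a p₀ p = ∃[ x ] (x < p × p ≡ cons (cons a x) p₀ × Dom x)

  private
    v₀ : ∀ {n} → Computable {suc n} _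
    v₀ = var· zero
    v₁ : ∀ {n} → Computable {2 + n} _
    v₁ = var· (suc zero)
    v₂ : ∀ {n} → Computable {3 + n} _
    v₂ = var· (suc (suc zero))
    v₃ : ∀ {n} → Computable {4 + n} _
    v₃ = var· (suc (suc (suc zero)))
    v₄ : ∀ {n} → Computable {5 + n} _
    v₄ = var· (suc (suc (suc (suc zero))))

    Holds· : ∀ {f : Vec ℕ n → ℕ} → Computable f → Decidable (λ v → Holds (f v))
    Holds· = sub₁ {P = λ v → Holds (lookup v zero)} (resp· (λ { (c ∷ []) → mk⇔ id id }) (fromComputes diagram))

    Dom· : ∀ {f : Vec ℕ n → ℕ} → Computable f → Decidable (λ v → Dom (f v))
    Dom· c = Holds· (cons· (const· 0) (cons· c (const· 0)))

    Entry· : Decidable {3} λ v → Entry (lookup v zero) (lookup v (suc zero)) (lookup v (suc (suc zero)))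
    Entry· = ∃<· v₀ (nthᶜ· v₀ v₁ ≡· cons· v₂ v₃)

    Matched· : Decidable {3} λ v → Matched (lookup v zero) (lookup v (suc zero)) (lookup v (suc (suc zero)))
    Matched· = ∀<· (v₁ +· v₂) (((dropᶜ· v₀ v₂ ≢0·) ∨· (dropᶜ· v₀ v₃ ≢0·)) ⇒·
      ((dropᶜ· v₀ v₂ ≢0·) ∧· (dropᶜ· v₀ v₃ ≢0·) ∧· sub₃ Entry· v₁ (nthᶜ· v₀ v₂) (nthᶜ· v₀ v₃)))

    Next· : Decidable {3} λ v → Next (lookup v zero) (lookup v (suc zero)) (lookup v (suc (suc zero)))
    Next· = (¬· (Dom· (arg 1)) ∧· (v₀ ≢0·) ∧· v₂ ≡· v₀) ∨·
      (∃<· v₂ (∃<· v₃ (v₄ ≡· cons· (cons· v₁ v₀) v₂ ∧· Dom· v₁ ∧· Dom· v₀ ∧·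
         ((nthᶜ· (const· 0) v₃ ≡· const· 0) ∧· v₁ ≡· nthᶜ· (const· 1) v₃ ∨·
          ((nthᶜ· (const· 0) v₃ ≢0·) ∧· v₀ ≡· nthᶜ· (const· 1) v₃))))
       ∧· (sub₃ Matched· v₂ (arg 4) (arg 5) ⇒·
           ((Holds· (cons· (arg 2) (cons· (arg 3) (arg 4))) ⇔· Holds· (cons· (arg 2) (cons· (arg 3) (arg 5)))) ∧·
            ((tl· (arg 4) ≢0·) ⇒· (hd· (arg 4) ≡· hd· (tl· (arg 4)) ⇔· hd· (arg 5) ≡· hd· (tl· (arg 5)))))))
      where
      arg : ∀ i → Computable {3} λ v → nthᶜ i (lookup v (suc zero))
      arg i = nthᶜ· (const· i) v₁

    Start· : ∀ a p₀ → Decidable {1} λ v → Start a p₀ (lookup v zero)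
    Start· a p₀ = ∃<· v₀ (v₁ ≡· cons· (cons· (const· a) v₀) (const· p₀) ∧· Dom· v₀)

  hd-codeList : ∀ x xs → hd (codeList (x ∷ xs)) ≡ x
  hd-codeList x xs = trans (cong hd (codeList-∷ x xs)) (hd-cons x (codeList xs))

  tl-codeList : ∀ x xs → tl (codeList (x ∷ xs)) ≡ codeList xs
  tl-codeList x xs = trans (cong tl (codeList-∷ x xs)) (tl-cons x (codeList xs))

  codeList-∷∷ : ∀ x y xs → codeList (x ∷ y ∷ xs) ≡ cons x (cons y (codeList xs))
  codeList-∷∷ x y xs = trans (codeList-∷ x (y ∷ xs)) (cong (cons x) (codeList-∷ y xs))

  codeList-∷≢0 : ∀ x xs → codeList (x ∷ xs) ≢ 0
  codeList-∷≢0 x xs e = cons≢0 x (codeList xs) (trans (sym (codeList-∷ x xs)) e)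

  holds : ∀ t k xs → Holds (cons t (cons k (codeList xs))) ⇔ Diagram M ι (t ∷ k ∷ xs)
  holds t k xs = mk⇔
    (λ (ys , e , d) → subst (Diagram M ι)
      (sym (codeList-injective (t ∷ k ∷ xs) ys (trans (codeList-∷∷ t k xs) e))) d)
    (λ d → t ∷ k ∷ xs , sym (codeList-∷∷ t k xs) , d)

  domain : ∀ a → Dom (ι a)
  domain a = from (holds 0 (ι a) []) (dom a)

  domain⁻¹ : ∀ x → Dom x → ∃[ a ] ι a ≡ x
  domain⁻¹ x d = dom⁻¹ x (to (holds 0 x []) d) refl

  nth-pairs : ∀ (v w : Vec (Carrier M) n) j → nth (pairs v w) (toℕ j) ≡ cons (ι (lookup v j)) (ι (lookup w j))
  nth-pairs (a ∷ v) (b ∷ w) zero    = refl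
  nth-pairs (a ∷ v) (b ∷ w) (suc j) = nth-pairs v w j

  length-pairs : ∀ (v w : Vec (Carrier M) n) → length (pairs v w) ≡ n
  length-pairs []      []      = refl
  length-pairs (a ∷ v) (b ∷ w) = cong suc (length-pairs v w)

  nth-pairs⁻¹ : ∀ (v w : Vec (Carrier M) n) i {x y} → nth (pairs v w) i ≡ cons x y →
                ∃[ j ] (x ≡ ι (lookup v j) × y ≡ ι (lookup w j))
  nth-pairs⁻¹ []      []      i       {x} {y} e = ⊥-elim (cons≢0 x y (sym e))
  nth-pairs⁻¹ (a ∷ v) (b ∷ w) zero    {x}     e = let p , q = cons-injective (ι a) x e in zero , sym p , sym q
  nth-pairs⁻¹ (a ∷ v) (b ∷ w) (suc i)         e = let j , p = nth-pairs⁻¹ v w i e in suc j , p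

  entry : ∀ (v w : Vec (Carrier M) n) j → Entry (position v w) (ι (lookup v j)) (ι (lookup w j))
  entry v w j = toℕ j
    , ≤-trans (subst (toℕ j <_) (sym (length-pairs v w)) (toℕ<n j)) (length≤codeList (pairs v w))
    , trans (nthᶜ-codeList (toℕ j) (pairs v w)) (nth-pairs v w j)

  matched : ∀ (v w : Vec (Carrier M) n) is →
            Matched (position v w) (codeList (numbers v is)) (codeList (numbers w is))
  matched v w is i _ i< =
      from (dropᶜ≢0 i (numbers v is)) (subst (i <_) (sym (length-map (ι ∘ lookup v) is)) i<length)
    , from (dropᶜ≢0 i (numbers w is)) (subst (i <_) (sym (length-map (ι ∘ lookup w) is)) i<length)
    , subst₂ (Entry (position v w)) (sym (nthᶜ-codeList i (numbers v is)))
             (sym (nthᶜ-codeList i (numbers w is))) (go is i i<length)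
    where
    i<length : i < length is
    i<length = [ (λ z → subst (i <_) (length-map (ι ∘ lookup v) is) (to (dropᶜ≢0 i (numbers v is)) z))
               , (λ z → subst (i <_) (length-map (ι ∘ lookup w) is) (to (dropᶜ≢0 i (numbers w is)) z)) ]′ i<

    go : ∀ is i → i < length is → Entry (position v w) (nth (numbers v is) i) (nth (numbers w is) i)
    go (j ∷ is) zero    p = entry v w j
    go (j ∷ is) (suc i) p = go is i (s≤s⁻¹ p)

  matched⁻¹ : ∀ (v w : Vec (Carrier M) n) as bs → Matched (position v w) (codeList as) (codeList bs) →
              ∃[ is ] (as ≡ numbers v is × bs ≡ numbers w is)
  matched⁻¹ v w as bs h = go as bs λ i i< →
    let p , q , j , _ , e = h i (bound i i<) (Sum.map (from (dropᶜ≢0 i as)) (from (dropᶜ≢0 i bs)) i<)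
        j′ , r , r′ = nth-pairs⁻¹ v w j (trans (sym (nthᶜ-codeList j (pairs v w))) e)
    in to (dropᶜ≢0 i as) p , to (dropᶜ≢0 i bs) q
     , j′ , trans (sym (nthᶜ-codeList i as)) r , trans (sym (nthᶜ-codeList i bs)) r′
    where
    bound : ∀ i → i < length as ⊎ i < length bs → i < codeList as + codeList bs
    bound i (inj₁ p) = ≤-trans p (≤-trans (length≤codeList as) (m≤m+n _ _))
    bound i (inj₂ p) = ≤-trans p (≤-trans (length≤codeList bs) (m≤n+m _ _))

    go : ∀ as bs → (∀ i → i < length as ⊎ i < length bs → i < length as × i < length bs
           × ∃[ j ] (nth as i ≡ ι (lookup v j) × nth bs i ≡ ι (lookup w j))) →
         ∃[ is ] (as ≡ numbers v is × bs ≡ numbers w is)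
    go []       []       h = [] , refl , refl
    go []       (b ∷ bs) h with () ← proj₁ (h 0 (inj₂ (s≤s z≤n)))
    go (a ∷ as) []       h with () ← proj₁ (proj₂ (h 0 (inj₁ (s≤s z≤n))))
    go (a ∷ as) (b ∷ bs) h =
      let _ , _ , j , p , q = h 0 (inj₁ (s≤s z≤n))
          is , ps , qs = go as bs λ i i< →
            let r , r′ , s = h (suc i) (Sum.map s≤s s≤s i<) in s≤s⁻¹ r , s≤s⁻¹ r′ , s
      in j ∷ is , cong₂ _∷_ p ps , cong₂ _∷_ q qs

  heads : ∀ (v : Vec (Carrier M) n) i j is →
          hd (codeList (numbers v (i ∷ j ∷ is))) ≡ hd (tl (codeList (numbers v (i ∷ j ∷ is))))
          ⇔ lookup v i ≡ lookup v j
  heads v i j is = mk⇔ (λ e → ι-injective (trans (sym first) (trans e second)))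
                       (λ e → trans first (trans (cong ι e) (sym second)))
    where
    first  = hd-codeList (ι (lookup v i)) (numbers v (j ∷ is))
    second = trans (cong hd (tl-codeList (ι (lookup v i)) (numbers v (j ∷ is))))
                   (hd-codeList (ι (lookup v j)) (numbers v is))

  agree : ∀ {v w : Vec (Carrier M) n} → PartialIsomorphism M v M w → ∀ t k A B → Agree (position v w) t k A B
  agree {v = v} {w} iso t k A B h
    with matched⁻¹ v w (decode A) (decode B)
           (subst₂ (Matched (position v w)) (sym (codeList-decode A)) (sym (codeList-decode B)) h)
  ... | is , p , q = subst₂ Conclusion (trans (cong codeList (sym p)) (codeList-decode A))
                                       (trans (cong codeList (sym q)) (codeList-decode B)) (holds⇔ , equal⇔ is)
    where
    Conclusion : ℕ → ℕ → Set
    Conclusion A B = (Holds (cons t (cons k A)) ⇔ Holds (cons t (cons k B)))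
                   × (tl A ≢ 0 → hd A ≡ hd (tl A) ⇔ hd B ≡ hd (tl B))

    holds⇔ : Holds (cons t (cons k (codeList (numbers v is)))) ⇔ Holds (cons t (cons k (codeList (numbers w is))))
    holds⇔ = mk⇔
      (from (holds t k (numbers w is)) ∘ transport iso t k is ∘ to (holds t k (numbers v is)))
      (from (holds t k (numbers v is)) ∘ transport (PartialIsomorphism-sym iso) t k is ∘ to (holds t k (numbers w is)))

    equal⇔ : ∀ is → tl (codeList (numbers v is)) ≢ 0 →
             hd (codeList (numbers v is)) ≡ hd (tl (codeList (numbers v is))) ⇔
             hd (codeList (numbers w is)) ≡ hd (tl (codeList (numbers w is)))
    equal⇔ []           z = ⊥-elim (z tl-0)
    equal⇔ (i ∷ [])     z = ⊥-elim (z (tl-codeList (ι (lookup v i)) []))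
    equal⇔ (i ∷ j ∷ is) _ = mk⇔ (from (heads w i j is) ∘ to (equality iso i j) ∘ to (heads v i j is))
                                (from (heads v i j is) ∘ from (equality iso i j) ∘ to (heads w i j is))

  answer : ∀ {a b s c} (v w : Vec (Carrier M) n) → PartialIsomorphism M (a ∷ v) M (b ∷ w) →
           ((s ≡ 0 × ι a ≡ c) ⊎ (s ≢ 0 × ι b ≡ c)) →
           ∀ t k A B → Answer s c t k A B (position v w) (position (a ∷ v) (b ∷ w))
  answer {a = a} {b} v w iso side t k A B = inj₂
    ( (ι a , subst (ι a <_) (sym e) (<-trans (x<cons (ι a) (ι b)) (x<cons _ _))
      , ι b , subst (ι b <_) (sym e) (<-trans (c<cons (ι a) (ι b)) (x<cons _ _))
      , e , domain a , domain b , side)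
    , agree iso t k A B)
    where
    e = position-∷ a b v w

  -- The tuples are non-empty because the position of the empty ones is 0, which the game excludes.
  BackAndForth⇒Survives : ∀ γ {n} {v w : Vec (Carrier M) (suc n)} → BackAndForth γ M v M w →
                          Survives Next γ (position v w)
  BackAndForth⇒Survives zero    e = tt
  BackAndForth⇒Survives (lim f) e = λ i → BackAndForth⇒Survives (f i) (e i)
  BackAndForth⇒Survives (suc γ) {n} {v@(a₀ ∷ v₀)} {w@(b₀ ∷ w₀)} (e , forth , back) =
      BackAndForth⇒Survives γ e , λ m → reply m (em₀ _) (nthᶜ 0 m ≟ 0)
    where
    reply : ∀ m → Dec (Dom (nthᶜ 1 m)) → Dec (nthᶜ 0 m ≡ 0) →
            ∃[ q ] (Next (position v w) m q × Survives Next γ q)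
    -- Where c is the number of no element, Duplicator stays in place.
    reply m (no ¬d) _ = position v w
      , inj₁ (¬d , codeList-∷≢0 (cons (ι a₀) (ι b₀)) (pairs v₀ w₀) , refl)
      , BackAndForth⇒Survives γ e
    reply m (yes d) (yes s≡0) =
      let a , ιa≡c = domain⁻¹ _ d
          b , e′ = forth a
      in position (a ∷ v) (b ∷ w)
       , answer v w (BackAndForth⇒PartialIsomorphism γ e′) (inj₁ (s≡0 , ιa≡c)) _ _ _ _
       , BackAndForth⇒Survives γ e′
    reply m (yes d) (no s≢0) =
      let b , ιb≡c = domain⁻¹ _ d
          a , e′ = back b
      in position (a ∷ v) (b ∷ w)
       , answer v w (BackAndForth⇒PartialIsomorphism γ e′) (inj₂ (s≢0 , ιb≡c)) _ _ _ _
       , BackAndForth⇒Survives γ e′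

  Partner : ℕ → Carrier M → Carrier M → Carrier M → Set
  Partner s c a b = (s ≡ 0 × a ≡ c) ⊎ (s ≢ 0 × b ≡ c)

  challenge : ∀ {γ} {v w : Vec (Carrier M) n} → Survives Next (suc γ) (position v w) → ∀ s c t k is →
    ∃[ a ] ∃[ b ] (Partner s c a b × Survives Next γ (position (a ∷ v) (b ∷ w))
      × Agree (position (a ∷ v) (b ∷ w)) t k (codeList (numbers v is)) (codeList (numbers w is)))
  challenge {γ = γ} {v} {w} (_ , reply) s c t k is =
    let q , r , u = reply (codeList move) in decodeAnswer q u (decodeMove r)
    where
    A = codeList (numbers v is)
    B = codeList (numbers w is)
    move = s ∷ ι c ∷ t ∷ k ∷ A ∷ B ∷ []

    decodeMove : ∀ {p q} → Next p (codeList move) q → Answer s (ι c) t k A B p q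
    decodeMove r rewrite nthᶜ-codeList 0 move | nthᶜ-codeList 1 move | nthᶜ-codeList 2 move
                       | nthᶜ-codeList 3 move | nthᶜ-codeList 4 move | nthᶜ-codeList 5 move = r

    decodeAnswer : ∀ q → Survives Next γ q → Answer s (ι c) t k A B (position v w) q →
      ∃[ a ] ∃[ b ] (Partner s c a b × Survives Next γ (position (a ∷ v) (b ∷ w))
        × Agree (position (a ∷ v) (b ∷ w)) t k A B)
    decodeAnswer q u (inj₁ (¬d , _)) = ⊥-elim (¬d (domain c))
    decodeAnswer q u (inj₂ ((x , _ , y , _ , e , dx , dy , side) , agrees)) with domain⁻¹ x dx | domain⁻¹ y dy
    ... | a , refl | b , refl = a , b
        , Sum.map (Prod.map₂ ι-injective) (Prod.map₂ ι-injective) side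
        , subst (Survives Next γ) e′ u
        , subst (λ q → Agree q t k A B) e′ agrees
      where
      e′ : q ≡ position (a ∷ v) (b ∷ w)
      e′ = trans e (sym (position-∷ a b v w))

  -- Agreement is tested only in the course of a move, so a round is spent on asking for an
  -- arbitrary element, `point M`. Its pair comes first in the new position, and the indices are
  -- shifted by `suc`.
  agreement : ∀ {v w : Vec (Carrier M) n} → Survives Next (suc zero) (position v w) → ∀ t k is →
    (Diagram M ι (t ∷ k ∷ numbers v is) ⇔ Diagram M ι (t ∷ k ∷ numbers w is))
    × (tl (codeList (numbers v is)) ≢ 0 → hd (codeList (numbers v is)) ≡ hd (tl (codeList (numbers v is)))
                                        ⇔ hd (codeList (numbers w is)) ≡ hd (tl (codeList (numbers w is))))
  agreement {v = v} {w} u t k is =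
    let a , b , _ , _ , agrees = challenge {γ = zero} {v} {w} u 0 (point M) t k is
        h , e = agrees (subst₂ (λ xs ys → Matched (position (a ∷ v) (b ∷ w)) (codeList xs) (codeList ys))
                          (numbers-suc a v is) (numbers-suc b w is) (matched (a ∷ v) (b ∷ w) (List.map suc is)))
    in mk⇔ (to (holds t k (numbers w is)) ∘ to h ∘ from (holds t k (numbers v is)))
           (to (holds t k (numbers v is)) ∘ from h ∘ from (holds t k (numbers w is))) , e

  Survives⇒PartialIsomorphism : ∀ {v w : Vec (Carrier M) n} → Survives Next (suc zero) (position v w) →
                                PartialIsomorphism M v M w
  Survives⇒PartialIsomorphism {n} {v} {w} u = record
    { equality = λ i j →
        let d = proj₂ (agreement {v = v} {w} u 0 0 (i ∷ j ∷ [])) λ z →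
                  codeList-∷≢0 (ι (lookup v j)) [] (trans (sym (tl-codeList (ι (lookup v i)) (numbers v (j ∷ [])))) z) in
        mk⇔ (to (heads w i j []) ∘ to d ∘ from (heads v i j []))
            (to (heads v i j []) ∘ from d ∘ from (heads w i j []))
    ; relation = λ R is →
        let d = proj₁ (agreement {v = v} {w} u 1 (codeʳ τ R) (Vec.toList is)) in
        mk⇔ (relation⁻¹ w R is ∘ to d ∘ relation⁺ v R is) (relation⁻¹ v R is ∘ from d ∘ relation⁺ w R is)
    ; function = λ f is j →
        let d = proj₁ (agreement {v = v} {w} u 2 (codeᶠ τ f) (j ∷ Vec.toList is)) in
        mk⇔ (function⁻¹ w f is j ∘ to d ∘ function⁺ v f is j) (function⁻¹ v f is j ∘ from d ∘ function⁺ w f is j)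
    }
    where
    relation⁺ : ∀ (v : Vec (Carrier M) n) R is → relᴹ M R (Vec.map (lookup v) is) →
                Diagram M ι (1 ∷ codeʳ τ R ∷ numbers v (Vec.toList is))
    relation⁺ v R is r = subst (λ xs → Diagram M ι (1 ∷ codeʳ τ R ∷ xs)) (sym (numbers-toList v is)) (rel R _ r)

    relation⁻¹ : ∀ (v : Vec (Carrier M) n) R is → Diagram M ι (1 ∷ codeʳ τ R ∷ numbers v (Vec.toList is)) →
                 relᴹ M R (Vec.map (lookup v) is)
    relation⁻¹ v R is d = rel⁻¹ R _ d (cong (λ xs → 1 ∷ codeʳ τ R ∷ xs) (numbers-toList v is))

    function⁺ : ∀ (v : Vec (Carrier M) n) f is j → funᴹ M f (Vec.map (lookup v) is) ≡ lookup v j →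
                Diagram M ι (2 ∷ codeᶠ τ f ∷ numbers v (j ∷ Vec.toList is))
    function⁺ v f is j e = subst₂ (λ x xs → Diagram M ι (2 ∷ codeᶠ τ f ∷ x ∷ xs)) (cong ι e)
                             (sym (numbers-toList v is)) (fun f _)

    function⁻¹ : ∀ (v : Vec (Carrier M) n) f is j → Diagram M ι (2 ∷ codeᶠ τ f ∷ numbers v (j ∷ Vec.toList is)) →
                 funᴹ M f (Vec.map (lookup v) is) ≡ lookup v j
    function⁻¹ v f is j d = fun⁻¹ f _ _ d (cong (λ xs → 2 ∷ codeᶠ τ f ∷ ι (lookup v j) ∷ xs) (numbers-toList v is))

  -- The surplus round pays for the test of atomic formulas at the end.
  Survives⇒BackAndForth : ∀ γ {n} {v w : Vec (Carrier M) n} → Survives Next (suc γ) (position v w) →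
                          BackAndForth γ M v M w
  Survives⇒BackAndForth zero    {v = v} {w} u = Survives⇒PartialIsomorphism {v = v} {w} u
  Survives⇒BackAndForth (lim f) {v = v} {w} u = λ i → Survives⇒BackAndForth (f i) {v = v} {w}
    (Survives-mono (suc (lim f)) (suc (f i)) (≤ᵒ-lim (f i) i (≤ᵒ-refl (f i))) u)
  Survives⇒BackAndForth (suc γ) {v = v} {w} u = Survives⇒BackAndForth γ {v = v} {w} (proj₁ u) , forth , back
    where
    forth : ∀ a → ∃[ b ] BackAndForth γ M (a ∷ v) M (b ∷ w)
    forth a with challenge {γ = suc γ} {v} {w} u 0 a 0 0 []
    ... | _ , b , inj₁ (_ , refl) , u′ , _ = b , Survives⇒BackAndForth γ {v = a ∷ v} {b ∷ w} u′
    ... | _ , _ , inj₂ (0≢0 , _) , _ = ⊥-elim (0≢0 refl)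
    back : ∀ b → ∃[ a ] BackAndForth γ M (a ∷ v) M (b ∷ w)
    back b with challenge {γ = suc γ} {v} {w} u 1 b 0 0 []
    ... | a , _ , inj₂ (_ , refl) , u′ , _ = a , Survives⇒BackAndForth γ {v = a ∷ v} {b ∷ w} u′
    ... | _ , _ , inj₁ (() , _) , _

  homogeneous : ∀ {v w : Vec (Carrier M) n} → (∀ γ → γ <ᵒ ω₁ → BackAndForth γ M v M w) →
                ∀ a → ∃[ b ] (∀ γ → γ <ᵒ ω₁ → BackAndForth γ M (a ∷ v) M (b ∷ w))
  homogeneous {v = v} {w} e a = extract (Game.boundedness starts)
    where
    open ComputableOrdinals.FirstNoncomputable em X ω₁ isΩ₁ using (ω₁-limit)

    p₀ = position v w

    start≢0 : ∀ {p} → Start (ι a) p₀ p → p ≢ 0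
    start≢0 (x , _ , e , _) p≡0 = cons≢0 (cons (ι a) x) p₀ (trans (sym e) p≡0)

    next≢0 : ∀ {p m q} → Next p m q → q ≢ 0
    next≢0 (inj₁ (_ , p≢0 , e))                   q≡0 = p≢0 (trans (sym e) q≡0)
    next≢0 {p} (inj₂ ((x , _ , y , _ , e , _) , _)) q≡0 = cons≢0 (cons x y) p (trans (sym e) q≡0)

    module Game = GameBoundedness em X ω₁ isΩ₁ (Start (ι a) p₀) Next (Start· (ι a) p₀) Next· start≢0
                    (λ {p} {m} {q} → next≢0 {p} {m} {q})

    starts : ∀ γ → γ <ᵒ ω₁ → ∃[ p ] (Start (ι a) p₀ p × Survives Next γ p)
    -- Choosing the partner of a costs one level, so the hypothesis is used at `suc γ`, still below
    -- `ω₁`.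
    starts γ γ<ω₁ = let b , e′ = proj₁ (proj₂ (e (suc γ) (ω₁-limit γ γ<ω₁))) a in
      position (a ∷ v) (b ∷ w)
      , (ι b , subst (ι b <_) (sym (position-∷ a b v w)) (<-trans (c<cons (ι a) (ι b)) (x<cons _ _))
        , position-∷ a b v w , domain b)
      , BackAndForth⇒Survives γ e′

    extract : ∃[ p ] (Start (ι a) p₀ p × (∀ γ → Survives Next γ p)) →
              ∃[ b ] (∀ γ → γ <ᵒ ω₁ → BackAndForth γ M (a ∷ v) M (b ∷ w))
    extract (p , (x , _ , p≡ , d) , u) with domain⁻¹ x d
    ... | b , refl = b , λ γ _ → Survives⇒BackAndForth γ {v = a ∷ v} {b ∷ w}
      (subst (Survives Next (suc γ)) (trans p≡ (sym (position-∷ a b v w))) (u (suc γ)))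

IsΩ₁ᴹ-limit : ExcludedMiddle (lsuc 0ℓ) → ∀ {τ} {M : Structure τ} δ → IsΩ₁ᴹ M δ →
              ∀ γ → γ <ᵒ δ → suc γ <ᵒ δ
IsΩ₁ᴹ-limit em δ ((X , _ , isΩ₁) , _) = ComputableOrdinals.FirstNoncomputable.ω₁-limit em X δ isΩ₁

-- Models of the limit of a branch

module LimitNode (em : ExcludedMiddle (lsuc 0ℓ)) {τ : Vocabulary} {φ : Sentence τ} {T : Ord → Theory τ}
                 (branch : IsBranch φ T) (δ : Ord) (limit : IsLimit δ) where
  open Classical em
  open Types em
  open Branches em branch
  open IsBranch branch

  private variable
    n m : ℕ

  lang-below : ∀ {n A} → lang (T δ) n A → ∃[ γ ] (γ <ᵒ δ × lang (T γ) n A)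
  lang-below = to (proj₁ (T-lim δ limit) _ _)

  thm-limit : ∀ {γ A} → γ <ᵒ δ → thm (T γ) A → thm (T δ) A
  thm-limit {γ} γ<δ t = from (proj₂ (T-lim δ limit) _) (γ , γ<δ , t)

  -- A formula of the limit node already occurs below δ, where the next successor level is a
  -- fragment and is still below δ.
  lang-closed : ∀ {A : Formula τ n} {B : Formula τ m} →
                (∀ {L} → IsFragment L → L n A → L m B) → lang (T δ) n A → lang (T δ) m B
  lang-closed closed l = let γ , γ<δ , l′ = lang-below l in
    lang-limit δ limit (proj₂ limit γ γ<δ)
      (closed (IsωComplete.fragment (complete-suc γ)) (lang-suc γ l′))

  lang-¬ : ∀ (A : Formula τ n) → lang (T δ) n A → lang (T δ) n (¬̇ A)
  lang-¬ A = lang-closed λ F → IsFragment.¬-in F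

  complete : ∀ {A} → lang (T δ) 0 A → thm (T δ) A ⊎ thm (T δ) (¬̇ A)
  complete {A} l = let γ , γ<δ , l′ = lang-below l in
    Sum.map (thm-limit (proj₂ limit γ γ<δ)) (thm-limit (proj₂ limit γ γ<δ))
      (IsωComplete.complete (complete-suc γ) A (lang-suc γ l′))

  close-in : ∀ {L : FormulaSet τ} → IsFragment L → ∀ n {A} → L n A → L 0 (close n A)
  close-in F zero    l = l
  close-in F (suc n) l = close-in F n (IsFragment.¬-in F (IsFragment.∃-in F (IsFragment.¬-in F l)))

  module _ {M N : Structure τ} (M⊨T : M ⊨ᵀ T δ) (N⊨T : N ⊨ᵀ T δ) where

    _~_ : Vec (Carrier M) n → Vec (Carrier N) n → Set
    v ~ w = ∀ γ → γ <ᵒ δ → BackAndForth γ M v N w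

    sameType⇒~ : {v : Vec (Carrier M) n} {w : Vec (Carrier N) n} → SameType (lang (T δ)) M v N w → v ~ w
    sameType⇒~ s γ γ<δ = sameType⇒BackAndForth γ models (weaken (lang-limit δ limit (proj₂ limit γ γ<δ)) s)
      where
      models : ∀ β → β ≤ᵒ suc γ → M ⊨ᵀ T β × N ⊨ᵀ T β
      models β β≤γ = (λ A t → M⊨T A (thm-limit β<δ t)) , (λ A t → N⊨T A (thm-limit β<δ t))
        where
        β<δ = ≤ᵒ-trans (suc β) (suc (suc γ)) δ β≤γ (proj₂ limit γ γ<δ)

    []~[] : [] ~ []
    []~[] = sameType⇒~ (sameType lang-¬ transfer-sentence)
      where
      transfer-sentence : ∀ A → lang (T δ) 0 A → M ⊨ A [ [] ] → N ⊨ A [ [] ]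
      transfer-sentence A l p with complete l
      ... | inj₁ t  = N⊨T A t
      ... | inj₂ ¬t = ⊥-elim (M⊨T (¬̇ A) ¬t p)

    -- A realization b′, w′ in N of the type of a, v only has w′ ~ w; homogeneity of N moves w′ to w.
    forth : IsΩ₁ᴹ N δ → RealizesEveryType N (T δ) →
            {v : Vec (Carrier M) n} {w : Vec (Carrier N) n} → v ~ w → ∀ a → ∃[ b ] (a ∷ v) ~ (b ∷ w)
    forth {n} ((X , (ι , ι-inj , diagram) , isΩ₁) , _) realizes {v} {w} v~w a
      with realizes (suc n) (s≤s z≤n) (typeOf (lang (T δ)) M (a ∷ v))
             (realized-isType M (a ∷ v) M⊨T lang-¬ λ A → mk⇔ id id)
    ... | b′ ∷ w′ , realized =
      let b , b′w′~bw = homogeneous (λ γ γ<δ → BackAndForth-trans γ (BackAndForth-sym γ (v~w′ γ γ<δ)) (v~w γ γ<δ)) b′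
      in b , λ γ γ<δ → BackAndForth-trans γ (av~b′w′ γ γ<δ) (b′w′~bw γ γ<δ)
      where
      open Homogeneity em N X ι ι-inj diagram δ isΩ₁ using (homogeneous)

      same-av : SameType (lang (T δ)) M (a ∷ v) N (b′ ∷ w′)
      same-av = sameType lang-¬ λ A l p → realized A (l , p)

      av~b′w′ : (a ∷ v) ~ (b′ ∷ w′)
      av~b′w′ = sameType⇒~ same-av

      -- A formula about v is one about a, v in which the new variable is skipped.
      v~w′ : v ~ w′
      v~w′ = sameType⇒~ (sameType lang-¬ λ A l p →
        to (⊨-weaken N b′ w′ A) (to (transfer same-av (ren suc A)
             (lang-closed (λ F → IsFragment.sub-in F (var ∘ suc)) l)) (from (⊨-weaken M a v A) p)))

  unique : {M N : Structure τ} → M ⊨ᵀ T δ → N ⊨ᵀ T δ → IsΩ₁ᴹ M δ → IsΩ₁ᴹ N δ →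
           RealizesEveryType M (T δ) → RealizesEveryType N (T δ) → M ≅ N
  unique {M} {N} M⊨T N⊨T ω₁ᴹ ω₁ᴺ realizesᴹ realizesᴺ = Zigzag.isomorphism em M N
    (_~_ M⊨T N⊨T) ([]~[] M⊨T N⊨T)
    (λ v~w → v~w zero (proj₁ limit))
    (λ v~w → forth M⊨T N⊨T ω₁ᴺ realizesᴺ v~w)
    (λ v~w b → let a , w~v = forth N⊨T M⊨T ω₁ᴹ realizesᴹ (λ γ γ<δ → BackAndForth-sym γ (v~w γ γ<δ)) b
               in a , λ γ γ<δ → BackAndForth-sym γ (w~v γ γ<δ))

  -- Principal types are realized in every model: by completeness `T δ` either refutes the
  -- generator, against consistency of the type, or asserts that it is satisfiable.
  realizesEveryType : {M : Structure τ} → M ⊨ᵀ T δ → RealizesEveryNonPrincipalType M (T δ) →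
                      RealizesEveryType M (T δ)
  realizesEveryType {M} M⊨T realizes n _ p t = decide (em₀ (Principal (T δ) n p))
    where
    decide : Dec (Principal (T δ) n p) → Realizes M n p
    decide (no ¬g) = realizes n p (t , ¬g)
    decide (yes g@(θ , pθ , _)) =
      let v , q = satisfiable (complete (lang-closed (λ F → close-in F n ∘ IsFragment.¬-in F) (IsType.in-lang t θ pθ)))
      in v , principal-realized {S = T δ} {p = p} {w = v} M⊨T g q
      where
      satisfiable : thm (T δ) (close n (¬̇ θ)) ⊎ thm (T δ) (¬̇ close n (¬̇ θ)) → ∃[ v ] M ⊨ θ [ v ]
      satisfiable (inj₁ s)  = ⊥-elim (type-consistent-with-theory t pθ s)
      satisfiable (inj₂ ¬s) = stable λ ¬∃ → M⊨T _ ¬s (from (⊨-close em M n) λ v q → ¬∃ (v , q))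

mainTheorem5 : ExcludedMiddle (lsuc 0ℓ) → (τ : Vocabulary) (φ : Sentence τ) → MinimalCounterexample φ → (𝒟 : SacksData φ) (let open SacksData 𝒟) (λ′ : Ord) → InS° φ 𝒟 λ′ →
    ((M M′ : Structure τ) → M ⊨ᵀ T λ′ → M′ ⊨ᵀ T λ′ → IsΩ₁ᴹ M λ′ → IsΩ₁ᴹ M′ λ′ → RealizesEveryType M (T λ′) → RealizesEveryType M′ (T λ′) → M ≅ M′)
    × (RealizesEveryType (B λ′) (T λ′) × IsΩ₁ᴹ (B λ′) λ′)
    × (B λ′ ⊨ᵀ T λ′ × ((M : Structure τ) → M ⊨ᵀ T λ′ → IsΩ₁ᴹ M λ′ → RealizesEveryType M (T λ′) → M ≅ B λ′))
mainTheorem5 em τ φ _ 𝒟 λ′ (_ , λ′∈C , _) =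
    (λ M M′ → unique)
  , (realizesB , B-ω₁ λ′ λ′∈C)
  , B-model λ′ λ′∈C
  , λ M M⊨T ω₁ᴹ realizes → unique M⊨T (B-model λ′ λ′∈C) ω₁ᴹ (B-ω₁ λ′ λ′∈C) realizes realizesB
  where
  open SacksData 𝒟

  limit : IsLimit λ′
  -- Closure under successor comes from the model `B λ′`, whose ω₁ is `λ′`: the successor of an
  -- ordinal computable in X is computable in X.
  limit = ≤ᵒ-trans (suc zero) (suc ω) λ′ tt (C-above-ω λ′ λ′∈C) , IsΩ₁ᴹ-limit em λ′ (B-ω₁ λ′ λ′∈C)

  open LimitNode em branch λ′ limit

  realizesB : RealizesEveryType (B λ′) (T λ′)
  realizesB = realizesEveryType (B-model λ′ λ′∈C) (B-types λ′ λ′∈C)
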